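{- Let $n\ge 6$ be an even integer, let $c$ be an integer with $1<c<n/2$, let $S=\{\pm 1,\pm c,n/2\}\subseteq\mathbb{Z}_n$, and assume that $\Gamma=\mathrm{Cay}(\mathbb{Z}_n;S)$ is closed distance magic. Then there exists $j\in\mathcal{J}_n(S)$ which is of type $2$ or of type $3^+$.
   Context: $\mathrm{Cay}(\mathbb{Z}_n;S)$ is the graph with vertex set $\mathbb{Z}_n$ in which $g,h$ are adjacent iff $h-g\in S$. A graph $\Gamma=(V,E)$ of order $n$ is closed distance magic if there are a bijection $\ell:V\to\{1,\ldots,n\}$ and a positive integer $r$ such that for all $u\in V$ the sum of the labels of $u$ and all its neighbors equals $r$. For $0\le j\le n-1$ let $\chi_j(x)=\cos(2\pi xj/n)+\mathbf{i}\sin(2\pi xj/n)$ and $\chi_j(S)=\sum_{x\in S}\chi_j(x)$; $\mathcal{J}_n(S)$ is the set of $j\in\{0,\ldots,n-1\}$ with $\chi_j(S)=-1$. An even $j\in\mathcal{J}_n(S)$ is of type $2$ if $\{\frac{2\pi j}{n},\frac{2\pi jc}{n}\}=\{\pm\frac{2\pi}{3}+2k_1\pi,\pm\frac{2\pi}{3}+2k_2\pi\}$ for some $k_1,k_2\in\mathbb{Z}$ and some (independent) choice of signs. An odd $j\in\mathcal{J}_n(S)$ is of type $3^+$ if $j=\frac{n(2k+1)}{2(c+1)}$ for some $k\in\mathbb{Z}$. -}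

module Defs where

open import Algebra.Bundles.Raw using (RawMonoid)
open import Algebra.Definitions.RawMonoid using (sum)
open import Data.Bool.Base using (if_then_else_)
open import Data.Fin.Base using (Fin; toℕ; fromℕ<)
open import Data.Fin.Properties using (_≟_)
open import Data.Fin.Subset using (Subset; _∈_; _∪_; ⁅_⁆)
open import Data.Fin.Subset.Properties using (_∈?_)
open import Data.Integer.Base as ℤ using (ℤ; +_; -[1+_]; _◃_)
import Data.Integer.DivMod as ℤ
import Data.Integer.Properties as ℤ
open import Data.Nat.Base as ℕ using (ℕ; zero; suc; NonZero)
open import Data.Nat.Coprimality using (sym; 1-coprimeTo)
open import Data.Nat.Divisibility using (_∣_)
import Data.Nat.DivMod as ℕ
import Data.Nat.Properties as ℕ
open import Data.Product.Base using (Σ; ∃; ∃-syntax; _×_; _,_; proj₁; proj₂)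
open import Data.Rational.Base
  using (ℚ; mkℚ; 0ℚ; 1ℚ; ½; _/_; _+_; _*_; _-_; -_; ∣_∣; _≤_; _<_; 1/_; *≤*; *<*;
         positive; nonNegative; >-nonZero)
  renaming (Positive to Positiveℚ)
open import Data.Rational.Properties hiding (_≟_)
open import Data.Rational.Solver using (module +-*-Solver)
open import Data.Sign.Base using (Sign)
open import Data.Sum.Base using (_⊎_; inj₁; inj₂)
open import Data.Vec.Base using (lookup; tabulate)
open import Function.Bundles using (_⤖_; _⇔_; module Bijection)
open import Level using (0ℓ)
open import Relation.Binary.Core using (Rel)
open import Relation.Binary.Definitions using (Decidable)
open import Relation.Binary.PropositionalEquality
  using (_≡_; refl; cong; cong₂; subst; subst₂; trans)
  renaming (sym to ≡-sym)
open import Relation.Nullary.Decidable using (does; _⊎-dec_; toWitness)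
open import Relation.Nullary.Negation using (¬_)

module Estimates where

  0≤1 : 0ℚ ≤ 1ℚ
  0≤1 = toWitness {a? = 0ℚ ≤? 1ℚ} _

  0≤½ : 0ℚ ≤ ½
  0≤½ = toWitness {a? = 0ℚ ≤? ½} _

  ≤-cong : ∀ {p q r s} → p ≡ q → r ≡ s → q ≤ s → p ≤ r
  ≤-cong refl refl q≤s = q≤s

  *-monoˡ : ∀ {r p q} → 0ℚ ≤ r → p ≤ q → r * p ≤ r * q
  *-monoˡ {r} 0≤r = *-monoˡ-≤-nonNeg r {{nonNegative 0≤r}}

  *-monoʳ : ∀ {r p q} → 0ℚ ≤ r → p ≤ q → p * r ≤ q * r
  *-monoʳ {r} 0≤r = *-monoʳ-≤-nonNeg r {{nonNegative 0≤r}}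

  *-mono : ∀ {p q r s} → 0ℚ ≤ q → 0ℚ ≤ r → p ≤ q → r ≤ s → p * r ≤ q * s
  *-mono 0≤q 0≤r p≤q r≤s = ≤-trans (*-monoʳ 0≤r p≤q) (*-monoˡ 0≤q r≤s)

  *-nonNeg : ∀ {p q} → 0ℚ ≤ p → 0ℚ ≤ q → 0ℚ ≤ p * q
  *-nonNeg {p} 0≤p 0≤q = ≤-cong (≡-sym (*-zeroʳ p)) refl (*-monoˡ 0≤p 0≤q)

  +-nonNeg : ∀ {p q} → 0ℚ ≤ p → 0ℚ ≤ q → 0ℚ ≤ p + q
  +-nonNeg 0≤p 0≤q = +-mono-≤ 0≤p 0≤q

  p≤p+q : ∀ {p q} → 0ℚ ≤ q → p ≤ p + q
  p≤p+q {p} 0≤q = ≤-cong (≡-sym (+-identityʳ p)) refl (+-monoʳ-≤ p 0≤q)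

  p≤q+p : ∀ {p q} → 0ℚ ≤ q → p ≤ q + p
  p≤q+p {p} {q} 0≤q = ≤-trans (p≤p+q 0≤q) (≤-reflexive (+-comm p q))

  p≤∣p∣ : ∀ p → p ≤ ∣ p ∣
  p≤∣p∣ p with ≤-total 0ℚ p
  ... | inj₁ 0≤p = ≤-reflexive (≡-sym (0≤p⇒∣p∣≡p 0≤p))
  ... | inj₂ p≤0 = ≤-trans p≤0 (0≤∣p∣ p)

  -- ∣ p ∣ ≤ r from  - r ≤ p ≤ r
  abs-≤ : ∀ {p r} → - r ≤ p → p ≤ r → ∣ p ∣ ≤ r
  abs-≤ {p} {r} -r≤p p≤r with ∣p∣≡p∨∣p∣≡-p p
  ... | inj₁ eq = ≤-cong eq refl p≤r
  ... | inj₂ eq = ≤-cong eq (solve 1 (λ x → x := :- (:- x)) refl r) (neg-antimono-≤ -r≤p)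
    where open +-*-Solver

  abs-split : ∀ p q r → ∣ p - r ∣ ≤ ∣ p - q ∣ + ∣ q - r ∣
  abs-split p q r =
    ≤-cong (cong ∣_∣ (solve 3 (λ x y z → x :- z := (x :- y) :+ (y :- z)) refl p q r))
           refl (∣p+q∣≤∣p∣+∣q∣ (p - q) (q - r))
    where open +-*-Solver

  abs-flip : ∀ p q → ∣ p - q ∣ ≡ ∣ q - p ∣
  abs-flip p q = trans
    (cong ∣_∣ (solve 2 (λ x y → x :- y := :- (y :- x)) refl p q)) (∣-p∣≡∣p∣ (q - p))
    where open +-*-Solver

  halves : ∀ ε → ½ * ε + ½ * ε ≡ ε
  halves = solve 1 (λ x → con ½ :* x :+ con ½ :* x := x) refl
    where open +-*-Solver

  *-pos : ∀ {p q} → 0ℚ < p → 0ℚ < q → 0ℚ < p * q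
  *-pos {p} {q} 0<p 0<q =
    positive⁻¹ (p * q) {{pos*pos⇒pos p {{positive 0<p}} q {{positive 0<q}}}}

  0<½ : 0ℚ < ½
  0<½ = toWitness {a? = 0ℚ <? ½} _

  ι : ℕ → ℚ
  ι zero    = 0ℚ
  ι (suc n) = 1ℚ + ι n

  ι≡ : ∀ n → ι n ≡ mkℚ (+ n) 0 (sym (1-coprimeTo n))
  ι≡ zero    = refl
  ι≡ (suc n) rewrite ι≡ n =
    trans (cong (λ z → (+ 1 ℤ.+ z) / 1) (ℤ.*-identityʳ (+ n)))
          (↥p/↧p≡p (mkℚ (+ suc n) 0 (sym (1-coprimeTo (suc n)))))

  0≤ι : ∀ n → 0ℚ ≤ ι n
  0≤ι zero    = ≤-refl
  0≤ι (suc n) = +-nonNeg 0≤1 (0≤ι n)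

  ι-+ : ∀ m n → ι (m ℕ.+ n) ≡ ι m + ι n
  ι-+ zero    n = ≡-sym (+-identityˡ (ι n))
  ι-+ (suc m) n = trans (cong (λ z → 1ℚ + z) (ι-+ m n)) (≡-sym (+-assoc 1ℚ (ι m) (ι n)))

  archimedean : ∀ p → ∃[ n ] p ≤ ι n
  archimedean (mkℚ -[1+ m ] d _) = 0 , *≤* ℤ.-≤+
  archimedean p@(mkℚ (+ m) d _)  = m , subst (p ≤_) (≡-sym (ι≡ m)) (*≤* (ℤ.*-monoˡ-≤-nonNeg (+ m) (ℤ.+≤+ (ℕ.s≤s ℕ.z≤n))))

  ι-inverse : ∀ i → ι (suc i) * (+ 1 / suc i) ≡ 1ℚ
  ι-inverse i = trans
    (cong₂ _*_ (ι≡ (suc i)) (↥p/↧p≡p (mkℚ (+ 1) i (1-coprimeTo (suc i)))))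
    (*-inverseʳ (mkℚ (+ suc i) 0 (sym (1-coprimeTo (suc i)))))

  0≤1/ : ∀ i → 0ℚ ≤ + 1 / suc i
  0≤1/ i = subst (0ℚ ≤_) (≡-sym (↥p/↧p≡p (mkℚ (+ 1) i (1-coprimeTo (suc i)))))
    (*≤* (ℤ.+≤+ ℕ.z≤n))

  half^ : ℕ → ℚ
  half^ zero    = 1ℚ
  half^ (suc k) = ½ * half^ k

  0<half^ : ∀ k → 0ℚ < half^ k
  0<half^ zero    = toWitness {a? = 0ℚ <? 1ℚ} _
  0<half^ (suc k) = *-pos 0<½ (0<half^ k)

  half^≤1 : ∀ k → half^ k ≤ 1ℚ
  half^≤1 zero    = ≤-refl
  half^≤1 (suc k) = ≤-trans (*-monoˡ 0≤½ (half^≤1 k)) (toWitness {a? = ½ * 1ℚ ≤? 1ℚ} _)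

  ι*half^ : ∀ k → ι k * half^ k ≤ 1ℚ
  ι*half^ zero    = 0≤1
  ι*half^ (suc k) = ≤-cong
    (solve 2 (λ m h → (con 1ℚ :+ m) :* (con ½ :* h) := con ½ :* h :+ con ½ :* (m :* h))
           refl (ι k) (half^ k))
    (≡-sym (halves 1ℚ))
    (+-mono-≤ (*-monoˡ 0≤½ (half^≤1 k)) (*-monoˡ 0≤½ (ι*half^ k)))
    where open +-*-Solver

  half^→0 : ∀ C {ε} → 0ℚ < ε → ∃[ k ] C * half^ k < ε
  half^→0 C {ε} 0<ε = suc k , <-≤-trans
      (*-monoˡ-<-pos (half^ (suc k)) {{positive (0<half^ (suc k))}} C<)
      (≤-cong (solve 3 (λ e m h → (e :* m) :* h := e :* (m :* h)) refl ε (ι (suc k)) (half^ (suc k)))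
              (≡-sym (*-identityʳ ε))
              (*-monoˡ (<⇒≤ 0<ε) (ι*half^ (suc k))))
    where
    open +-*-Solver
    instance
      ε≢0 : Data.Rational.Base.NonZero ε
      ε≢0 = >-nonZero 0<ε
    k = proj₁ (archimedean (C * 1/ ε))
    C≤ : C ≤ ε * ι k
    C≤ = ≤-cong
      (trans (≡-sym (*-identityʳ C)) (trans (cong (C *_) (≡-sym (*-inverseˡ ε)))
        (solve 3 (λ c i e → c :* (i :* e) := e :* (c :* i)) refl C (1/ ε) ε)))
      refl (*-monoˡ (<⇒≤ 0<ε) (proj₂ (archimedean (C * 1/ ε))))
    C< : C < ε * ι (suc k)
    C< = ≤-<-trans C≤ (*-monoʳ-<-pos ε {{positive 0<ε}}
      (subst (_< 1ℚ + ι k) (+-identityˡ (ι k)) (+-monoˡ-< (ι k) (toWitness {a? = 0ℚ <? 1ℚ} _))))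

open Estimates

Cauchy : (ℕ → ℚ) → Set
Cauchy s = ∀ {ε} → 0ℚ < ε →
  ∃[ N ] ∀ m n → N ℕ.≤ m → N ℕ.≤ n → ∣ s m - s n ∣ < ε

record ℝ : Set where
  constructor mkℝ
  field
    seq    : ℕ → ℚ
    cauchy : Cauchy seq

open ℝ public

infix 4 _≈_

_≈_ : Rel ℝ 0ℓ
x ≈ y = ∀ {ε} → 0ℚ < ε → ∃[ N ] ∀ n → N ℕ.≤ n → ∣ seq x n - seq y n ∣ < ε

module Sequences where

  -- It suffices to compare indices m ≥ n.
  cauchy-ordered : ∀ {s} →
    (∀ {ε} → 0ℚ < ε → ∃[ N ] ∀ n k → N ℕ.≤ n → ∣ s (n ℕ.+ k) - s n ∣ < ε) → Cauchy s
  cauchy-ordered {s} h {ε} 0<ε = N , bound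
    where
    N = proj₁ (h 0<ε)
    go : ∀ m n → N ℕ.≤ n → n ℕ.≤ m → ∣ s m - s n ∣ < ε
    go m n N≤n n≤m =
      subst (λ i → ∣ s i - s n ∣ < ε) (ℕ.m+[n∸m]≡n n≤m) (proj₂ (h 0<ε) n (m ℕ.∸ n) N≤n)
    bound : ∀ m n → N ℕ.≤ m → N ℕ.≤ n → ∣ s m - s n ∣ < ε
    bound m n N≤m N≤n with ℕ.≤-total n m
    ... | inj₁ n≤m = go m n N≤n n≤m
    ... | inj₂ m≤n = subst (_< ε) (abs-flip (s n) (s m)) (go n m N≤m m≤n)

  -- Sequences whose increments decay geometrically from index K on.
  module Geometric (s : ℕ → ℚ) (K : ℕ) (C : ℚ) (0≤C : 0ℚ ≤ C)
    (step : ∀ k → ∣ s (suc (K ℕ.+ k)) - s (K ℕ.+ k) ∣ ≤ C * half^ k) where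

    open +-*-Solver

    2C = C + C

    increment : ∀ k i → ∣ s (K ℕ.+ k ℕ.+ i) - s (K ℕ.+ k) ∣ ≤ 2C * half^ k - 2C * half^ (k ℕ.+ i)
    increment k zero rewrite ℕ.+-identityʳ (K ℕ.+ k) | ℕ.+-identityʳ k =
      ≤-reflexive (trans (cong ∣_∣ (+-inverseʳ (s (K ℕ.+ k)))) (≡-sym (+-inverseʳ (2C * half^ k))))
    increment k (suc i) rewrite ℕ.+-suc (K ℕ.+ k) i | ℕ.+-suc k i =
      ≤-trans (abs-split (s (suc (K ℕ.+ k ℕ.+ i))) (s (K ℕ.+ k ℕ.+ i)) (s (K ℕ.+ k)))
        (≤-trans (+-mono-≤ step′ (increment k i))
          (≤-reflexive (solve 3 (λ c h h′ →
             c :* h′ :+ ((c :+ c) :* h :- (c :+ c) :* h′)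
               := (c :+ c) :* h :- (c :+ c) :* (con ½ :* h′)) refl C (half^ k) (half^ (k ℕ.+ i)))))
      where
      step′ : ∣ s (suc (K ℕ.+ k ℕ.+ i)) - s (K ℕ.+ k ℕ.+ i) ∣ ≤ C * half^ (k ℕ.+ i)
      step′ = subst (λ j → ∣ s (suc j) - s j ∣ ≤ C * half^ (k ℕ.+ i))
                (≡-sym (ℕ.+-assoc K k i)) (step (k ℕ.+ i))

    0≤2C : 0ℚ ≤ 2C
    0≤2C = +-nonNeg 0≤C 0≤C

    increment≤ : ∀ k i → ∣ s (K ℕ.+ k ℕ.+ i) - s (K ℕ.+ k) ∣ ≤ 2C * half^ k
    increment≤ k i = ≤-trans (increment k i)
      (≤-cong refl (≡-sym (+-identityʳ (2C * half^ k)))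
        (+-monoʳ-≤ (2C * half^ k)
          (neg-antimono-≤ (*-nonNeg 0≤2C (<⇒≤ (0<half^ (k ℕ.+ i)))))))

    isCauchy : Cauchy s
    isCauchy = cauchy-ordered {s} λ {ε} 0<ε →
      let k , small = half^→0 2C 0<ε in
      K ℕ.+ k , λ n i K+k≤n →
        let j = n ℕ.∸ (K ℕ.+ k)
            n≡ : K ℕ.+ (k ℕ.+ j) ≡ n
            n≡ = trans (≡-sym (ℕ.+-assoc K k j)) (ℕ.m+[n∸m]≡n K+k≤n)
        in subst (λ n → ∣ s (n ℕ.+ i) - s n ∣ < ε) n≡
             (≤-<-trans (increment≤ (k ℕ.+ j) i)
               (≤-<-trans (*-monoˡ 0≤2C (half^-anti k j)) small))
      where
      half^-anti : ∀ k j → half^ (k ℕ.+ j) ≤ half^ k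
      half^-anti zero    j = half^≤1 j
      half^-anti (suc k) j = *-monoˡ 0≤½ (half^-anti k j)

  bounded : ∀ s → Cauchy s → ∃[ b ] ∀ n → ∣ s n ∣ ≤ ι b
  bounded s c = proj₁ (archimedean (max N + 1ℚ)) , λ n →
      ≤-trans (below n) (proj₂ (archimedean (max N + 1ℚ)))
    where
    N = proj₁ (c (toWitness {a? = 0ℚ <? 1ℚ} _))
    max : ℕ → ℚ
    max zero    = ∣ s zero ∣
    max (suc n) = max n + ∣ s (suc n) ∣
    0≤max : ∀ n → 0ℚ ≤ max n
    0≤max zero    = 0≤∣p∣ (s zero)
    0≤max (suc n) = +-nonNeg (0≤max n) (0≤∣p∣ (s (suc n)))
    last : ∀ n → ∣ s n ∣ ≤ max n
    last zero    = ≤-refl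
    last (suc n) = p≤q+p (0≤max n)
    max-mono : ∀ {m n} → m ℕ.≤′ n → max m ≤ max n
    max-mono ℕ.≤′-refl       = ≤-refl
    max-mono (ℕ.≤′-step m≤n) = ≤-trans (max-mono m≤n) (p≤p+q (0≤∣p∣ (s _)))
    below : ∀ n → ∣ s n ∣ ≤ max N + 1ℚ
    below n with ℕ.≤-total n N
    ... | inj₁ n≤N = ≤-trans (last n) (≤-trans (max-mono (ℕ.≤⇒≤′ n≤N)) (p≤p+q 0≤1))
    ... | inj₂ N≤n = ≤-cong
      (cong ∣_∣ (solve 2 (λ x y → x := y :+ (x :- y)) refl (s n) (s N))) refl
      (≤-trans (∣p+q∣≤∣p∣+∣q∣ (s N) (s n - s N))
        (+-mono-≤ (last N) (<⇒≤ (proj₂ (c _) n N N≤n ℕ.≤-refl))))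
      where open +-*-Solver

open Sequences

infixl 6 _⊕_
infixl 7 _·_

fromℚ : ℚ → ℝ
fromℚ q = mkℝ (λ _ → q) λ 0<ε →
  0 , λ _ _ _ _ → subst (_< _) (≡-sym (cong ∣_∣ (+-inverseʳ q))) 0<ε

_⊕_ : ℝ → ℝ → ℝ
x ⊕ y = mkℝ (λ n → seq x n + seq y n) λ {ε} 0<ε →
  let M , p = cauchy x (*-pos 0<½ 0<ε)
      N , q = cauchy y (*-pos 0<½ 0<ε)
  in M ℕ.⊔ N , λ m n m≥ n≥ →
    subst₂ _<_
      refl (halves ε)
      (≤-<-trans
        (≤-cong (cong ∣_∣ (solve 4 (λ a b c d → (a :+ b) :- (c :+ d) := (a :- c) :+ (b :- d)) refl
                   (seq x m) (seq y m) (seq x n) (seq y n)))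
                refl (∣p+q∣≤∣p∣+∣q∣ (seq x m - seq x n) (seq y m - seq y n)))
        (+-mono-< (p m n (ℕ.≤-trans (ℕ.m≤m⊔n M N) m≥) (ℕ.≤-trans (ℕ.m≤m⊔n M N) n≥))
                  (q m n (ℕ.≤-trans (ℕ.m≤n⊔m M N) m≥) (ℕ.≤-trans (ℕ.m≤n⊔m M N) n≥))))
  where open +-*-Solver

module Lipschitz where

  -- L bounds the increments of t by those of s.
  lipschitz : ∀ L {s t : ℕ → ℚ} → (∀ m n → ∣ t m - t n ∣ ≤ ι L * ∣ s m - s n ∣) →
              Cauchy s → Cauchy t
  lipschitz L {s} h c {ε} 0<ε =
    let N , p = c (*-pos 0<ε 0<1/) in
    N , λ m n N≤m N≤n → ≤-<-trans (h m n)
      (≤-<-trans (*-monoʳ (0≤∣p∣ (s m - s n)) (p≤q+p {ι L} {1ℚ} 0≤1))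
        (<-≤-trans (*-monoʳ-<-pos (ι (suc L)) {{positive 0<ιL}} (p m n N≤m N≤n))
          (≤-reflexive (trans
            (solve 3 (λ l e i → l :* (e :* i) := e :* (l :* i)) refl (ι (suc L)) ε (+ 1 / suc L))
            (trans (cong (λ z → ε * z) (ι-inverse L)) (*-identityʳ ε))))))
    where
    open +-*-Solver
    0<ιL : 0ℚ < ι (suc L)
    0<ιL = <-≤-trans (toWitness {a? = 0ℚ <? 1ℚ} _) (p≤p+q (0≤ι L))
    0<1/ : 0ℚ < + 1 / suc L
    0<1/ = subst (0ℚ <_) (≡-sym (↥p/↧p≡p (mkℚ (+ 1) L (1-coprimeTo (suc L)))))
             (*<* (ℤ.+<+ (ℕ.s≤s ℕ.z≤n)))

open Lipschitz

_·_ : ℚ → ℝ → ℝ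
q · x = mkℝ (λ n → q * seq x n)
  (let L , ∣q∣≤L = archimedean ∣ q ∣ in lipschitz L {seq x} {λ n → q * seq x n} (λ m n →
    ≤-cong (trans (cong ∣_∣ (solve 3 (λ q a b → q :* a :- q :* b := q :* (a :- b)) refl
                                 q (seq x m) (seq x n)))
                  (∣p*q∣≡∣p∣*∣q∣ q (seq x m - seq x n)))
           refl (*-monoʳ (0≤∣p∣ (seq x m - seq x n)) ∣q∣≤L)) (cauchy x))
  where open +-*-Solver

-- x ^ i / i !
expTerm : ℚ → ℕ → ℚ
expTerm x zero    = 1ℚ
expTerm x (suc i) = expTerm x i * (x * (+ 1 / suc i))

-- Sum of a i * x ^ i / i ! over i < N.
taylor : (ℕ → ℚ) → ℚ → ℕ → ℚ
taylor a x zero    = 0ℚ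
taylor a x (suc N) = taylor a x N + a N * expTerm x N

-- The i-th derivatives at 0.
cosCoeff sinCoeff : ℕ → ℚ
cosCoeff zero          = 1ℚ
cosCoeff (suc zero)    = 0ℚ
cosCoeff (suc (suc i)) = - cosCoeff i
sinCoeff zero          = 0ℚ
sinCoeff (suc zero)    = 1ℚ
sinCoeff (suc (suc i)) = - sinCoeff i

module Series where

  cosCoeff≤1 : ∀ i → ∣ cosCoeff i ∣ ≤ 1ℚ
  cosCoeff≤1 zero          = ≤-refl
  cosCoeff≤1 (suc zero)    = 0≤1
  cosCoeff≤1 (suc (suc i)) = ≤-cong (∣-p∣≡∣p∣ (cosCoeff i)) refl (cosCoeff≤1 i)

  sinCoeff≤1 : ∀ i → ∣ sinCoeff i ∣ ≤ 1ℚ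
  sinCoeff≤1 zero          = 0≤1
  sinCoeff≤1 (suc zero)    = ≤-refl
  sinCoeff≤1 (suc (suc i)) = ≤-cong (∣-p∣≡∣p∣ (sinCoeff i)) refl (sinCoeff≤1 i)

  -- Estimates on arguments of absolute value at most b, against the partial sums E of exp b.
  module Bounds (b : ℕ) where

    open +-*-Solver

    B : ℚ
    B = ι b

    e : ℕ → ℚ
    e = expTerm B

    E : ℕ → ℚ
    E = taylor (λ _ → 1ℚ) B

    0≤ratio : ∀ i → 0ℚ ≤ B * (+ 1 / suc i)
    0≤ratio i = *-nonNeg (0≤ι b) (0≤1/ i)

    0≤e : ∀ i → 0ℚ ≤ e i
    0≤e zero    = 0≤1
    0≤e (suc i) = *-nonNeg (0≤e i) (0≤ratio i)

    0≤E : ∀ i → 0ℚ ≤ E i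
    0≤E zero    = ≤-refl
    0≤E (suc i) = +-nonNeg (0≤E i) (≤-cong refl (*-identityˡ (e i)) (0≤e i))

    ratio≤½ : ∀ k → B * (+ 1 / suc (b ℕ.+ b ℕ.+ k)) ≤ ½
    ratio≤½ k = ≤-cong
      (solve 2 (λ x r → x :* r := con ½ :* ((x :+ x) :* r)) refl B r)
      (trans (≡-sym (*-identityʳ ½)) (cong (λ z → ½ * z) (≡-sym (ι-inverse (b ℕ.+ b ℕ.+ k)))))
      (*-monoˡ 0≤½ (*-monoʳ (0≤1/ (b ℕ.+ b ℕ.+ k)) 2B≤))
      where
      r = + 1 / suc (b ℕ.+ b ℕ.+ k)
      2B≤ : B + B ≤ ι (suc (b ℕ.+ b ℕ.+ k))
      2B≤ = ≤-trans
        (≤-trans (p≤p+q (0≤ι k))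
          (≤-reflexive (≡-sym (trans (ι-+ (b ℕ.+ b) k) (cong (λ z → z + ι k) (ι-+ b b))))))
        (p≤q+p 0≤1)

    e-decay : ∀ j k → e (b ℕ.+ b ℕ.+ j ℕ.+ k) ≤ e (b ℕ.+ b ℕ.+ j) * half^ k
    e-decay j zero rewrite ℕ.+-identityʳ (b ℕ.+ b ℕ.+ j) = ≤-reflexive (≡-sym (*-identityʳ _))
    e-decay j (suc k) rewrite ℕ.+-suc (b ℕ.+ b ℕ.+ j) k = ≤-trans
      (*-mono (*-nonNeg (0≤e (b ℕ.+ b ℕ.+ j)) (<⇒≤ (0<half^ k)))
              (0≤ratio (b ℕ.+ b ℕ.+ j ℕ.+ k))
              (e-decay j k)
              (subst (λ i → B * (+ 1 / suc i) ≤ ½) (≡-sym (ℕ.+-assoc (b ℕ.+ b) j k)) (ratio≤½ (j ℕ.+ k))))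
      (≤-reflexive (solve 2 (λ x h → x :* h :* con ½ := x :* (con ½ :* h)) refl
                          (e (b ℕ.+ b ℕ.+ j)) (half^ k)))

    E-step : ∀ i → E (suc i) - E i ≡ e i
    E-step i = solve 2 (λ x y → (x :+ con 1ℚ :* y) :- x := y) refl (E i) (e i)

    module Tail (j : ℕ) = Geometric E (b ℕ.+ b ℕ.+ j) (e (b ℕ.+ b ℕ.+ j)) (0≤e (b ℕ.+ b ℕ.+ j))
      (λ k → ≤-cong (trans (cong ∣_∣ (E-step (b ℕ.+ b ℕ.+ j ℕ.+ k)))
                           (0≤p⇒∣p∣≡p (0≤e (b ℕ.+ b ℕ.+ j ℕ.+ k))))
                    refl (e-decay j k))

    E-cauchy : Cauchy E
    E-cauchy = Tail.isCauchy 0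

    E-tail : ∀ j k → E (b ℕ.+ b ℕ.+ j ℕ.+ k) - E (b ℕ.+ b ℕ.+ j) ≤ e (b ℕ.+ b ℕ.+ j) + e (b ℕ.+ b ℕ.+ j)
    E-tail j k = ≤-trans (p≤∣p∣ _) (≤-cong
      (cong (λ i → ∣ E (i ℕ.+ k) - E i ∣) (≡-sym (ℕ.+-identityʳ (b ℕ.+ b ℕ.+ j))))
      (≡-sym (*-identityʳ _)) (Tail.increment≤ j 0 k))

    term≤ : ∀ {x} → ∣ x ∣ ≤ B → ∀ i → ∣ expTerm x i ∣ ≤ e i
    term≤ x≤ zero    = ≤-refl
    term≤ {x} x≤ (suc i) = ≤-cong
      (trans (∣p*q∣≡∣p∣*∣q∣ (expTerm x i) _)
        (cong (λ z → ∣ expTerm x i ∣ * z)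
          (trans (∣p*q∣≡∣p∣*∣q∣ x _) (cong (λ z → ∣ x ∣ * z) (0≤p⇒∣p∣≡p (0≤1/ i))))))
      refl
      (*-mono (0≤e i) (*-nonNeg (0≤∣p∣ x) (0≤1/ i)) (term≤ x≤ i) (*-monoʳ (0≤1/ i) x≤))

    -- The mean value estimate for x ^ (i + 1) / (i + 1)!.
    term-lipschitz : ∀ {x y} → ∣ x ∣ ≤ B → ∣ y ∣ ≤ B → ∀ i →
      ∣ expTerm x (suc i) - expTerm y (suc i) ∣ ≤ e i * ∣ x - y ∣
    term-lipschitz {x} {y} x≤ y≤ zero = ≤-reflexive (trans
      (cong ∣_∣ (solve 2 (λ x y → con 1ℚ :* (x :* con 1ℚ) :- con 1ℚ :* (y :* con 1ℚ) := x :- y) refl x y))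
      (≡-sym (*-identityˡ ∣ x - y ∣)))
    term-lipschitz {x} {y} x≤ y≤ (suc i) = ≤-trans
      (≤-cong (cong ∣_∣ (solve 5 (λ s t x y r →
                  s :* (x :* r) :- t :* (y :* r) := (s :* (x :- y) :+ (s :- t) :* y) :* r)
                  refl s t x y r))
              refl
        (≤-cong (trans (∣p*q∣≡∣p∣*∣q∣ (s * (x - y) + (s - t) * y) r) (cong (λ z → ∣ s * (x - y) + (s - t) * y ∣ * z) (0≤p⇒∣p∣≡p (0≤1/ (suc i)))))
                refl
          (*-monoʳ (0≤1/ (suc i))
            (≤-trans (∣p+q∣≤∣p∣+∣q∣ (s * (x - y)) ((s - t) * y))
              (+-mono-≤
                (≤-cong (∣p*q∣≡∣p∣*∣q∣ s (x - y)) refl (*-monoʳ (0≤∣p∣ (x - y)) (term≤ x≤ (suc i))))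
                (≤-cong (∣p*q∣≡∣p∣*∣q∣ (s - t) y) refl
                  (*-mono (*-nonNeg (0≤e i) (0≤∣p∣ (x - y))) (0≤∣p∣ y)
                          (term-lipschitz x≤ y≤ i) y≤)))))))
      (≤-reflexive (trans
        (solve 5 (λ e B ri r d →
           (e :* (B :* ri) :* d :+ e :* d :* B) :* r
             := (e :* d :* B :* r) :* (ri :+ con 1ℚ)) refl (e i) B (+ 1 / suc i) r ∣ x - y ∣)
        (trans (cong (λ z → (e i * ∣ x - y ∣ * B * r) * z) ri+1)
        (trans (solve 6 (λ e B ri r d m → (e :* d :* B :* r) :* (m :* ri) := (m :* r) :* (e :* (B :* ri) :* d)) refl
                  (e i) B (+ 1 / suc i) r ∣ x - y ∣ (ι (suc (suc i))))
        (trans (cong (λ z → z * (e (suc i) * ∣ x - y ∣)) (ι-inverse (suc i)))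
               (*-identityˡ _))))))
      where
      s = expTerm x (suc i)
      t = expTerm y (suc i)
      r = + 1 / suc (suc i)
      ri+1 : (+ 1 / suc i) + 1ℚ ≡ ι (suc (suc i)) * (+ 1 / suc i)
      ri+1 = trans (cong (λ z → (+ 1 / suc i) + z) (≡-sym (ι-inverse i)))
        (solve 2 (λ m ri → ri :+ m :* ri := (con 1ℚ :+ m) :* ri) refl (ι (suc i)) (+ 1 / suc i))

    module _ (a : ℕ → ℚ) (a≤1 : ∀ i → ∣ a i ∣ ≤ 1ℚ) where

      private
        a*≤ : ∀ i {p q} → ∣ p ∣ ≤ q → ∣ a i * p ∣ ≤ q
        a*≤ i {p} {q} p≤q = ≤-cong (∣p*q∣≡∣p∣*∣q∣ (a i) p) (≡-sym (*-identityˡ q))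
          (*-mono 0≤1 (0≤∣p∣ p) (a≤1 i) p≤q)

      taylor-tail : ∀ {x} → ∣ x ∣ ≤ B → ∀ N k →
        ∣ taylor a x (N ℕ.+ k) - taylor a x N ∣ ≤ E (N ℕ.+ k) - E N
      taylor-tail {x} x≤ N zero rewrite ℕ.+-identityʳ N = ≤-reflexive
        (trans (cong ∣_∣ (+-inverseʳ (taylor a x N))) (≡-sym (+-inverseʳ (E N))))
      taylor-tail {x} x≤ N (suc k) rewrite ℕ.+-suc N k = ≤-trans
        (≤-cong (cong ∣_∣ (solve 3 (λ p q r → (p :+ q) :- r := (p :- r) :+ q) refl
                   (taylor a x (N ℕ.+ k)) (a (N ℕ.+ k) * expTerm x (N ℕ.+ k)) (taylor a x N)))
                refl (∣p+q∣≤∣p∣+∣q∣ (taylor a x (N ℕ.+ k) - taylor a x N) (a (N ℕ.+ k) * expTerm x (N ℕ.+ k))))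
        (≤-trans (+-mono-≤ (taylor-tail x≤ N k) (a*≤ (N ℕ.+ k) (term≤ x≤ (N ℕ.+ k))))
          (≤-reflexive (solve 3 (λ p q r → (p :- r) :+ q := (p :+ con 1ℚ :* q) :- r) refl
                   (E (N ℕ.+ k)) (e (N ℕ.+ k)) (E N))))

      taylor-lipschitz : ∀ {x y} → ∣ x ∣ ≤ B → ∣ y ∣ ≤ B → ∀ N k →
        ∣ (taylor a x (suc N ℕ.+ k) - taylor a x (suc N)) - (taylor a y (suc N ℕ.+ k) - taylor a y (suc N)) ∣
          ≤ (E (N ℕ.+ k) - E N) * ∣ x - y ∣
      taylor-lipschitz {x} {y} x≤ y≤ N zero rewrite ℕ.+-identityʳ N = ≤-reflexive (trans
        (cong ∣_∣ (solve 2 (λ p q → (p :- p) :- (q :- q) := con 0ℚ) refl (taylor a x (suc N)) (taylor a y (suc N))))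
        (solve 2 (λ p d → con 0ℚ := (p :- p) :* d) refl (E N) ∣ x - y ∣))
      taylor-lipschitz {x} {y} x≤ y≤ N (suc k) rewrite ℕ.+-suc N k = ≤-trans
        (≤-cong (cong ∣_∣ (solve 7 (λ p q a s p′ q′ t →
                    ((p :+ a :* s) :- q) :- ((p′ :+ a :* t) :- q′)
                      := ((p :- q) :- (p′ :- q′)) :+ a :* (s :- t)) refl
                    (taylor a x (suc N ℕ.+ k)) (taylor a x (suc N)) (a (suc (N ℕ.+ k))) (expTerm x (suc (N ℕ.+ k)))
                    (taylor a y (suc N ℕ.+ k)) (taylor a y (suc N)) (expTerm y (suc (N ℕ.+ k)))))
                refl (∣p+q∣≤∣p∣+∣q∣
                  ((taylor a x (suc N ℕ.+ k) - taylor a x (suc N)) - (taylor a y (suc N ℕ.+ k) - taylor a y (suc N)))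
                  (a (suc (N ℕ.+ k)) * (expTerm x (suc (N ℕ.+ k)) - expTerm y (suc (N ℕ.+ k))))))
        (≤-trans (+-mono-≤ (taylor-lipschitz x≤ y≤ N k)
                           (a*≤ (suc (N ℕ.+ k)) (term-lipschitz x≤ y≤ (N ℕ.+ k))))
          (≤-reflexive (solve 4 (λ p q r d → (p :- r) :* d :+ q :* d := ((p :+ con 1ℚ :* q) :- r) :* d) refl
                   (E (N ℕ.+ k)) (e (N ℕ.+ k)) (E N) ∣ x - y ∣)))

open Series

-- The partial sums are taken at the rational approximations of the argument.
series : (a : ℕ → ℚ) → (∀ i → ∣ a i ∣ ≤ 1ℚ) → ℝ → ℝ
series a a≤1 x = mkℝ s (cauchy-ordered {s} λ {ε} 0<ε →
    let N₁ , p = E-cauchy (*-pos 0<½ 0<ε)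
        N₂ , q = approx (*-pos 0<½ 0<ε)
    in suc (N₁ ℕ.⊔ N₂) , λ n k N<n →
      let N≤n = ℕ.<⇒≤ N<n
          n≥1 = ℕ.≤-trans (ℕ.s≤s ℕ.z≤n) N<n
          N₁≤n = ℕ.≤-trans (ℕ.m≤m⊔n N₁ N₂) N≤n
          N₂≤n = ℕ.≤-trans (ℕ.m≤n⊔m N₁ N₂) N≤n
          n≤n+k = ℕ.m≤m+n n k
      in ≤-<-trans (abs-split (s (n ℕ.+ k)) (taylor a (seq x (n ℕ.+ k)) n) (s n))
           (subst (∣ s (n ℕ.+ k) - taylor a (seq x (n ℕ.+ k)) n ∣ + ∣ taylor a (seq x (n ℕ.+ k)) n - s n ∣ <_)
                  (halves ε)
             (+-mono-<
               (≤-<-trans (≤-trans (taylor-tail a a≤1 (x≤ (n ℕ.+ k)) n k) (p≤∣p∣ _))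
                          (p (n ℕ.+ k) n (ℕ.≤-trans N₁≤n n≤n+k) N₁≤n))
               (≤-<-trans (first (n ℕ.+ k) n n n≥1)
                          (q (n ℕ.+ k) n (ℕ.≤-trans N₂≤n n≤n+k) N₂≤n)))))
  where
  s : ℕ → ℚ
  s N = taylor a (seq x N) N
  b = proj₁ (bounded (seq x) (cauchy x))
  x≤ = proj₂ (bounded (seq x) (cauchy x))
  open Bounds b
  L = proj₁ (bounded E E-cauchy)
  open +-*-Solver
  approx : Cauchy (λ n → ι L * seq x n)
  approx = cauchy (ι L · x)
  first : ∀ m n N → 1 ℕ.≤ N →
    ∣ taylor a (seq x m) N - taylor a (seq x n) N ∣ ≤ ∣ ι L * seq x m - ι L * seq x n ∣
  first m n (suc N) _ = ≤-trans
    (≤-cong (cong ∣_∣ (solve 3 (λ p q r → p :- q := (p :- r) :- (q :- r)) refl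
               (taylor a (seq x m) (suc N)) (taylor a (seq x n) (suc N)) (taylor a (seq x m) 1)))
            refl (taylor-lipschitz a a≤1 (x≤ m) (x≤ n) 0 N))
    (≤-trans (*-monoʳ (0≤∣p∣ (seq x m - seq x n))
               (≤-cong (+-identityʳ (E N)) refl (≤-trans (p≤∣p∣ (E N)) (proj₂ (bounded E E-cauchy) N))))
      (≤-reflexive (≡-sym (trans
        (cong ∣_∣ (solve 3 (λ l p q → l :* p :- l :* q := l :* (p :- q)) refl (ι L) (seq x m) (seq x n)))
        (trans (∣p*q∣≡∣p∣*∣q∣ (ι L) (seq x m - seq x n))
               (cong (λ z → z * ∣ seq x m - seq x n ∣) (0≤p⇒∣p∣≡p (0≤ι L))))))))

cos sin : ℝ → ℝ
cos = series cosCoeff cosCoeff≤1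
sin = series sinCoeff sinCoeff≤1

-- π / 2 is the limit of the iteration x ↦ x + cos x started at 3/2; it satisfies cos (π / 2) = 0.
-- The k-th step uses the Taylor polynomial with 8 + k terms; eight terms already make
-- the step a contraction of the interval [3/2, 5/3].
halfπ : ℕ → ℚ
halfπ zero    = + 3 / 2
halfπ (suc k) = halfπ k + taylor cosCoeff (halfπ k) (8 ℕ.+ k)

module HalfPi where

  open +-*-Solver
  open Bounds 2

  lo hi : ℚ
  lo = + 3 / 2
  hi = + 5 / 3

  I : ℚ → Set
  I x = lo ≤ x × x ≤ hi

  G : ℕ → ℚ → ℚ
  G N x = x + taylor cosCoeff x N

  0≤lo : 0ℚ ≤ lo
  0≤lo = toWitness {a? = 0ℚ ≤? lo} _

  0≤hi : 0ℚ ≤ hi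
  0≤hi = toWitness {a? = 0ℚ ≤? hi} _

  I⇒0≤ : ∀ {x} → I x → 0ℚ ≤ x
  I⇒0≤ (l , _) = ≤-trans 0≤lo l

  I⇒≤B : ∀ {x} → I x → ∣ x ∣ ≤ B
  I⇒≤B i@(_ , u) = ≤-cong (0≤p⇒∣p∣≡p (I⇒0≤ i)) refl (≤-trans u (toWitness {a? = hi ≤? B} _))

  sq : ℚ → ℚ
  sq x = x * x

  sq-≥ : ∀ {p x} → 0ℚ ≤ p → p ≤ x → sq p ≤ sq x
  sq-≥ 0≤p p≤x = *-mono (≤-trans 0≤p p≤x) 0≤p p≤x p≤x

  inner : ℚ → ℚ → ℚ
  inner x y = (½ - (+ 1 / 24) * (sq x + sq y))
              + (+ 1 / 720) * (sq (sq x) + sq x * sq y + sq (sq y))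

  slope : ℚ → ℚ → ℚ
  slope x y = 1ℚ - (x + y) * inner x y

  G₈-diff : ∀ x y → G 8 x - G 8 y ≡ slope x y * (x - y)
  G₈-diff = solve 2 (λ x y →
      (x :+ tay x 8) :- (y :+ tay y 8)
        := (con 1ℚ :- (x :+ y) :* ((con ½ :- con (+ 1 / 24) :* (x :* x :+ y :* y))
              :+ con (+ 1 / 720) :* ((x :* x) :* (x :* x) :+ (x :* x) :* (y :* y) :+ (y :* y) :* (y :* y))))
           :* (x :- y)) refl
    where
    term : Polynomial 2 → ℕ → Polynomial 2
    term x zero    = con 1ℚ
    term x (suc i) = term x i :* (x :* con (+ 1 / suc i))
    tay : Polynomial 2 → ℕ → Polynomial 2
    tay x zero    = con 0ℚ
    tay x (suc N) = tay x N :+ con (cosCoeff N) :* term x N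

  inner-lo inner-hi : ℚ
  inner-lo = (½ - (+ 1 / 24) * (sq hi + sq hi)) + (+ 1 / 720) * (sq (sq lo) + sq lo * sq lo + sq (sq lo))
  inner-hi = (½ - (+ 1 / 24) * (sq lo + sq lo)) + (+ 1 / 720) * (sq (sq hi) + sq hi * sq hi + sq (sq hi))

  module _ {x y} (ix : I x) (iy : I y) where

    0≤x = I⇒0≤ ix
    0≤y = I⇒0≤ iy

    inner≥ : inner-lo ≤ inner x y
    inner≥ = +-mono-≤
      (+-monoʳ-≤ ½ (neg-antimono-≤ (*-monoˡ (toWitness {a? = 0ℚ ≤? + 1 / 24} _)
        (+-mono-≤ (sq-≥ 0≤x (proj₂ ix)) (sq-≥ 0≤y (proj₂ iy))))))
      (*-monoˡ (toWitness {a? = 0ℚ ≤? + 1 / 720} _)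
        (+-mono-≤ (+-mono-≤ (sq-≥ 0≤l² lx) (*-mono (≤-trans 0≤l² lx) 0≤l² lx ly)) (sq-≥ 0≤l² ly)))
      where
      0≤l² = *-nonNeg 0≤lo 0≤lo
      lx = sq-≥ 0≤lo (proj₁ ix)
      ly = sq-≥ 0≤lo (proj₁ iy)

    inner≤ : inner x y ≤ inner-hi
    inner≤ = +-mono-≤
      (+-monoʳ-≤ ½ (neg-antimono-≤ (*-monoˡ (toWitness {a? = 0ℚ ≤? + 1 / 24} _)
        (+-mono-≤ (sq-≥ 0≤lo (proj₁ ix)) (sq-≥ 0≤lo (proj₁ iy))))))
      (*-monoˡ (toWitness {a? = 0ℚ ≤? + 1 / 720} _)
        (+-mono-≤ (+-mono-≤ (sq-≥ 0≤x² ux) (*-mono (≤-trans 0≤x² ux) 0≤y² ux uy)) (sq-≥ 0≤y² uy)))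
      where
      0≤x² = *-nonNeg 0≤x 0≤x
      0≤y² = *-nonNeg 0≤y 0≤y
      ux = sq-≥ 0≤x (proj₂ ix)
      uy = sq-≥ 0≤y (proj₂ iy)

    ∣slope∣≤ : ∣ slope x y ∣ ≤ + 3 / 16
    ∣slope∣≤ = abs-≤
      (≤-trans (toWitness {a? = - (+ 3 / 16) ≤? 1ℚ - (hi + hi) * inner-hi} _)
        (+-monoʳ-≤ 1ℚ (neg-antimono-≤
          (*-mono (+-nonNeg 0≤hi 0≤hi) (≤-trans (toWitness {a? = 0ℚ ≤? inner-lo} _) inner≥)
                  (+-mono-≤ (proj₂ ix) (proj₂ iy)) inner≤))))
      (≤-trans
        (+-monoʳ-≤ 1ℚ (neg-antimono-≤
          (*-mono (+-nonNeg 0≤x 0≤y) (toWitness {a? = 0ℚ ≤? inner-lo} _)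
                  (+-mono-≤ (proj₁ ix) (proj₁ iy)) inner≥)))
        (toWitness {a? = 1ℚ - (lo + lo) * inner-lo ≤? + 3 / 16} _))

    contraction : ∀ k → ∣ G (8 ℕ.+ k) x - G (8 ℕ.+ k) y ∣ ≤ (+ 1 / 4) * ∣ x - y ∣
    contraction k = ≤-trans
      (≤-cong (cong ∣_∣ (solve 6 (λ x y t t₈ u u₈ →
                  (x :+ t) :- (y :+ u) := ((x :+ t₈) :- (y :+ u₈)) :+ ((t :- t₈) :- (u :- u₈))) refl
                  x y t t₈ u u₈))
              refl (∣p+q∣≤∣p∣+∣q∣ (G 8 x - G 8 y) ((t - t₈) - (u - u₈))))
      (≤-trans (+-mono-≤
          (≤-cong (trans (cong ∣_∣ (G₈-diff x y)) (∣p*q∣≡∣p∣*∣q∣ (slope x y) (x - y))) refl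
                  (*-monoʳ (0≤∣p∣ (x - y)) ∣slope∣≤))
          (≤-trans (taylor-lipschitz cosCoeff cosCoeff≤1 (I⇒≤B ix) (I⇒≤B iy) 7 k)
                   (*-monoʳ (0≤∣p∣ (x - y)) (E-tail 3 k))))
        (≤-cong (≡-sym (*-distribʳ-+ ∣ x - y ∣ (+ 3 / 16) (e 7 + e 7))) refl
          (*-monoʳ (0≤∣p∣ (x - y)) (toWitness {a? = (+ 3 / 16) + (e 7 + e 7) ≤? + 1 / 4} _))))
      where
      t  = taylor cosCoeff x (8 ℕ.+ k)
      t₈ = taylor cosCoeff x 8
      u  = taylor cosCoeff y (8 ℕ.+ k)
      u₈ = taylor cosCoeff y 8

  ∣∣≤⇒≤ : ∀ {p q r} → ∣ p - q ∣ ≤ r → p ≤ q + r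
  ∣∣≤⇒≤ {p} {q} h = ≤-cong (solve 2 (λ p q → p := q :+ (p :- q)) refl p q) refl
    (+-monoʳ-≤ q (≤-trans (p≤∣p∣ (p - q)) h))

  ∣∣≤⇒≥ : ∀ {p q r} → ∣ p - q ∣ ≤ r → q - r ≤ p
  ∣∣≤⇒≥ {p} {q} {r} h = ≤-cong refl
    (solve 2 (λ p q → p := q :- (q :- p)) refl p q)
    (+-monoʳ-≤ q (neg-antimono-≤ (≤-trans (p≤∣p∣ (q - p)) (≤-cong (abs-flip q p) refl h))))

  lo∈I : I lo
  lo∈I = ≤-refl , toWitness {a? = lo ≤? hi} _

  radius : ℚ
  radius = (+ 1 / 4) * (hi - lo) + (e 8 + e 8)

  G-near : ∀ {x} → I x → ∀ k → ∣ G (8 ℕ.+ k) x - G 8 lo ∣ ≤ radius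
  G-near {x} ix k = ≤-trans (abs-split (G (8 ℕ.+ k) x) (G (8 ℕ.+ k) lo) (G 8 lo)) (+-mono-≤
    (≤-trans (contraction ix lo∈I k) (*-monoˡ (toWitness {a? = 0ℚ ≤? + 1 / 4} _)
      (≤-cong (0≤p⇒∣p∣≡p (≤-cong (≡-sym (+-inverseʳ lo)) refl (+-monoˡ-≤ (- lo) (proj₁ ix)))) refl
              (+-monoˡ-≤ (- lo) (proj₂ ix)))))
    (≤-cong (cong ∣_∣ (solve 3 (λ l t u → (l :+ t) :- (l :+ u) := t :- u) refl
               lo (taylor cosCoeff lo (8 ℕ.+ k)) (taylor cosCoeff lo 8))) refl
      (≤-trans (taylor-tail cosCoeff cosCoeff≤1 (I⇒≤B lo∈I) 8 k) (E-tail 4 k))))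

  lo≤ : lo ≤ G 8 lo - radius
  lo≤ = toWitness {a? = lo ≤? G 8 lo - radius} _

  ≤hi : G 8 lo + radius ≤ hi
  ≤hi = toWitness {a? = G 8 lo + radius ≤? hi} _

  G∈I : ∀ {x} → I x → ∀ k → I (G (8 ℕ.+ k) x)
  G∈I {x} ix k =
    ≤-trans {lo} {G 8 lo - radius} {G (8 ℕ.+ k) x} lo≤
      (∣∣≤⇒≥ {G (8 ℕ.+ k) x} {G 8 lo} {radius} (G-near ix k)) ,
    ≤-trans {G (8 ℕ.+ k) x} {G 8 lo + radius} {hi}
      (∣∣≤⇒≤ {G (8 ℕ.+ k) x} {G 8 lo} {radius} (G-near ix k)) ≤hi

  halfπ∈I : ∀ k → I (halfπ k)
  halfπ∈I zero    = lo∈I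
  halfπ∈I (suc k) = G∈I (halfπ∈I k) k

  step : ∀ k → ∣ halfπ (suc k) - halfπ k ∣ ≤ 1ℚ * half^ k
  step zero    = toWitness {a? = ∣ halfπ 1 - halfπ 0 ∣ ≤? 1ℚ * half^ 0} _
  step (suc k) = ≤-trans
    (≤-cong (cong ∣_∣ (solve 5 (λ x y t a u →
                (x :+ (t :+ a)) :- (y :+ u) := ((x :+ t) :- (y :+ u)) :+ a) refl
                x y (taylor cosCoeff x (8 ℕ.+ k)) new (taylor cosCoeff y (8 ℕ.+ k))))
            refl (∣p+q∣≤∣p∣+∣q∣ (G (8 ℕ.+ k) x - G (8 ℕ.+ k) y) new))
    (≤-trans (+-mono-≤
        (≤-trans (contraction (halfπ∈I (suc k)) (halfπ∈I k) k)
                 (*-monoˡ (toWitness {a? = 0ℚ ≤? + 1 / 4} _) (step k)))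
        (≤-trans new≤ (*-monoʳ (<⇒≤ (0<half^ k)) (toWitness {a? = e 8 ≤? + 1 / 4} _))))
      (≤-reflexive (solve 1 (λ h → con (+ 1 / 4) :* (con 1ℚ :* h) :+ con (+ 1 / 4) :* h
                                     := con 1ℚ :* (con ½ :* h)) refl (half^ k))))
    where
    x = halfπ (suc k)
    y = halfπ k
    new = cosCoeff (8 ℕ.+ k) * expTerm x (8 ℕ.+ k)
    new≤ : ∣ new ∣ ≤ e 8 * half^ k
    new≤ = ≤-trans
      (≤-cong (∣p*q∣≡∣p∣*∣q∣ (cosCoeff (8 ℕ.+ k)) (expTerm x (8 ℕ.+ k)))
              (≡-sym (*-identityˡ (e (8 ℕ.+ k))))
              (*-mono 0≤1 (0≤∣p∣ (expTerm x (8 ℕ.+ k))) (cosCoeff≤1 (8 ℕ.+ k))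
                      (term≤ (I⇒≤B (halfπ∈I (suc k))) (8 ℕ.+ k))))
      (e-decay 4 k)

  halfπ-cauchy : Cauchy halfπ
  halfπ-cauchy = Geometric.isCauchy halfπ 0 1ℚ 0≤1 step

π : ℝ
π = (+ 2 / 1) · mkℝ halfπ HalfPi.halfπ-cauchy

record ℂ : Set where
  constructor _+i_
  field
    re im : ℝ

open ℂ public

infix 4 _≈ᶜ_

_≈ᶜ_ : Rel ℂ 0ℓ
z ≈ᶜ w = re z ≈ re w × im z ≈ im w

-1ᶜ : ℂ
-1ᶜ = fromℚ (- 1ℚ) +i fromℚ 0ℚ

ℂ-+-rawMonoid : RawMonoid 0ℓ 0ℓ
ℂ-+-rawMonoid = record
  { _≈_ = _≈ᶜ_
  ; _∙_ = λ z w → (re z ⊕ re w) +i (im z ⊕ im w)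
  ; ε   = fromℚ 0ℚ +i fromℚ 0ℚ
  }

sumOver : ∀ (M : RawMonoid 0ℓ 0ℓ) {n} → Subset n →
          (Fin n → RawMonoid.Carrier M) → RawMonoid.Carrier M
sumOver M S f = sum M (λ x → if lookup S x then f x else RawMonoid.ε M)

residue : ∀ n .{{_ : NonZero n}} → ℤ → Fin n
residue n z = fromℕ< (ℤ.n%ℕd<d z n)

difference : ∀ {n} .{{_ : NonZero n}} → Fin n → Fin n → Fin n
difference {n} h g = residue n (+ toℕ h ℤ.- + toℕ g)

-- Loops and one-way edges are not excluded; Cay n S has none when S = - S and 0 ∉ S.
record Graph (n : ℕ) : Set₁ where
  field
    Adj  : Rel (Fin n) 0ℓ
    adj? : Decidable Adj

  closedNeighbourhood : Fin n → Subset n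
  closedNeighbourhood u = tabulate λ v → does ((v ≟ u) ⊎-dec (adj? u v))

Cay : ∀ n .{{_ : NonZero n}} → Subset n → Graph n
Cay n S = record
  { Adj  = λ g h → difference h g ∈ S
  ; adj? = λ g h → difference h g ∈? S
  }

ClosedDistanceMagic : ∀ {n} → Graph n → Set
ClosedDistanceMagic {n} Γ =
  ∃[ ℓ ] ∃[ r ] 0 ℕ.< r × ∀ u → sumOver ℕ.+-0-rawMonoid (closedNeighbourhood u) (label ℓ) ≡ r
  where
  open Graph Γ
  label : Fin n ⤖ Fin n → Fin n → ℕ
  label ℓ v = suc (toℕ (Bijection.to ℓ v))

-- {±1, ±c, n/2}
connectionSet : ∀ n .{{_ : NonZero n}} → ℕ → Subset n
connectionSet n c =
  ⁅ residue n (+ 1) ⁆ ∪ ⁅ residue n (ℤ.- + 1) ⁆ ∪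
  ⁅ residue n (+ c) ⁆ ∪ ⁅ residue n (ℤ.- + c) ⁆ ∪
  ⁅ residue n (+ (n ℕ./ 2)) ⁆

module _ (n : ℕ) .{{_ : NonZero n}} where

  χ : Fin n → Fin n → ℂ
  χ j x = cos θ +i sin θ
    where
    θ : ℝ
    θ = (+ (2 ℕ.* toℕ x ℕ.* toℕ j) / n) · π

  χ-sum : Fin n → Subset n → ℂ
  χ-sum j S = sumOver ℂ-+-rawMonoid S (χ j)

  𝒥 : Subset n → Fin n → Set
  𝒥 S j = χ-sum j S ≈ᶜ -1ᶜ

infix 4 _≐_

-- Equality of the sets {a , b} and {c , d} of real numbers.
_≐_ : ℝ × ℝ → ℝ × ℝ → Set
(a , b) ≐ (c , d) = ∀ x → (x ≈ a ⊎ x ≈ b) ⇔ (x ≈ c ⊎ x ≈ d)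

-- ± 2π/3 + 2kπ
twoThirdsπ : Sign → ℤ → ℝ
twoThirdsπ s k = ((s ◃ 2) / 3) · π ⊕ ((+ 2 ℤ.* k) / 1) · π

-- Types of the elements j of 𝒥; membership of j in 𝒥 is not part of these predicates.
module _ (n : ℕ) .{{_ : NonZero n}} (c : ℕ) where

  Type2 : Fin n → Set
  Type2 j = 2 ∣ toℕ j ×
    ∃[ s₁ ] ∃[ s₂ ] ∃[ k₁ ] ∃[ k₂ ]
      ((+ (2 ℕ.* toℕ j) / n) · π , (+ (2 ℕ.* toℕ j ℕ.* c) / n) · π)
        ≐ (twoThirdsπ s₁ k₁ , twoThirdsπ s₂ k₂)

  Type3⁺ : Fin n → Set
  Type3⁺ j = ¬ 2 ∣ toℕ j ×
    ∃[ k ] (+ toℕ j) / 1 ≡ (+ n ℤ.* (+ 2 ℤ.* k ℤ.+ + 1)) / (2 ℕ.* suc c)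

{-# OPTIONS --safe #-}
module Submission where

-- Let T be the shift of functions on ℤ_n, X = T + T⁻¹, Y = T^c + T^-c, m = n / 2, and let F be a
-- magic labelling.  If the reduced form of m / (c + 1) has odd numerator and denominator, the
-- numerator is an eigenvalue index of type 3⁺, and if 3 divides n but not c, then n / 3 is one of
-- type 2.  Otherwise F is not injective:
-- On h = F - T^m F we have T^m = -1 and (T^(c-1) + 1) (T^(c+1) + 1) = 0, where the second factor is
-- invertible by parity; so T^(c-1) h = - h.  If c is even this forces h = 0.  If c is odd,
-- g = F + T^m F - const satisfies (2 + X + Y) g = 0.  On the lattice of such integer functions
-- B = X + 1 does not increase the norm, since
--   |g|² - |B g|² = |(1 + T) (1 + T^c) g|²,
-- and descent on the norm gives X (X + 1) (X + 2) g = 0; this replaces the determination of the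
-- rational angles with cos α + cos β = -1.  Each factor is then invertible, so g = 0, and F has the
-- same value at 0 and at m + c - 1.
-- The values of χ_j come from the addition formula for the Taylor polynomials of cosine and sine.

module CauchyProduct where

  open import Defs
  open Defs.Estimates
  open Defs.Series
  open import Data.Nat.Base as ℕ using (ℕ; zero; suc)
  import Data.Nat.Properties as ℕ
  open import Data.Integer.Base using (+_)
  open import Data.Rational.Base
  open import Data.Rational.Properties
  open import Data.Rational.Solver using (module +-*-Solver)
  open import Relation.Binary.PropositionalEquality
  open +-*-Solver using (solve; _:+_; _:*_; _:-_; :-_; con; _:=_)

  partialSum : (ℕ → ℚ) → ℕ → ℚ
  partialSum f zero    = 0ℚ
  partialSum f (suc N) = partialSum f N + f N

  partialSum-cong : ∀ {f g} → (∀ i → f i ≡ g i) → ∀ N → partialSum f N ≡ partialSum g N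
  partialSum-cong f≡g zero    = refl
  partialSum-cong f≡g (suc N) = cong₂ _+_ (partialSum-cong f≡g N) (f≡g N)

  taylor≡partialSum : ∀ a x N → taylor a x N ≡ partialSum (λ i → a i * expTerm x i) N
  taylor≡partialSum a x zero    = refl
  taylor≡partialSum a x (suc N) = cong (_+ a N * expTerm x N) (taylor≡partialSum a x N)

  partialSum-*ˡ : ∀ p f N → partialSum (λ i → p * f i) N ≡ p * partialSum f N
  partialSum-*ˡ p f zero    = sym (*-zeroʳ p)
  partialSum-*ˡ p f (suc N) = trans (cong (_+ p * f N) (partialSum-*ˡ p f N))
                                    (sym (*-distribˡ-+ p (partialSum f N) (f N)))

  partialSum-head : ∀ f N → partialSum f (suc N) ≡ f 0 + partialSum (λ i → f (suc i)) N
  partialSum-head f zero    = +-comm 0ℚ (f 0)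
  partialSum-head f (suc N) = trans (cong (_+ f (suc N)) (partialSum-head f N))
    (+-assoc (f 0) (partialSum (λ i → f (suc i)) N) (f (suc N)))

  partialSum-tail : ∀ {f F} → (∀ i → ∣ f i ∣ ≤ F i) → ∀ N k →
    ∣ partialSum f (N ℕ.+ k) - partialSum f N ∣ ≤ partialSum F (N ℕ.+ k) - partialSum F N
  partialSum-tail {f} {F} f≤F N zero rewrite ℕ.+-identityʳ N = ≤-reflexive
    (trans (cong ∣_∣ (+-inverseʳ (partialSum f N))) (sym (+-inverseʳ (partialSum F N))))
  partialSum-tail {f} {F} f≤F N (suc k) rewrite ℕ.+-suc N k = ≤-trans
    (≤-cong (cong ∣_∣ (solve 3 (λ p q r → (p :+ q) :- r := (p :- r) :+ q) refl
               (partialSum f (N ℕ.+ k)) (f (N ℕ.+ k)) (partialSum f N))) refl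
      (∣p+q∣≤∣p∣+∣q∣ (partialSum f (N ℕ.+ k) - partialSum f N) (f (N ℕ.+ k))))
    (≤-trans (+-mono-≤ (partialSum-tail f≤F N k) (f≤F (N ℕ.+ k)))
      (≤-reflexive (solve 3 (λ p q r → (p :- r) :+ q := (p :+ q) :- r) refl
               (partialSum F (N ℕ.+ k)) (F (N ℕ.+ k)) (partialSum F N))))

  -- The sums of g i j over i < M , j < N, over i + j < N, and over i + j = k.
  rectangle : (ℕ → ℕ → ℚ) → ℕ → ℕ → ℚ
  rectangle g zero    N = 0ℚ
  rectangle g (suc M) N = partialSum (g 0) N + rectangle (λ i → g (suc i)) M N

  triangle : (ℕ → ℕ → ℚ) → ℕ → ℚ
  triangle g zero    = 0ℚ
  triangle g (suc N) = partialSum (g 0) (suc N) + triangle (λ i → g (suc i)) N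

  antidiagonal : (ℕ → ℕ → ℚ) → ℕ → ℚ
  antidiagonal g zero    = g 0 0
  antidiagonal g (suc k) = g 0 (suc k) + antidiagonal (λ i → g (suc i)) k

  triangle-suc : ∀ g N → triangle g (suc N) ≡ triangle g N + antidiagonal g N
  triangle-suc g zero    = solve 1 (λ x → con 0ℚ :+ x :+ con 0ℚ := con 0ℚ :+ x) refl (g 0 0)
  triangle-suc g (suc N) = trans
    (cong (λ z → partialSum (g 0) (suc (suc N)) + z) (triangle-suc (λ i → g (suc i)) N))
    (solve 4 (λ p x t d → (p :+ x) :+ (t :+ d) := (p :+ t) :+ (x :+ d)) refl
      (partialSum (g 0) (suc N)) (g 0 (suc N)) (triangle (λ i → g (suc i)) N)
      (antidiagonal (λ i → g (suc i)) N))

  triangle≡partialSum : ∀ g N → triangle g N ≡ partialSum (antidiagonal g) N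
  triangle≡partialSum g zero    = refl
  triangle≡partialSum g (suc N) = trans (triangle-suc g N) (cong (_+ antidiagonal g N) (triangle≡partialSum g N))

  partialSum-nonNeg : ∀ {f} → (∀ i → 0ℚ ≤ f i) → ∀ N → 0ℚ ≤ partialSum f N
  partialSum-nonNeg 0≤f zero    = ≤-refl
  partialSum-nonNeg 0≤f (suc N) = +-nonNeg (partialSum-nonNeg 0≤f N) (0≤f N)

  partialSum-mono : ∀ {f} → (∀ i → 0ℚ ≤ f i) → ∀ N k → partialSum f N ≤ partialSum f (N ℕ.+ k)
  partialSum-mono 0≤f N zero    rewrite ℕ.+-identityʳ N = ≤-refl
  partialSum-mono 0≤f N (suc k) rewrite ℕ.+-suc N k =
    ≤-trans (partialSum-mono 0≤f N k) (p≤p+q (0≤f (N ℕ.+ k)))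

  triangle-nonNeg : ∀ {g} → (∀ i j → 0ℚ ≤ g i j) → ∀ N → 0ℚ ≤ triangle g N
  triangle-nonNeg 0≤g zero    = ≤-refl
  triangle-nonNeg 0≤g (suc N) =
    +-nonNeg (partialSum-nonNeg (0≤g 0) (suc N)) (triangle-nonNeg (λ i → 0≤g (suc i)) N)

  rectangle≤triangle : ∀ {g} → (∀ i j → 0ℚ ≤ g i j) → ∀ M N → rectangle g M N ≤ triangle g (M ℕ.+ N)
  rectangle≤triangle 0≤g zero    N = triangle-nonNeg 0≤g N
  rectangle≤triangle {g} 0≤g (suc M) N = +-mono-≤
    (subst (λ k → partialSum (g 0) N ≤ partialSum (g 0) k)
      (trans (ℕ.+-suc N M) (cong suc (ℕ.+-comm N M)))
      (partialSum-mono (0≤g 0) N (suc M)))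
    (rectangle≤triangle (λ i → 0≤g (suc i)) M N)

  rectangle-triangle : ∀ {g G} → (∀ i j → ∣ g i j ∣ ≤ G i j) → ∀ M k →
    ∣ rectangle g M (M ℕ.+ k) - triangle g M ∣ ≤ rectangle G M (M ℕ.+ k) - triangle G M
  rectangle-triangle g≤G zero k = ≤-refl
  rectangle-triangle {g} {G} g≤G (suc M) k = ≤-trans
    (≤-cong (cong ∣_∣ (regroup g)) refl
      (∣p+q∣≤∣p∣+∣q∣ (partialSum (g 0) (suc M ℕ.+ k) - partialSum (g 0) (suc M))
                    (rectangle (λ i → g (suc i)) M (suc M ℕ.+ k) - triangle (λ i → g (suc i)) M)))
    (≤-trans
      (+-mono-≤ (partialSum-tail (g≤G 0) (suc M) k)
        (subst (λ l → ∣ rectangle (λ i → g (suc i)) M l - triangle (λ i → g (suc i)) M ∣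
                        ≤ rectangle (λ i → G (suc i)) M l - triangle (λ i → G (suc i)) M)
          (ℕ.+-suc M k) (rectangle-triangle (λ i → g≤G (suc i)) M (suc k))))
      (≤-reflexive (sym (regroup G))))
    where
    regroup : ∀ f → rectangle f (suc M) (suc M ℕ.+ k) - triangle f (suc M)
      ≡ (partialSum (f 0) (suc M ℕ.+ k) - partialSum (f 0) (suc M))
        + (rectangle (λ i → f (suc i)) M (suc M ℕ.+ k) - triangle (λ i → f (suc i)) M)
    regroup f = solve 4 (λ p r q t → (p :+ r) :- (q :+ t) := (p :- q) :+ (r :- t)) refl
      (partialSum (f 0) (suc M ℕ.+ k)) (rectangle (λ i → f (suc i)) M (suc M ℕ.+ k))
      (partialSum (f 0) (suc M)) (triangle (λ i → f (suc i)) M)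

  rectangle-cong : ∀ {g h} → (∀ i j → g i j ≡ h i j) → ∀ M N → rectangle g M N ≡ rectangle h M N
  rectangle-cong g≡h zero    N = refl
  rectangle-cong g≡h (suc M) N =
    cong₂ _+_ (partialSum-cong (g≡h 0) N) (rectangle-cong (λ i → g≡h (suc i)) M N)

  rectangle-product : ∀ u v M N → rectangle (λ i j → u i * v j) M N ≡ partialSum u M * partialSum v N
  rectangle-product u v zero    N = sym (*-zeroˡ (partialSum v N))
  rectangle-product u v (suc M) N = trans
    (cong₂ _+_ (partialSum-*ˡ (u 0) v N) (rectangle-product (λ i → u (suc i)) v M N))
    (trans (sym (*-distribʳ-+ (partialSum v N) (u 0) (partialSum (λ i → u (suc i)) M)))
           (cong (_* partialSum v N) (sym (partialSum-head u M))))

  partialSum-+ : ∀ f g N → partialSum (λ i → f i + g i) N ≡ partialSum f N + partialSum g N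
  partialSum-+ f g zero    = refl
  partialSum-+ f g (suc N) = trans (cong (_+ (f N + g N)) (partialSum-+ f g N))
    (solve 4 (λ p q x y → (p :+ q) :+ (x :+ y) := (p :+ x) :+ (q :+ y)) refl
      (partialSum f N) (partialSum g N) (f N) (g N))

  rectangle-+ : ∀ g h M N → rectangle (λ i j → g i j + h i j) M N ≡ rectangle g M N + rectangle h M N
  rectangle-+ g h zero    N = refl
  rectangle-+ g h (suc M) N = trans
    (cong₂ _+_ (partialSum-+ (g 0) (h 0) N) (rectangle-+ (λ i → g (suc i)) (λ i → h (suc i)) M N))
    (solve 4 (λ p q x y → (p :+ q) :+ (x :+ y) := (p :+ x) :+ (q :+ y)) refl
      (partialSum (g 0) N) (partialSum (h 0) N)
      (rectangle (λ i → g (suc i)) M N) (rectangle (λ i → h (suc i)) M N))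

  antidiagonal-cong : ∀ {g h} → (∀ i j → g i j ≡ h i j) → ∀ k → antidiagonal g k ≡ antidiagonal h k
  antidiagonal-cong g≡h zero    = g≡h 0 0
  antidiagonal-cong g≡h (suc k) = cong₂ _+_ (g≡h 0 (suc k)) (antidiagonal-cong (λ i → g≡h (suc i)) k)

  antidiagonal-+ : ∀ g h k → antidiagonal (λ i j → g i j + h i j) k ≡ antidiagonal g k + antidiagonal h k
  antidiagonal-+ g h zero    = refl
  antidiagonal-+ g h (suc k) = trans
    (cong (λ z → g 0 (suc k) + h 0 (suc k) + z) (antidiagonal-+ (λ i → g (suc i)) (λ i → h (suc i)) k))
    (solve 4 (λ p q x y → (p :+ q) :+ (x :+ y) := (p :+ x) :+ (q :+ y)) refl
      (g 0 (suc k)) (h 0 (suc k)) (antidiagonal (λ i → g (suc i)) k) (antidiagonal (λ i → h (suc i)) k))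

  antidiagonal-*ˡ : ∀ p g k → antidiagonal (λ i j → p * g i j) k ≡ p * antidiagonal g k
  antidiagonal-*ˡ p g zero    = refl
  antidiagonal-*ˡ p g (suc k) = trans
    (cong (λ z → p * g 0 (suc k) + z) (antidiagonal-*ˡ p (λ i → g (suc i)) k))
    (sym (*-distribˡ-+ p (g 0 (suc k)) (antidiagonal (λ i → g (suc i)) k)))

  antidiagonal-weight : ∀ (w : ℕ → ℚ) g k → antidiagonal (λ i j → w (i ℕ.+ j) * g i j) k ≡ w k * antidiagonal g k
  antidiagonal-weight w g zero    = refl
  antidiagonal-weight w g (suc k) = trans
    (cong (λ z → w (suc k) * g 0 (suc k) + z) (antidiagonal-weight (λ i → w (suc i)) (λ i → g (suc i)) k))
    (sym (*-distribˡ-+ (w (suc k)) (g 0 (suc k)) (antidiagonal (λ i → g (suc i)) k)))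

  antidiagonal-last : ∀ g k → antidiagonal g (suc k) ≡ antidiagonal (λ i j → g i (suc j)) k + g (suc k) 0
  antidiagonal-last g zero    = refl
  antidiagonal-last g (suc k) = trans
    (cong (λ z → g 0 (suc (suc k)) + z) (antidiagonal-last (λ i → g (suc i)) k))
    (sym (+-assoc (g 0 (suc (suc k))) (antidiagonal (λ i j → g (suc i) (suc j)) k) (g (suc (suc k)) 0)))

  expTerm-suc : ∀ x i → ι (suc i) * expTerm x (suc i) ≡ x * expTerm x i
  expTerm-suc x i = trans
    (solve 4 (λ m e x r → m :* (e :* (x :* r)) := (m :* r) :* (x :* e)) refl
      (ι (suc i)) (expTerm x i) x (+ 1 / suc i))
    (trans (cong (_* (x * expTerm x i)) (ι-inverse i)) (*-identityˡ (x * expTerm x i)))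

  -- The binomial theorem, by induction from (i + j) e i e j = x e (i - 1) e j + y e i e (j - 1).
  expTerm-+ : ∀ x y k → expTerm (x + y) k ≡ antidiagonal (λ i j → expTerm x i * expTerm y j) k
  expTerm-+ x y zero    = refl
  expTerm-+ x y (suc k) = sym (trans
    (solve-weight (trans (sym (antidiagonal-weight ι e (suc k))) weighted))
    (trans (cong (λ z → (x + y) * z * r) (sym (expTerm-+ x y k)))
      (solve 3 (λ s e r → s :* e :* r := e :* (s :* r)) refl (x + y) (expTerm (x + y) k) r)))
    where
    r = + 1 / suc k
    e : ℕ → ℕ → ℚ
    e i j = expTerm x i * expTerm y j
    D = antidiagonal e k
    solve-weight : ∀ {p q} → ι (suc k) * p ≡ q → p ≡ q * r
    solve-weight {p} {q} eq = trans (sym (*-identityˡ p)) (trans (cong (_* p) (sym (ι-inverse k)))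
      (trans (solve 3 (λ m r p → m :* r :* p := m :* p :* r) refl (ι (suc k)) r p) (cong (_* r) eq)))
    first : antidiagonal (λ i j → ι i * e i j) (suc k) ≡ x * D
    first = trans (cong₂ _+_ (*-zeroˡ (e 0 (suc k)))
        (trans (antidiagonal-cong (λ i j → trans (sym (*-assoc (ι (suc i)) (expTerm x (suc i)) (expTerm y j)))
                 (trans (cong (_* expTerm y j) (expTerm-suc x i)) (*-assoc x (expTerm x i) (expTerm y j)))) k)
               (antidiagonal-*ˡ x e k)))
      (+-identityˡ (x * D))
    second : antidiagonal (λ i j → ι j * e i j) (suc k) ≡ y * D
    second = trans (antidiagonal-last (λ i j → ι j * e i j) k) (trans (cong₂ _+_
        (trans (antidiagonal-cong (λ i j → trans
                  (solve 3 (λ m p q → m :* (p :* q) := p :* (m :* q)) refl (ι (suc j)) (expTerm x i) (expTerm y (suc j)))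
                  (trans (cong (expTerm x i *_) (expTerm-suc y j))
                         (solve 3 (λ p y q → p :* (y :* q) := y :* (p :* q)) refl (expTerm x i) y (expTerm y j)))) k)
               (antidiagonal-*ˡ y e k))
        (*-zeroˡ (e (suc k) 0)))
      (+-identityʳ (y * D)))
    weighted : antidiagonal (λ i j → ι (i ℕ.+ j) * e i j) (suc k) ≡ (x + y) * D
    weighted = trans (antidiagonal-cong (λ i j → trans (cong (_* e i j) (ι-+ i j))
                                              (*-distribʳ-+ (e i j) (ι i) (ι j))) (suc k))
      (trans (antidiagonal-+ (λ i j → ι i * e i j) (λ i j → ι j * e i j) (suc k))
        (trans (cong₂ _+_ first second) (sym (*-distribʳ-+ D x y))))

module CosineSine where

  open import Defs
  open CauchyProduct
  open Defs.Estimates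
  open Defs.Series
  open Defs.Sequences using (bounded)
  open Defs.HalfPi using (halfπ∈I; I⇒≤B; I⇒0≤)
  open import Data.Nat.Base as ℕ using (ℕ; zero; suc)
  import Data.Nat.Properties as ℕ
  open import Data.Integer.Base using (+_)
  open import Data.Product.Base using (∃-syntax; _×_; _,_; proj₁; proj₂)
  open import Data.Rational.Base
  open import Data.Rational.Properties
  open import Data.Rational.Solver using (module +-*-Solver)
  open import Relation.Binary.PropositionalEquality hiding ([_])
  open import Relation.Nullary.Decidable using (toWitness)
  open +-*-Solver using (solve; _:+_; _:*_; _:-_; :-_; con; _:=_)

  record Null (s : ℕ → ℚ) : Set where
    constructor null
    field small : ∀ {ε} → 0ℚ < ε → ∃[ N ] ∀ n → N ℕ.≤ n → ∣ s n ∣ < ε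

  open Null

  Bounded : (ℕ → ℚ) → Set
  Bounded s = ∃[ b ] ∀ n → ∣ s n ∣ ≤ ι b

  null-≤ : ∀ {s t} → (∀ n → ∣ t n ∣ ≤ ∣ s n ∣) → Null s → Null t
  null-≤ t≤s (null h) = null λ 0<ε → let N , p = h 0<ε in N , λ n N≤n → ≤-<-trans (t≤s n) (p n N≤n)

  null-cong : ∀ {s t} → (∀ n → t n ≡ s n) → Null s → Null t
  null-cong t≡s = null-≤ (λ n → ≤-reflexive (cong ∣_∣ (t≡s n)))

  null-+ : ∀ {s t} → Null s → Null t → Null (λ n → s n + t n)
  null-+ {s} {t} (null h) (null k) = null λ {ε} 0<ε →
    let M , p = h (*-pos 0<½ 0<ε)
        N , q = k (*-pos 0<½ 0<ε)
    in M ℕ.⊔ N , λ n n≥ → subst (∣ s n + t n ∣ <_) (halves ε)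
         (≤-<-trans (∣p+q∣≤∣p∣+∣q∣ (s n) (t n))
           (+-mono-< (p n (ℕ.≤-trans (ℕ.m≤m⊔n M N) n≥)) (q n (ℕ.≤-trans (ℕ.m≤n⊔m M N) n≥))))

  null-neg : ∀ {s} → Null s → Null (λ n → - s n)
  null-neg {s} = null-≤ (λ n → ≤-reflexive (∣-p∣≡∣p∣ (s n)))

  null-* : ∀ {u s} → Bounded u → Null s → Null (λ n → u n * s n)
  null-* {u} {s} (b , u≤b) (null h) = null λ {ε} 0<ε →
    let N , p = h (*-pos 0<ε 0<1/) in
    N , λ n N≤n → ≤-<-trans
      (≤-cong (∣p*q∣≡∣p∣*∣q∣ (u n) (s n)) refl
        (*-monoʳ (0≤∣p∣ (s n)) (≤-trans (u≤b n) (p≤q+p {ι b} {1ℚ} 0≤1))))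
      (<-≤-trans (*-monoʳ-<-pos (ι (suc b)) {{positive 0<ιb}} (p n N≤n))
        (≤-reflexive (trans
          (solve 3 (λ l e i → l :* (e :* i) := e :* (l :* i)) refl (ι (suc b)) ε (+ 1 / suc b))
          (trans (cong (λ z → ε * z) (ι-inverse b)) (*-identityʳ ε)))))
    where
    0<ιb : 0ℚ < ι (suc b)
    0<ιb = <-≤-trans (toWitness {a? = 0ℚ <? 1ℚ} _) (p≤p+q (0≤ι b))
    0<1/ : 0ℚ < + 1 / suc b
    0<1/ = positive⁻¹ (+ 1 / suc b) {{normalize-pos 1 (suc b)}}

  const-bounded : ∀ p → Bounded (λ _ → p)
  const-bounded p = let b , p≤b = archimedean ∣ p ∣ in b , λ _ → p≤b

  null-*ᶜ : ∀ p {s} → Null s → Null (λ n → p * s n)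
  null-*ᶜ p = null-* (const-bounded p)

  null-from : ∀ N {s} → (∀ n → N ℕ.≤ n → s n ≡ 0ℚ) → Null s
  null-from N h = null λ {ε} 0<ε → N , λ n N≤n → subst (_< ε) (sym (cong ∣_∣ (h n N≤n))) 0<ε

  null-cancel : ∀ {u s : ℕ → ℚ} N → (∀ n → N ℕ.≤ n → + 1 / 6 ≤ u n) → Null (λ n → u n * s n) → Null s
  null-cancel {u} {s} N u≥ (null h) = null λ {ε} 0<ε →
    let 0<6⁻¹ = toWitness {a? = 0ℚ <? + 1 / 6} _
        M , p = h (*-pos 0<6⁻¹ 0<ε)
    in N ℕ.⊔ M , λ n n≥ →
      let u≥′ = u≥ n (ℕ.≤-trans (ℕ.m≤m⊔n N M) n≥)
      in *-cancelˡ-<-nonNeg (+ 1 / 6)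
        (≤-<-trans
          (≤-trans (*-monoʳ (0≤∣p∣ (s n)) (≤-trans u≥′ (p≤∣p∣ (u n))))
                   (≤-reflexive (sym (∣p*q∣≡∣p∣*∣q∣ (u n) (s n)))))
          (p n (ℕ.≤-trans (ℕ.m≤n⊔m N M) n≥)))

  taylor-+ : ∀ a → (∀ i → ∣ a i ∣ ≤ 1ℚ) → ∀ b {x y : ℕ → ℚ} →
    (∀ n → ∣ x n ∣ ≤ ι b) → (∀ n → ∣ y n ∣ ≤ ι b) →
    Null (λ n → rectangle (λ i j → a (i ℕ.+ j) * (expTerm (x n) i * expTerm (y n) j)) n n
                - taylor a (x n + y n) n)
  taylor-+ a a≤1 b {x} {y} x≤ y≤ = null-≤ bound
    (null λ 0<ε → let N , p = E₂.E-cauchy 0<ε in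
      N , λ n N≤n → p (n ℕ.+ n) n (ℕ.≤-trans N≤n (ℕ.m≤m+n n n)) N≤n)
    where
    module E₁ = Bounds b
    module E₂ = Bounds (b ℕ.+ b)
    G : ℕ → ℕ → ℚ
    G i j = E₁.e i * E₁.e j
    0≤G : ∀ i j → 0ℚ ≤ G i j
    0≤G i j = *-nonNeg (E₁.0≤e i) (E₁.0≤e j)
    g : ℕ → ℕ → ℕ → ℚ
    g n i j = a (i ℕ.+ j) * (expTerm (x n) i * expTerm (y n) j)
    g≤G : ∀ n i j → ∣ g n i j ∣ ≤ G i j
    g≤G n i j = ≤-cong
      (trans (∣p*q∣≡∣p∣*∣q∣ (a (i ℕ.+ j)) (expTerm (x n) i * expTerm (y n) j))
        (cong (λ z → ∣ a (i ℕ.+ j) ∣ * z) (∣p*q∣≡∣p∣*∣q∣ (expTerm (x n) i) (expTerm (y n) j))))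
      (sym (*-identityˡ (G i j)))
      (*-mono 0≤1 (*-nonNeg (0≤∣p∣ (expTerm (x n) i)) (0≤∣p∣ (expTerm (y n) j))) (a≤1 (i ℕ.+ j))
        (*-mono (E₁.0≤e i) (0≤∣p∣ (expTerm (y n) j)) (E₁.term≤ (x≤ n) i) (E₁.term≤ (y≤ n) j)))
    triangle-g : ∀ n → triangle (g n) n ≡ taylor a (x n + y n) n
    triangle-g n = trans (triangle≡partialSum (g n) n) (trans
      (partialSum-cong (λ k → trans
        (antidiagonal-weight a (λ i j → expTerm (x n) i * expTerm (y n) j) k)
        (cong (λ z → a k * z) (sym (expTerm-+ (x n) (y n) k)))) n)
      (sym (taylor≡partialSum a (x n + y n) n)))
    triangle-G : ∀ n → triangle G n ≡ E₂.E n
    triangle-G n = trans (triangle≡partialSum G n) (trans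
      (partialSum-cong (λ k → trans (sym (expTerm-+ (ι b) (ι b) k))
        (trans (cong (λ z → expTerm z k) (sym (ι-+ b b))) (sym (*-identityˡ (E₂.e k))))) n)
      (sym (taylor≡partialSum (λ _ → 1ℚ) (ι (b ℕ.+ b)) n)))
    bound : ∀ n → ∣ rectangle (g n) n n - taylor a (x n + y n) n ∣ ≤ ∣ E₂.E (n ℕ.+ n) - E₂.E n ∣
    bound n = ≤-trans
      (≤-cong (cong₂ (λ k t → ∣ rectangle (g n) n k - t ∣) (sym (ℕ.+-identityʳ n)) (sym (triangle-g n))) refl
        (rectangle-triangle (g≤G n) n 0))
      (≤-trans
        (≤-cong (cong (λ k → rectangle G n k - triangle G n) (ℕ.+-identityʳ n))
          (cong₂ _-_ (sym (triangle-G (n ℕ.+ n))) (sym (triangle-G n)))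
          (+-monoˡ-≤ (- triangle G n) (rectangle≤triangle 0≤G n n)))
        (p≤∣p∣ (E₂.E (n ℕ.+ n) - E₂.E n)))

  sinCoeff-suc : ∀ j → sinCoeff (suc j) ≡ cosCoeff j
  sinCoeff-suc zero          = refl
  sinCoeff-suc (suc zero)    = refl
  sinCoeff-suc (suc (suc j)) = cong -_ (sinCoeff-suc j)

  cosCoeff-suc : ∀ j → cosCoeff (suc j) ≡ - sinCoeff j
  cosCoeff-suc zero          = refl
  cosCoeff-suc (suc zero)    = refl
  cosCoeff-suc (suc (suc j)) = cong -_ (cosCoeff-suc j)

  cosCoeff-+ : ∀ i j → cosCoeff (i ℕ.+ j) ≡ cosCoeff i * cosCoeff j - sinCoeff i * sinCoeff j
  cosCoeff-+ zero j = solve 2 (λ c s → c := con 1ℚ :* c :- con 0ℚ :* s) refl (cosCoeff j) (sinCoeff j)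
  cosCoeff-+ (suc zero) j = trans (cosCoeff-suc j)
    (solve 2 (λ c s → :- s := con 0ℚ :* c :- con 1ℚ :* s) refl (cosCoeff j) (sinCoeff j))
  cosCoeff-+ (suc (suc i)) j = trans (cong -_ (cosCoeff-+ i j))
    (solve 4 (λ a b c d → :- (a :* b :- c :* d) := (:- a) :* b :- (:- c) :* d) refl
      (cosCoeff i) (cosCoeff j) (sinCoeff i) (sinCoeff j))

  sinCoeff-+ : ∀ i j → sinCoeff (i ℕ.+ j) ≡ sinCoeff i * cosCoeff j + cosCoeff i * sinCoeff j
  sinCoeff-+ zero j = solve 2 (λ c s → s := con 0ℚ :* c :+ con 1ℚ :* s) refl (cosCoeff j) (sinCoeff j)
  sinCoeff-+ (suc zero) j = trans (sinCoeff-suc j)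
    (solve 2 (λ c s → c := con 1ℚ :* c :+ con 0ℚ :* s) refl (cosCoeff j) (sinCoeff j))
  sinCoeff-+ (suc (suc i)) j = trans (cong -_ (sinCoeff-+ i j))
    (solve 4 (λ a b c d → :- (a :* b :+ c :* d) := (:- a) :* b :+ (:- c) :* d) refl
      (sinCoeff i) (cosCoeff j) (cosCoeff i) (sinCoeff j))

  rectangle-taylor : ∀ a b x y M N →
    rectangle (λ i j → (a i * b j) * (expTerm x i * expTerm y j)) M N ≡ taylor a x M * taylor b y N
  rectangle-taylor a b x y M N = trans
    (rectangle-cong (λ i j → solve 4 (λ a b p q → (a :* b) :* (p :* q) := (a :* p) :* (b :* q)) refl
      (a i) (b j) (expTerm x i) (expTerm y j)) M N)
    (trans (rectangle-product (λ i → a i * expTerm x i) (λ j → b j * expTerm y j) M N)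
      (sym (cong₂ _*_ (taylor≡partialSum a x M) (taylor≡partialSum b y N))))

  cosπ sinπ : ℚ → ℕ → ℚ
  cosπ q = seq (cos (q · π))
  sinπ q = seq (sin (q · π))

  cosπ-bounded : ∀ q → Bounded (cosπ q)
  cosπ-bounded q = bounded (cosπ q) (cauchy (cos (q · π)))

  sinπ-bounded : ∀ q → Bounded (sinπ q)
  sinπ-bounded q = bounded (sinπ q) (cauchy (sin (q · π)))

  common-bound : ∀ {s t} → Bounded s → Bounded t → ∃[ b ] (∀ n → ∣ s n ∣ ≤ ι b) × (∀ n → ∣ t n ∣ ≤ ι b)
  common-bound {s} {t} (b , s≤) (c , t≤) = b ℕ.+ c ,
    (λ n → ≤-trans (s≤ n) (≤-cong refl (ι-+ b c) (p≤p+q {ι b} (0≤ι c)))) ,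
    (λ n → ≤-trans (t≤ n) (≤-cong refl (ι-+ b c) (p≤q+p {ι c} (0≤ι b))))

  argument-bounded : ∀ q → Bounded (λ n → q * seq π n)
  argument-bounded q = bounded (seq (q · π)) (cauchy (q · π))

  cosπ-+ : ∀ p q → Null (λ n → (cosπ p n * cosπ q n - sinπ p n * sinπ q n) - cosπ (p + q) n)
  cosπ-+ p q =
    let b , p≤ , q≤ = common-bound (argument-bounded p) (argument-bounded q)
    in null-cong (λ n → cong₂ _-_ (expand n) (cong (λ z → taylor cosCoeff z n) (*-distribʳ-+ (seq π n) p q)))
         (taylor-+ cosCoeff cosCoeff≤1 b p≤ q≤)
    where
    expand : ∀ n → cosπ p n * cosπ q n - sinπ p n * sinπ q n ≡
      rectangle (λ i j → cosCoeff (i ℕ.+ j) * (expTerm (p * seq π n) i * expTerm (q * seq π n) j)) n n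
    expand n = sym (trans
      (rectangle-cong (λ i j → trans (cong (λ z → z * (e i * f j)) (cosCoeff-+ i j))
        (solve 6 (λ a b c d e f → (a :* b :- c :* d) :* (e :* f)
            := (a :* b) :* (e :* f) :+ ((:- c) :* d) :* (e :* f)) refl
          (cosCoeff i) (cosCoeff j) (sinCoeff i) (sinCoeff j) (e i) (f j))) n n)
      (trans (rectangle-+ (λ i j → (cosCoeff i * cosCoeff j) * (e i * f j))
                          (λ i j → (- sinCoeff i * sinCoeff j) * (e i * f j)) n n)
        (trans (cong₂ _+_ (rectangle-taylor cosCoeff cosCoeff _ _ n n)
                          (trans (rectangle-taylor (λ i → - sinCoeff i) sinCoeff _ _ n n)
                                 (cong (λ z → z * sinπ q n) (taylor-neg sinCoeff _ n))))
          (cong (λ z → cosπ p n * cosπ q n + z) (sym (neg-distribˡ-* (sinπ p n) (sinπ q n)))))))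
      where
      e f : ℕ → ℚ
      e = expTerm (p * seq π n)
      f = expTerm (q * seq π n)
      taylor-neg : ∀ a x N → taylor (λ i → - a i) x N ≡ - taylor a x N
      taylor-neg a x zero    = refl
      taylor-neg a x (suc N) = trans (cong (λ z → z + (- a N) * expTerm x N) (taylor-neg a x N))
        (solve 3 (λ t a e → :- t :+ (:- a) :* e := :- (t :+ a :* e)) refl (taylor a x N) (a N) (expTerm x N))

  sinπ-+ : ∀ p q → Null (λ n → (sinπ p n * cosπ q n + cosπ p n * sinπ q n) - sinπ (p + q) n)
  sinπ-+ p q =
    let b , p≤ , q≤ = common-bound (argument-bounded p) (argument-bounded q)
    in null-cong (λ n → cong₂ _-_ (expand n) (cong (λ z → taylor sinCoeff z n) (*-distribʳ-+ (seq π n) p q)))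
         (taylor-+ sinCoeff sinCoeff≤1 b p≤ q≤)
    where
    expand : ∀ n → sinπ p n * cosπ q n + cosπ p n * sinπ q n ≡
      rectangle (λ i j → sinCoeff (i ℕ.+ j) * (expTerm (p * seq π n) i * expTerm (q * seq π n) j)) n n
    expand n = sym (trans
      (rectangle-cong (λ i j → trans (cong (λ z → z * (e i * f j)) (sinCoeff-+ i j))
        (*-distribʳ-+ (e i * f j) (sinCoeff i * cosCoeff j) (cosCoeff i * sinCoeff j))) n n)
      (trans (rectangle-+ (λ i j → (sinCoeff i * cosCoeff j) * (e i * f j))
                          (λ i j → (cosCoeff i * sinCoeff j) * (e i * f j)) n n)
        (cong₂ _+_ (rectangle-taylor sinCoeff cosCoeff _ _ n n) (rectangle-taylor cosCoeff sinCoeff _ _ n n))))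
      where
      e f : ℕ → ℚ
      e = expTerm (p * seq π n)
      f = expTerm (q * seq π n)

  expTerm-neg : ∀ x i → expTerm (- x) (suc (suc i)) ≡ expTerm (- x) i * (x * (+ 1 / suc i)) * (x * (+ 1 / suc (suc i)))
  expTerm-neg x i = solve 4 (λ e x r s → e :* ((:- x) :* r) :* ((:- x) :* s) := e :* (x :* r) :* (x :* s)) refl
    (expTerm (- x) i) x (+ 1 / suc i) (+ 1 / suc (suc i))

  cosTerm-neg : ∀ x i → cosCoeff i * expTerm (- x) i ≡ cosCoeff i * expTerm x i
  cosTerm-neg x zero = refl
  cosTerm-neg x (suc zero) = trans (*-zeroˡ (expTerm (- x) 1)) (sym (*-zeroˡ (expTerm x 1)))
  cosTerm-neg x (suc (suc i)) = trans
    (cong (λ z → (- cosCoeff i) * z) (expTerm-neg x i))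
    (trans (solve 4 (λ c e p q → (:- c) :* (e :* p :* q) := (:- (c :* e)) :* (p :* q)) refl
             (cosCoeff i) (expTerm (- x) i) (x * (+ 1 / suc i)) (x * (+ 1 / suc (suc i))))
      (trans (cong (λ z → (- z) * ((x * (+ 1 / suc i)) * (x * (+ 1 / suc (suc i))))) (cosTerm-neg x i))
        (solve 4 (λ c e p q → (:- (c :* e)) :* (p :* q) := (:- c) :* (e :* p :* q)) refl
             (cosCoeff i) (expTerm x i) (x * (+ 1 / suc i)) (x * (+ 1 / suc (suc i))))))

  sinTerm-neg : ∀ x i → sinCoeff i * expTerm (- x) i ≡ - (sinCoeff i * expTerm x i)
  sinTerm-neg x zero = refl
  sinTerm-neg x (suc zero) = solve 1 (λ x → con 1ℚ :* (con 1ℚ :* ((:- x) :* con 1ℚ)) := :- (con 1ℚ :* (con 1ℚ :* (x :* con 1ℚ)))) refl x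
  sinTerm-neg x (suc (suc i)) = trans
    (cong (λ z → (- sinCoeff i) * z) (expTerm-neg x i))
    (trans (solve 4 (λ c e p q → (:- c) :* (e :* p :* q) := (:- (c :* e)) :* (p :* q)) refl
             (sinCoeff i) (expTerm (- x) i) (x * (+ 1 / suc i)) (x * (+ 1 / suc (suc i))))
      (trans (cong (λ z → (- z) * ((x * (+ 1 / suc i)) * (x * (+ 1 / suc (suc i))))) (sinTerm-neg x i))
        (solve 4 (λ c e p q → (:- (:- (c :* e))) :* (p :* q) := :- ((:- c) :* (e :* p :* q))) refl
             (sinCoeff i) (expTerm x i) (x * (+ 1 / suc i)) (x * (+ 1 / suc (suc i))))))

  cosπ-neg : ∀ q n → cosπ (- q) n ≡ cosπ q n
  cosπ-neg q n = trans (cong (λ z → taylor cosCoeff z n) (sym (neg-distribˡ-* q (seq π n))))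
    (trans (taylor≡partialSum cosCoeff _ n)
      (trans (partialSum-cong (cosTerm-neg (q * seq π n)) n) (sym (taylor≡partialSum cosCoeff _ n))))

  sinπ-neg : ∀ q n → sinπ (- q) n ≡ - sinπ q n
  sinπ-neg q n = trans (cong (λ z → taylor sinCoeff z n) (sym (neg-distribˡ-* q (seq π n)))) (odd n)
    where
    odd : ∀ N → taylor sinCoeff (- (q * seq π n)) N ≡ - taylor sinCoeff (q * seq π n) N
    odd zero    = refl
    odd (suc N) = trans (cong₂ _+_ (odd N) (sinTerm-neg (q * seq π n) N))
      (sym (neg-distrib-+ (taylor sinCoeff (q * seq π n) N) (sinCoeff N * expTerm (q * seq π n) N)))

  taylor-cos-0 : ∀ N → taylor cosCoeff 0ℚ (suc N) ≡ 1ℚ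
  taylor-cos-0 zero    = refl
  taylor-cos-0 (suc N) = trans (cong₂ _+_ (taylor-cos-0 N)
      (solve 3 (λ c e r → c :* (e :* (con 0ℚ :* r)) := con 0ℚ) refl (cosCoeff (suc N)) (expTerm 0ℚ N) (+ 1 / suc N)))
    (+-identityʳ 1ℚ)

  cosπ-0 : Null (λ n → cosπ 0ℚ n - 1ℚ)
  cosπ-0 = null-from 1 λ where
    (suc n) _ → cong (λ z → z - 1ℚ)
      (trans (cong (λ z → taylor cosCoeff z (suc n)) (*-zeroˡ (seq π (suc n)))) (taylor-cos-0 n))

  pythagoras : ∀ q → Null (λ n → cosπ q n * cosπ q n + sinπ q n * sinπ q n - 1ℚ)
  pythagoras q = null-cong (λ n → trans
      (solve 3 (λ c s z → c :* c :+ s :* s :- con 1ℚ := ((c :* c :- s :* (:- s)) :- z) :+ (z :- con 1ℚ)) refl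
                (cosπ q n) (sinπ q n) (cosπ 0ℚ n))
      (cong (λ z → z + (cosπ 0ℚ n - 1ℚ))
        (cong₂ _-_ (cong₂ (λ c s → cosπ q n * c - sinπ q n * s) (sym (cosπ-neg q n)) (sym (sinπ-neg q n)))
          (cong (λ r → cosπ r n) (sym (+-inverseʳ q))))))
    (null-+ (cosπ-+ q (- q)) cosπ-0)

  cosπ-½ : Null (cosπ ½)
  cosπ-½ = null-cong split (null-+ increment (null-neg tail))
    where
    open Bounds 2
    split : ∀ n → cosπ ½ n ≡ (halfπ (suc n) - halfπ n)
      + - (taylor cosCoeff (halfπ n) (8 ℕ.+ n) - taylor cosCoeff (halfπ n) n)
    split n = trans
      (cong (λ z → taylor cosCoeff z n) (solve 1 (λ h → con ½ :* (con (+ 2 / 1) :* h) := h) refl (halfπ n)))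
      (solve 3 (λ h t u → u := ((h :+ t) :- h) :+ (:- (t :- u))) refl
        (halfπ n) (taylor cosCoeff (halfπ n) (8 ℕ.+ n)) (taylor cosCoeff (halfπ n) n))
    increment : Null (λ n → halfπ (suc n) - halfπ n)
    increment = null λ 0<ε → let N , p = HalfPi.halfπ-cauchy 0<ε in
      N , λ n N≤n → p (suc n) n (ℕ.m≤n⇒m≤1+n N≤n) N≤n
    tail : Null (λ n → taylor cosCoeff (halfπ n) (8 ℕ.+ n) - taylor cosCoeff (halfπ n) n)
    tail = null-≤ {λ n → E (8 ℕ.+ n) - E n} (λ n → subst (λ k → ∣ taylor cosCoeff (halfπ n) k - taylor cosCoeff (halfπ n) n ∣ ≤ ∣ E k - E n ∣)
                           (ℕ.+-comm n 8)
                           (≤-trans (taylor-tail cosCoeff cosCoeff≤1 (I⇒≤B (halfπ∈I n)) n 8) (p≤∣p∣ (E (n ℕ.+ 8) - E n))))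
      (null λ 0<ε → let N , p = E-cauchy 0<ε in
        N , λ n N≤n → p (8 ℕ.+ n) n (ℕ.≤-trans N≤n (ℕ.m≤n+m n 8)) N≤n)

  2ℚ : ℚ
  2ℚ = 1ℚ + 1ℚ

  cosπ-double : ∀ q → Null (λ n → (2ℚ * (cosπ q n * cosπ q n) - 1ℚ) - cosπ (q + q) n)
  cosπ-double q = null-cong
    (λ n → solve 3 (λ c s d → (con 2ℚ :* (c :* c) :- con 1ℚ) :- d
        := ((c :* c :- s :* s) :- d) :+ (c :* c :+ s :* s :- con 1ℚ)) refl
      (cosπ q n) (sinπ q n) (cosπ (q + q) n))
    (null-+ (cosπ-+ q q) (pythagoras q))

  cosπ-1 : Null (λ n → cosπ 1ℚ n + 1ℚ)
  cosπ-1 = null-cong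
    (λ n → solve 2 (λ c d → d :+ con 1ℚ := con 2ℚ :* (c :* c) :+ (:- ((con 2ℚ :* (c :* c) :- con 1ℚ) :- d))) refl
      (cosπ ½ n) (cosπ 1ℚ n))
    (null-+ (null-*ᶜ 2ℚ (null-* (cosπ-bounded ½) cosπ-½)) (null-neg (cosπ-double ½)))

  sinπ-1 : Null (sinπ 1ℚ)
  sinπ-1 = null-cong
    (λ n → solve 3 (λ c s d → d := con 2ℚ :* (s :* c) :+ (:- ((s :* c :+ c :* s) :- d))) refl
      (cosπ ½ n) (sinπ ½ n) (sinπ 1ℚ n))
    (null-+ (null-*ᶜ 2ℚ (null-* (sinπ-bounded ½) cosπ-½)) (null-neg (sinπ-+ ½ ½)))

  Period : ℚ → Set
  Period r = ∀ q → Null (λ n → cosπ (q + r) n - cosπ q n) × Null (λ n → sinπ (q + r) n - sinπ q n)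

  Antiperiod : ℚ → Set
  Antiperiod r = ∀ q → Null (λ n → cosπ (q + r) n + cosπ q n) × Null (λ n → sinπ (q + r) n + sinπ q n)

  antiperiod-1 : Antiperiod 1ℚ
  antiperiod-1 q =
    null-cong
      (λ n → solve 5 (λ d c s c₁ s₁ → d :+ c
          := (:- ((c :* c₁ :- s :* s₁) :- d)) :+ (c :* (c₁ :+ con 1ℚ) :+ (:- (s :* s₁)))) refl
        (cosπ (q + 1ℚ) n) (cosπ q n) (sinπ q n) (cosπ 1ℚ n) (sinπ 1ℚ n))
      (null-+ (null-neg (cosπ-+ q 1ℚ))
        (null-+ (null-* (cosπ-bounded q) cosπ-1) (null-neg (null-* (sinπ-bounded q) sinπ-1)))) ,
    null-cong
      (λ n → solve 5 (λ d c s c₁ s₁ → d :+ s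
          := (:- ((s :* c₁ :+ c :* s₁) :- d)) :+ (s :* (c₁ :+ con 1ℚ) :+ c :* s₁)) refl
        (sinπ (q + 1ℚ) n) (cosπ q n) (sinπ q n) (cosπ 1ℚ n) (sinπ 1ℚ n))
      (null-+ (null-neg (sinπ-+ q 1ℚ))
        (null-+ (null-* (sinπ-bounded q) cosπ-1) (null-* (cosπ-bounded q) sinπ-1)))

  antiperiod-+ : ∀ {r s} → Antiperiod r → Antiperiod s → Period (r + s)
  antiperiod-+ {r} {s} R S q =
    combine cosπ (proj₁ (R q)) (proj₁ (S (q + r))) , combine sinπ (proj₂ (R q)) (proj₂ (S (q + r)))
    where
    combine : ∀ (f : ℚ → ℕ → ℚ) → Null (λ n → f (q + r) n + f q n) → Null (λ n → f (q + r + s) n + f (q + r) n) →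
              Null (λ n → f (q + (r + s)) n - f q n)
    combine f R′ S′ = null-cong
      (λ n → trans (cong (λ z → f z n - f q n) (sym (+-assoc q r s)))
        (solve 3 (λ x y z → z :- x := (z :+ y) :+ (:- (y :+ x))) refl (f q n) (f (q + r) n) (f (q + r + s) n)))
      (null-+ S′ (null-neg R′))

  period-+ : ∀ {r s} → Period r → Period s → Period (r + s)
  period-+ {r} {s} R S q =
    combine cosπ (proj₁ (R q)) (proj₁ (S (q + r))) , combine sinπ (proj₂ (R q)) (proj₂ (S (q + r)))
    where
    combine : ∀ (f : ℚ → ℕ → ℚ) → Null (λ n → f (q + r) n - f q n) → Null (λ n → f (q + r + s) n - f (q + r) n) →
              Null (λ n → f (q + (r + s)) n - f q n)
    combine f R′ S′ = null-cong
      (λ n → trans (cong (λ z → f z n - f q n) (sym (+-assoc q r s)))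
        (solve 3 (λ x y z → z :- x := (z :- y) :+ (y :- x)) refl (f q n) (f (q + r) n) (f (q + r + s) n)))
      (null-+ S′ R′)

  period-antiperiod : ∀ {r s} → Period r → Antiperiod s → Antiperiod (r + s)
  period-antiperiod {r} {s} R S q =
    combine cosπ (proj₁ (R q)) (proj₁ (S (q + r))) , combine sinπ (proj₂ (R q)) (proj₂ (S (q + r)))
    where
    combine : ∀ (f : ℚ → ℕ → ℚ) → Null (λ n → f (q + r) n - f q n) → Null (λ n → f (q + r + s) n + f (q + r) n) →
              Null (λ n → f (q + (r + s)) n + f q n)
    combine f R′ S′ = null-cong
      (λ n → trans (cong (λ z → f z n + f q n) (sym (+-assoc q r s)))
        (solve 3 (λ x y z → z :+ x := (z :+ y) :+ (:- (y :- x))) refl (f q n) (f (q + r) n) (f (q + r + s) n)))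
      (null-+ S′ (null-neg R′))

  period-neg : ∀ {r} → Period r → Period (- r)
  period-neg {r} R q = combine cosπ (proj₁ (R (q - r))) , combine sinπ (proj₂ (R (q - r)))
    where
    combine : ∀ (f : ℚ → ℕ → ℚ) → Null (λ n → f (q - r + r) n - f (q - r) n) → Null (λ n → f (q - r) n - f q n)
    combine f R′ = null-cong
      (λ n → trans (cong (λ z → f (q - r) n - f z n) (solve 2 (λ q r → q := q :- r :+ r) refl q r))
        (solve 2 (λ x y → x :- y := :- (y :- x)) refl (f (q - r) n) (f (q - r + r) n)))
      (null-neg R′)

  private
    sixth third : ℚ
    sixth = + 1 / 6
    third = + 1 / 3

  -- π / 6 ∈ [0 , 1], where 1 - x² / 2 is within 1/3 of the partial sums of cos x.
  cosπ-sixth≥ : ∀ n → 3 ℕ.≤ n → sixth ≤ cosπ sixth n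
  cosπ-sixth≥ n 3≤n = subst (λ k → sixth ≤ taylor cosCoeff x k) (ℕ.m+[n∸m]≡n 3≤n) bound
    where
    open Bounds 1
    k = n ℕ.∸ 3
    h = halfπ n
    x = sixth * ((+ 2 / 1) * h)
    x≡ : x ≡ third * h
    x≡ = solve 1 (λ h → con sixth :* (con (+ 2 / 1) :* h) := con third :* h) refl h
    0≤x : 0ℚ ≤ x
    0≤x = subst (0ℚ ≤_) (sym x≡) (*-nonNeg (toWitness {a? = 0ℚ ≤? third} _) (I⇒0≤ (halfπ∈I n)))
    x≤1 : x ≤ 1ℚ
    x≤1 = subst (_≤ 1ℚ) (sym x≡) (≤-trans
      (*-monoˡ (toWitness {a? = 0ℚ ≤? third} _) (proj₂ (halfπ∈I n)))
      (toWitness {a? = third * (+ 5 / 3) ≤? 1ℚ} _))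
    x≤B : ∣ x ∣ ≤ B
    x≤B = ≤-cong (0≤p⇒∣p∣≡p 0≤x) refl x≤1
    near : ∣ taylor cosCoeff x (3 ℕ.+ k) - taylor cosCoeff x 3 ∣ ≤ third
    near = ≤-trans (taylor-tail cosCoeff cosCoeff≤1 x≤B 3 k)
      (≤-trans (E-tail 1 k) (toWitness {a? = e 3 + e 3 ≤? third} _))
    ½≤ : ½ ≤ taylor cosCoeff x 3
    ½≤ = ≤-cong refl (solve 1 (λ x → taylor₃ x := con 1ℚ :- con ½ :* (x :* x)) refl x)
      (+-monoʳ-≤ 1ℚ (neg-antimono-≤ (*-monoˡ 0≤½ (*-mono 0≤1 0≤x x≤1 x≤1))))
      where
      open +-*-Solver using (Polynomial)
      taylor₃ : ∀ {m} → Polynomial m → Polynomial m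
      taylor₃ x = con 0ℚ :+ con 1ℚ :* con 1ℚ :+ con 0ℚ :* (con 1ℚ :* (x :* con 1ℚ))
        :+ con (- 1ℚ) :* (con 1ℚ :* (x :* con 1ℚ) :* (x :* con ½))
    bound : sixth ≤ taylor cosCoeff x (3 ℕ.+ k)
    bound = ≤-trans {sixth} {taylor cosCoeff x 3 - third}
      (≤-trans (toWitness {a? = sixth ≤? ½ - third} _) (+-monoˡ-≤ (- third) ½≤))
      (HalfPi.∣∣≤⇒≥ near)

  -- The triple angle formula gives 0 = cos (π / 2) = w (4 w² - 3) for w = cos (π / 6), and w > 0.
  cosπ-sixth² : Null (λ n → 2ℚ * (cosπ sixth n * cosπ sixth n) - (1ℚ + ½))
  cosπ-sixth² = null-cancel 3 cosπ-sixth≥ (null-cong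
    (λ n → solve 5 (λ w v a b h → w :* (con 2ℚ :* (w :* w) :- con (1ℚ + ½)) :=
         con ½ :* (
           (w :* ((w :* w :- v :* v) :- a) :+ (:- (v :* ((v :* w :+ w :* v) :- b))))
           :+ (((a :* w :- b :* v) :- h) :+ h)
           :+ con (2ℚ + 1ℚ) :* (w :* (w :* w :+ v :* v :- con 1ℚ)))) refl
      (cosπ sixth n) (sinπ sixth n) (cosπ third n) (sinπ third n) (cosπ ½ n))
    (null-*ᶜ ½ (null-+
      (null-+
        (null-+ (null-* (cosπ-bounded sixth) (cosπ-+ sixth sixth))
                (null-neg (null-* (sinπ-bounded sixth) (sinπ-+ sixth sixth))))
        (null-+ (cosπ-+ third sixth) cosπ-½))
      (null-*ᶜ (2ℚ + 1ℚ) (null-* (cosπ-bounded sixth) (pythagoras sixth))))))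

  cosπ-⅓ : Null (λ n → cosπ third n - ½)
  cosπ-⅓ = null-cong
    (λ n → solve 2 (λ w d → d :- con ½ := (con 2ℚ :* (w :* w) :- con (1ℚ + ½)) :+ (:- ((con 2ℚ :* (w :* w) :- con 1ℚ) :- d))) refl
      (cosπ sixth n) (cosπ third n))
    (null-+ cosπ-sixth² (null-neg (cosπ-double sixth)))

  cosπ-⅔ : Null (λ n → cosπ (+ 2 / 3) n + ½)
  cosπ-⅔ = null-cong
    (λ n → solve 2 (λ c d → d :+ con ½ := con 2ℚ :* ((c :+ con ½) :* (c :- con ½)) :+ (:- ((con 2ℚ :* (c :* c) :- con 1ℚ) :- d))) refl
      (cosπ third n) (cosπ (+ 2 / 3) n))
    (null-+ (null-*ᶜ 2ℚ (null-* {λ n → cosπ third n + ½} (bounded (seq (cos (third · π) ⊕ fromℚ ½)) (cauchy (cos (third · π) ⊕ fromℚ ½))) cosπ-⅓))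
            (null-neg (cosπ-double third)))

module Shifts where

  open import Algebra.Bundles using (AbelianGroup)
  open import Data.Fin.Base using (Fin; zero; suc; toℕ; fromℕ<; inject₁; fromℕ)
  import Data.Fin.Properties as Fin
  open import Data.Integer.Base hiding (NonZero; suc)
  import Data.Integer.DivMod as ℤ
  open import Data.Integer.Properties
  open import Data.Integer.Solver using (module +-*-Solver)
  open import Data.Nat.Base as ℕ using (ℕ; zero; suc; NonZero)
  open import Data.Nat.Induction using (<-rec)
  import Data.Nat.Properties as ℕ
  open import Data.Nat.Divisibility using (_∣_; divides; _∣0; ∣-refl; ∣m∣n⇒∣m+n)
  import Data.Nat.DivMod as ℕ
  open import Data.Product.Base using (∃-syntax; _,_)
  open import Data.Sum.Base using (_⊎_; inj₁; inj₂)
  open import Relation.Binary.PropositionalEquality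
  open import Relation.Nullary using (¬_; yes; no; contradiction)
  open import Algebra.Properties.Group (AbelianGroup.group +-0-abelianGroup) using (∙-cancelˡ)
  open import Algebra.Properties.Semiring.Sum +-*-semiring
    using (sum; sum-cong-≗; ∑-distrib-+; sum-init-last; sum-replicate-zero)
  open +-*-Solver using (solve; _:+_; _:*_; _:-_; :-_; con; _:=_)

  Seq : Set
  Seq = ℤ → ℤ

  record Twist (σ a : ℤ) (u : Seq) : Set where
    constructor twist
    field shift : ∀ x → u (x + a) ≡ σ * u x

  twist-+ : ∀ {σ τ a b u} → Twist σ a u → Twist τ b u → Twist (τ * σ) (a + b) u
  twist-+ {σ} {τ} {a} {b} {u} (twist p) (twist q) = twist λ x → trans (cong u (sym (+-assoc x a b)))
    (trans (q (x + a)) (trans (cong (λ z → τ * z) (p x)) (sym (*-assoc τ σ (u x)))))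

  twist-* : ∀ {σ a u} → Twist σ a u → ∀ k → Twist (σ ^ k) (+ k * a) u
  twist-* {σ} {a} {u} p zero = twist λ x → trans (cong u (trans (cong (λ z → x + z) (*-zeroˡ a)) (+-identityʳ x))) (sym (*-identityˡ (u x)))
  twist-* {σ} {a} {u} p (suc k) = subst (λ b → Twist (σ ^ suc k) b u)
    (solve 2 (λ k a → k :* a :+ a := (con 1ℤ :+ k) :* a) refl (+ k) a)
    (twist-+ (twist-* p k) p)

  -1^even : ∀ {k} → 2 ∣ k → -1ℤ ^ k ≡ 1ℤ
  -1^even (divides q refl) = helper q
    where
    helper : ∀ q → -1ℤ ^ (q ℕ.* 2) ≡ 1ℤ
    helper zero    = refl
    helper (suc q) = cong (λ z → -1ℤ * (-1ℤ * z)) (helper q)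

  even-or-suc-even : ∀ k → (2 ∣ k) ⊎ (2 ∣ suc k)
  even-or-suc-even zero = inj₁ (2 ∣0)
  even-or-suc-even (suc k) with even-or-suc-even k
  ... | inj₁ 2∣k  = inj₂ (∣m∣n⇒∣m+n ∣-refl 2∣k)
  ... | inj₂ 2∣k′ = inj₁ 2∣k′

  -1^odd : ∀ {k} → ¬ 2 ∣ k → -1ℤ ^ k ≡ -1ℤ
  -1^odd {k} odd with even-or-suc-even k
  ... | inj₁ 2∣k = contradiction 2∣k odd
  ... | inj₂ 2∣k′ = trans (solve 1 (λ z → z := con -1ℤ :* (con -1ℤ :* z)) refl (-1ℤ ^ k)) (cong (λ z → -1ℤ * z) (-1^even 2∣k′))

  twist-conflict : ∀ {σ τ a u} → σ ≡ 1ℤ → τ ≡ -1ℤ → Twist σ a u → Twist τ a u → ∀ x → u x ≡ 0ℤ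
  twist-conflict {u = u} refl refl (twist p) (twist q) x = double-zero (trans (sym (*-identityˡ (u x))) (trans (sym (p x)) (q x)))
    where
    double-zero : ∀ {z} → z ≡ -1ℤ * z → z ≡ 0ℤ
    double-zero {z} eq = *-cancelˡ-≡ (+ 2) z 0ℤ
      (trans (solve 1 (λ z → con (+ 2) :* z := z :- con -1ℤ :* z) refl z)
        (trans (cong (λ w → w - -1ℤ * z) eq) (+-inverseʳ (-1ℤ * z))))

  3z≡0⇒z≡0 : ∀ z → + 3 * z ≡ 0ℤ → z ≡ 0ℤ
  3z≡0⇒z≡0 z eq = *-cancelˡ-≡ (+ 3) z 0ℤ eq

  neighbours : ℤ → Seq → Seq
  neighbours a u x = u (x + a) + u (x - a)

  pair : ℤ → Seq → Seq
  pair a u x = u (x + a) + u x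

  swap-shifts : ∀ (u : Seq) x a b → u (x + a + b) ≡ u (x + b + a)
  swap-shifts u x a b = cong u (solve 3 (λ x a b → x :+ a :+ b := x :+ b :+ a) refl x a b)

  module _ (n : ℕ) .{{_ : NonZero n}} where

    Periodic : Seq → Set
    Periodic u = ∀ x → u (x + + n) ≡ u x

    periodic-shift : ∀ {u} → Periodic u → ∀ a → Periodic (λ x → u (x + a))
    periodic-shift {u} P a x = trans (swap-shifts u x (+ n) a) (P (x + a))

    periodic-multiple : ∀ {u} → Periodic u → ∀ k x → u (x + k * + n) ≡ u x
    periodic-multiple {u} P (+ k) x =
      trans (Twist.shift (twist-* {1ℤ} (twist λ x → trans (P x) (sym (*-identityˡ (u x)))) k) x)
        (trans (cong (λ z → z * u x) (^-zeroˡ k)) (*-identityˡ (u x)))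
    periodic-multiple {u} P -[1+ k ] x = sym (trans
      (cong u (trans (sym (+-identityʳ x)) (trans
        (cong (λ z → x + z) (solve 2 (λ k n → con 0ℤ := (:- k) :* n :+ k :* n) refl (+ suc k) (+ n)))
        (sym (+-assoc x (-[1+ k ] * + n) (+ suc k * + n))))))
      (periodic-multiple P (+ suc k) (x + -[1+ k ] * + n)))

    residue-class : ∀ {u} → Periodic u → ∀ x → u x ≡ u (+ toℕ (fromℕ< (ℤ.n%ℕd<d x n)))
    residue-class {u} P x = trans (cong u (ℤ.a≡a%ℕn+[a/ℕn]*n x n))
      (trans (periodic-multiple P (x ℤ./ℕ n) (+ (x ℤ.%ℕ n)))
        (cong (λ k → u (+ k)) (sym (Fin.toℕ-fromℕ< (ℤ.n%ℕd<d x n)))))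

    total : Seq → ℤ
    total u = sum {n} (λ i → u (+ toℕ i))

    total-cong : ∀ {u v} → (∀ x → u x ≡ v x) → total u ≡ total v
    total-cong u≡v = sum-cong-≗ {n} (λ i → u≡v (+ toℕ i))

    total-zero : ∀ {u} → (∀ x → u x ≡ 0ℤ) → total u ≡ 0ℤ
    total-zero h = trans (total-cong h) (sum-replicate-zero n)

    total-+ : ∀ u v → total (λ x → u x + v x) ≡ total u + total v
    total-+ u v = ∑-distrib-+ {n} (λ i → u (+ toℕ i)) (λ i → v (+ toℕ i))

    total-shift1 : ∀ {u} → Periodic u → total (λ x → u (x + 1ℤ)) ≡ total u
    total-shift1 {u} P = ∙-cancelˡ (u 0ℤ) _ _ (begin
      u 0ℤ + total (λ x → u (x + 1ℤ))  ≡⟨ cong (λ z → u 0ℤ + z) (sum-cong-≗ {n} (λ i → cong u (+-comm (+ toℕ i) 1ℤ))) ⟩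
      sum {suc n} (λ i → u (+ toℕ i))  ≡⟨ sum-init-last (λ (i : Fin (suc n)) → u (+ toℕ i)) ⟩
      sum {n} (λ i → u (+ toℕ (inject₁ i))) + u (+ toℕ (fromℕ n))
        ≡⟨ cong₂ _+_ (sum-cong-≗ {n} (λ i → cong (λ k → u (+ k)) (Fin.toℕ-inject₁ i)))
                     (trans (cong (λ k → u (+ k)) (Fin.toℕ-fromℕ n)) (trans (cong u (sym (+-identityˡ (+ n)))) (P 0ℤ))) ⟩
      total u + u 0ℤ                   ≡⟨ +-comm (total u) (u 0ℤ) ⟩
      u 0ℤ + total u                   ∎)
      where open ≡-Reasoning

    total-shift⁺ : ∀ {u} → Periodic u → ∀ k → total (λ x → u (x + + k)) ≡ total u
    total-shift⁺ {u} P zero    = total-cong (λ x → cong u (+-identityʳ x))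
    total-shift⁺ {u} P (suc k) = trans
      (total-cong (λ x → cong u (sym (+-assoc x 1ℤ (+ k)))))
      (trans (total-shift1 {λ x → u (x + + k)} (periodic-shift P (+ k))) (total-shift⁺ P k))

    total-shift : ∀ {u} → Periodic u → ∀ a → total (λ x → u (x + a)) ≡ total u
    total-shift P (+ k)        = total-shift⁺ P k
    total-shift {u} P -[1+ k ] = trans
      (sym (total-shift⁺ {λ x → u (x + -[1+ k ])} (periodic-shift P -[1+ k ]) (suc k)))
      (total-cong (λ x → cong u (trans (+-assoc x (+ suc k) -[1+ k ])
        (trans (cong (λ z → x + z) (+-inverseʳ (+ suc k))) (+-identityʳ x)))))

    ⟨_,_⟩ : Seq → Seq → ℤ
    ⟨ u , v ⟩ = total (λ x → u x * v x)

    ⟨⟩-cong : ∀ {u u′ v v′} → (∀ x → u x ≡ u′ x) → (∀ x → v x ≡ v′ x) → ⟨ u , v ⟩ ≡ ⟨ u′ , v′ ⟩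
    ⟨⟩-cong p q = total-cong (λ x → cong₂ _*_ (p x) (q x))

    ⟨⟩-shift : ∀ {u v} → Periodic u → Periodic v → ∀ a →
      ⟨ (λ x → u (x + a)) , v ⟩ ≡ ⟨ u , (λ x → v (x - a)) ⟩
    ⟨⟩-shift {u} {v} P Q a = trans
      (total-cong (λ x → cong (λ z → u (x + a) * z) (cong v (solve 2 (λ x a → x := x :+ a :- a) refl x a))))
      (total-shift {λ x → u x * v (x - a)} (λ x → cong₂ _*_ (P x) (periodic-shift Q (- a) x)) a)

    neighbours-adjoint : ∀ {u v} → Periodic u → Periodic v → ∀ a → ⟨ neighbours a u , v ⟩ ≡ ⟨ u , neighbours a v ⟩
    neighbours-adjoint {u} {v} P Q a = begin
      ⟨ neighbours a u , v ⟩
        ≡⟨ total-cong (λ x → *-distribʳ-+ (v x) (u (x + a)) (u (x - a))) ⟩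
      total (λ x → u (x + a) * v x + u (x - a) * v x)
        ≡⟨ total-+ (λ x → u (x + a) * v x) (λ x → u (x - a) * v x) ⟩
      ⟨ (λ x → u (x + a)) , v ⟩ + ⟨ (λ x → u (x - a)) , v ⟩
        ≡⟨ cong₂ _+_ (⟨⟩-shift P Q a) (⟨⟩-shift P Q (- a)) ⟩
      ⟨ u , (λ x → v (x - a)) ⟩ + ⟨ u , (λ x → v (x - - a)) ⟩
        ≡⟨ total-+ (λ x → u x * v (x - a)) (λ x → u x * v (x - - a)) ⟨
      total (λ x → u x * v (x - a) + u x * v (x - - a))
        ≡⟨ total-cong (λ x → trans (solve 3 (λ u p q → u :* p :+ u :* q := u :* (q :+ p)) refl (u x) (v (x - a)) (v (x - - a)))
                             (cong (λ b → u x * (v (x + b) + v (x - a))) (neg-involutive a))) ⟩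
      ⟨ u , neighbours a v ⟩ ∎
      where open ≡-Reasoning

    ⟨pair,pair⟩ : ∀ {u v} → Periodic u → Periodic v → ∀ a →
      ⟨ pair a u , pair a v ⟩ ≡ ⟨ (λ x → + 2 * u x + neighbours a u x) , v ⟩
    ⟨pair,pair⟩ {u} {v} P Q a = begin
      ⟨ pair a u , pair a v ⟩
        ≡⟨ total-cong (λ x → solve 4 (λ p q r s → (p :+ q) :* (r :+ s) := p :* r :+ (q :* r :+ (p :+ q) :* s)) refl
             (u (x + a)) (u x) (v (x + a)) (v x)) ⟩
      total (λ x → u (x + a) * v (x + a) + (u x * v (x + a) + pair a u x * v x))
        ≡⟨ total-+ (λ x → u (x + a) * v (x + a)) (λ x → u x * v (x + a) + pair a u x * v x) ⟩
      total (λ x → u (x + a) * v (x + a)) + total (λ x → u x * v (x + a) + pair a u x * v x)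
        ≡⟨ cong₂ _+_ (total-shift {λ x → u x * v x} (λ x → cong₂ _*_ (P x) (Q x)) a)
             (trans (total-+ (λ x → u x * v (x + a)) (λ x → pair a u x * v x))
               (cong (λ z → z + ⟨ pair a u , v ⟩) (sym shifted))) ⟩
      ⟨ u , v ⟩ + (⟨ (λ x → u (x - a)) , v ⟩ + ⟨ pair a u , v ⟩)
        ≡⟨ trans (total-+ (λ x → u x * v x) (λ x → u (x - a) * v x + pair a u x * v x))
             (cong (λ z → ⟨ u , v ⟩ + z) (total-+ (λ x → u (x - a) * v x) (λ x → pair a u x * v x))) ⟨
      total (λ x → u x * v x + (u (x - a) * v x + pair a u x * v x))
        ≡⟨ total-cong (λ x → solve 4 (λ p q r s → q :* s :+ (r :* s :+ (p :+ q) :* s) := (con (+ 2) :* q :+ (p :+ r)) :* s) refl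
             (u (x + a)) (u x) (u (x - a)) (v x)) ⟩
      ⟨ (λ x → + 2 * u x + neighbours a u x) , v ⟩ ∎
      where
      open ≡-Reasoning
      shifted : ⟨ (λ x → u (x - a)) , v ⟩ ≡ ⟨ u , (λ x → v (x + a)) ⟩
      shifted = trans (⟨⟩-shift P Q (- a)) (total-cong (λ x → cong (λ b → u x * v (x + b)) (neg-involutive a)))

    0≤⟨⟩ : ∀ u → 0ℤ ≤ ⟨ u , u ⟩
    0≤⟨⟩ u = sum-nonNeg n (λ i → u (+ toℕ i))
      where
      sum-nonNeg : ∀ m (t : Fin m → ℤ) → 0ℤ ≤ sum (λ i → t i * t i)
      sum-nonNeg zero    t = ≤-refl
      sum-nonNeg (suc m) t = +-mono-≤ (0≤i*i (t zero)) (sum-nonNeg m (λ i → t (suc i)))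
        where
        0≤i*i : ∀ i → 0ℤ ≤ i * i
        0≤i*i (+ zero)  = ≤-refl
        0≤i*i +[1+ i ]  = +≤+ ℕ.z≤n
        0≤i*i -[1+ i ]  = +≤+ ℕ.z≤n

    ⟨⟩≡0⇒≡0 : ∀ {u} → Periodic u → ⟨ u , u ⟩ ≡ 0ℤ → ∀ x → u x ≡ 0ℤ
    ⟨⟩≡0⇒≡0 {u} P eq x = trans (residue-class P x)
      (sum-zero n (λ i → u (+ toℕ i)) eq (fromℕ< (ℤ.n%ℕd<d x n)))
      where
      square : ∀ i → ∃[ k ] i * i ≡ + k
      square (+ zero)  = 0 , refl
      square +[1+ i ]  = _ , refl
      square -[1+ i ]  = _ , refl
      squares : ∀ m (t : Fin m → ℤ) → ∃[ k ] sum (λ i → t i * t i) ≡ + k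
      squares zero    t = 0 , refl
      squares (suc m) t =
        let k , p = square (t zero) ; l , q = squares m (λ i → t (suc i)) in k ℕ.+ l , cong₂ _+_ p q
      sum-zero : ∀ m (t : Fin m → ℤ) → sum (λ i → t i * t i) ≡ 0ℤ → ∀ i → t i ≡ 0ℤ
      sum-zero (suc m) t eq i =
        let k , p = square (t zero) ; l , q = squares m (λ i → t (suc i))
            k+l≡0 = +-injective (trans (sym (cong₂ _+_ p q)) eq)
        in split i (trans p (cong +_ (ℕ.m+n≡0⇒m≡0 k k+l≡0))) (trans q (cong +_ (ℕ.m+n≡0⇒n≡0 k k+l≡0)))
        where
        split : ∀ i → t zero * t zero ≡ 0ℤ → sum (λ i → t (suc i) * t (suc i)) ≡ 0ℤ → t i ≡ 0ℤ
        split zero p q with i*j≡0⇒i≡0∨j≡0 (t zero) p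
        ... | inj₁ r = r
        ... | inj₂ r = r
        split (suc i) p q = sum-zero m (λ i → t (suc i)) q i

    module _ (c : ℤ) where

      X Y B Q : Seq → Seq
      X = neighbours 1ℤ
      Y = neighbours c
      B u x = X u x + u x
      Q u x = X (X u) x + + 2 * X u x

      record Kernel (u : Seq) : Set where
        constructor kernel
        field equation : ∀ x → + 2 * u x + X u x + Y u x ≡ 0ℤ

      periodic-X : ∀ {u} → Periodic u → Periodic (X u)
      periodic-X P x = cong₂ _+_ (periodic-shift P 1ℤ x) (periodic-shift P (- 1ℤ) x)

      periodic-B : ∀ {u} → Periodic u → Periodic (B u)
      periodic-B P x = cong₂ _+_ (periodic-X P x) (P x)

      periodic-Q : ∀ {u} → Periodic u → Periodic (Q u)
      periodic-Q P x = cong₂ _+_ (periodic-X (periodic-X P) x) (cong (λ z → + 2 * z) (periodic-X P x))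

      periodic-pair : ∀ {u} → Periodic u → ∀ a → Periodic (pair a u)
      periodic-pair P a x = cong₂ _+_ (periodic-shift P a x) (P x)

      neighbours-comm : ∀ a b u x → neighbours a (neighbours b u) x ≡ neighbours b (neighbours a u) x
      neighbours-comm a b u x = trans
        (cong₂ _+_ (cong₂ _+_ (swap-shifts u x a b) (swap-shifts u x a (- b)))
                   (cong₂ _+_ (swap-shifts u x (- a) b) (swap-shifts u x (- a) (- b))))
        (solve 4 (λ p q r s → (p :+ q) :+ (r :+ s) := (p :+ r) :+ (q :+ s)) refl
          (u (x + b + a)) (u (x - b + a)) (u (x + b - a)) (u (x - b - a)))

      neighbours-cong : ∀ {u v} a → (∀ x → u x ≡ v x) → ∀ x → neighbours a u x ≡ neighbours a v x
      neighbours-cong a u≡v x = cong₂ _+_ (u≡v (x + a)) (u≡v (x - a))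

      kernel-X : ∀ {u} → Kernel u → Kernel (X u)
      kernel-X {u} (kernel K) = kernel λ x → begin
        + 2 * X u x + X (X u) x + Y (X u) x
          ≡⟨ cong (λ z → + 2 * X u x + X (X u) x + z) (neighbours-comm c 1ℤ u x) ⟩
        + 2 * X u x + X (X u) x + X (Y u) x
          ≡⟨ solve 6 (λ p q r s t v → con (+ 2) :* (p :+ q) :+ (r :+ s) :+ (t :+ v)
                := (con (+ 2) :* p :+ r :+ t) :+ (con (+ 2) :* q :+ s :+ v)) refl
              (u (x + 1ℤ)) (u (x - 1ℤ)) (X u (x + 1ℤ)) (X u (x - 1ℤ)) (Y u (x + 1ℤ)) (Y u (x - 1ℤ)) ⟩
        (+ 2 * u (x + 1ℤ) + X u (x + 1ℤ) + Y u (x + 1ℤ)) + (+ 2 * u (x - 1ℤ) + X u (x - 1ℤ) + Y u (x - 1ℤ))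
          ≡⟨ cong₂ _+_ (K (x + 1ℤ)) (K (x - 1ℤ)) ⟩
        0ℤ ∎
        where open ≡-Reasoning

      kernel-combination : ∀ {u v} p q → Kernel u → Kernel v → Kernel (λ x → p * u x + q * v x)
      kernel-combination {u} {v} p q (kernel K) (kernel L) = kernel λ x → trans
        (solve 12 (λ p q a b d e f a′ b′ d′ e′ f′ →
            con (+ 2) :* (p :* a :+ q :* a′) :+ ((p :* b :+ q :* b′) :+ (p :* d :+ q :* d′))
               :+ ((p :* e :+ q :* e′) :+ (p :* f :+ q :* f′))
            := p :* (con (+ 2) :* a :+ (b :+ d) :+ (e :+ f)) :+ q :* (con (+ 2) :* a′ :+ (b′ :+ d′) :+ (e′ :+ f′))) refl
          p q (u x) (u (x + 1ℤ)) (u (x - 1ℤ)) (u (x + c)) (u (x - c))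
              (v x) (v (x + 1ℤ)) (v (x - 1ℤ)) (v (x + c)) (v (x - c)))
        (trans (cong₂ (λ s t → p * s + q * t) (K x) (L x))
          (solve 2 (λ p q → p :* con 0ℤ :+ q :* con 0ℤ := con 0ℤ) refl p q))

      kernel-cong : ∀ {u v} → (∀ x → u x ≡ v x) → Kernel u → Kernel v
      kernel-cong {u} {v} u≡v (kernel K) = kernel λ x → trans
        (cong₂ _+_ (cong₂ _+_ (cong (λ z → + 2 * z) (sym (u≡v x))) (sym (neighbours-cong 1ℤ u≡v x)))
                   (sym (neighbours-cong c u≡v x)))
        (K x)

      kernel-B : ∀ {u} → Kernel u → Kernel (B u)
      kernel-B {u} K = kernel-cong (λ x → cong₂ _+_ (*-identityˡ (X u x)) (*-identityˡ (u x)))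
        (kernel-combination 1ℤ 1ℤ (kernel-X K) K)

      kernel-Q : ∀ {u} → Kernel u → Kernel (Q u)
      kernel-Q {u} K = kernel-cong (λ x → cong (λ z → z + + 2 * X u x) (*-identityˡ (X (X u) x)))
        (kernel-combination 1ℤ (+ 2) (kernel-X (kernel-X K)) (kernel-X K))

      pair≡0⇒ : ∀ {u} a → (∀ x → pair a u x ≡ 0ℤ) → ∀ x → + 2 * u x + neighbours a u x ≡ 0ℤ
      pair≡0⇒ {u} a h x = trans
        (solve 3 (λ p q r → con (+ 2) :* p :+ (q :+ r) := (q :+ p) :+ (p :+ r)) refl (u x) (u (x + a)) (u (x - a)))
        (cong₂ _+_ (h x) (trans (cong (λ z → z + u (x - a)) (cong u (solve 2 (λ x a → x := x :- a :+ a) refl x a))) (h (x - a))))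

      pair≡0⇐ : ∀ {u} → Periodic u → ∀ a → (∀ x → + 2 * u x + neighbours a u x ≡ 0ℤ) → ∀ x → pair a u x ≡ 0ℤ
      pair≡0⇐ {u} P a h = ⟨⟩≡0⇒≡0 (periodic-pair P a)
        (trans (⟨pair,pair⟩ P P a) (total-zero (λ x → trans (cong (λ z → z * u x) (h x)) (*-zeroˡ (u x)))))

      B-adjoint : ∀ {u v} → Periodic u → Periodic v → ⟨ B u , v ⟩ ≡ ⟨ u , B v ⟩
      B-adjoint {u} {v} P R = begin
        ⟨ B u , v ⟩            ≡⟨ total-cong (λ x → *-distribʳ-+ (v x) (X u x) (u x)) ⟩
        total (λ x → X u x * v x + u x * v x) ≡⟨ total-+ (λ x → X u x * v x) (λ x → u x * v x) ⟩
        ⟨ X u , v ⟩ + ⟨ u , v ⟩ ≡⟨ cong (λ z → z + ⟨ u , v ⟩) (neighbours-adjoint P R 1ℤ) ⟩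
        ⟨ u , X v ⟩ + ⟨ u , v ⟩ ≡⟨ total-+ (λ x → u x * X v x) (λ x → u x * v x) ⟨
        total (λ x → u x * X v x + u x * v x) ≡⟨ total-cong (λ x → *-distribˡ-+ (u x) (X v x) (v x)) ⟨
        ⟨ u , B v ⟩            ∎
        where open ≡-Reasoning

      BB≡Q+1 : ∀ u x → B (B u) x ≡ Q u x + u x
      BB≡Q+1 u x = solve 5 (λ p q r s t → ((p :+ q) :+ (r :+ s)) :+ ((q :+ s) :+ t)
                     := (p :+ r :+ con (+ 2) :* (q :+ s)) :+ t) refl
        (X u (x + 1ℤ)) (u (x + 1ℤ)) (X u (x - 1ℤ)) (u (x - 1ℤ)) (u x)

      defect : Seq → Seq
      defect u = pair 1ℤ (pair c u)

      module _ {u} (P : Periodic u) (K : Kernel u) where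

        private
          k : Seq
          k x = + 2 * u x + X u x

        periodic-k : Periodic k
        periodic-k x = cong₂ _+_ (cong (λ z → + 2 * z) (P x)) (periodic-X P x)

        kernel-k : Kernel k
        kernel-k = kernel-cong (λ x → cong (λ z → + 2 * u x + z) (*-identityˡ (X u x))) (kernel-combination (+ 2) 1ℤ K (kernel-X K))

        Xk≡Q : ∀ x → X k x ≡ Q u x
        Xk≡Q x = solve 4 (λ p q r s → (con (+ 2) :* p :+ q) :+ (con (+ 2) :* r :+ s)
                            := q :+ s :+ con (+ 2) :* (p :+ r)) refl
          (u (x + 1ℤ)) (X u (x + 1ℤ)) (u (x - 1ℤ)) (X u (x - 1ℤ))

        pair-k : ∀ x → + 2 * pair c u x + X (pair c u) x ≡ pair c k x
        pair-k x = trans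
          (cong (λ z → + 2 * pair c u x + z) (cong₂ _+_
            (cong (λ z → z + u (x + 1ℤ)) (swap-shifts u x 1ℤ c))
            (cong (λ z → z + u (x - 1ℤ)) (swap-shifts u x (- 1ℤ) c))))
          (solve 6 (λ p q r s t v → con (+ 2) :* (p :+ q) :+ ((r :+ s) :+ (t :+ v))
              := (con (+ 2) :* p :+ (r :+ t)) :+ (con (+ 2) :* q :+ (s :+ v))) refl
            (u (x + c)) (u x) (u (x + c + 1ℤ)) (u (x + 1ℤ)) (u (x + c - 1ℤ)) (u (x - 1ℤ)))

        2k+Yk : ∀ x → + 2 * k x + Y k x ≡ - Q u x
        2k+Yk x = trans
          (solve 3 (λ p q r → p :+ r := (p :+ q :+ r) :+ (:- q)) refl (+ 2 * k x) (X k x) (Y k x))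
          (trans (cong₂ (λ s t → s - t) (Kernel.equation kernel-k x) (Xk≡Q x)) (+-identityˡ (- Q u x)))

        -- (2 + X)(2 + Y) = (1 + T)(1 + T⁻¹)(1 + T ^ c)(1 + T ^ - c) equals - Q on the kernel, and B² = 1 + Q.
        norm-defect : ⟨ u , u ⟩ ≡ ⟨ B u , B u ⟩ + ⟨ defect u , defect u ⟩
        norm-defect = sym (begin
          ⟨ B u , B u ⟩ + ⟨ defect u , defect u ⟩
            ≡⟨ cong₂ _+_ (sym (B-adjoint (periodic-B P) P)) (⟨pair,pair⟩ (periodic-pair P c) (periodic-pair P c) 1ℤ) ⟩
          ⟨ B (B u) , u ⟩ + ⟨ (λ x → + 2 * pair c u x + X (pair c u) x) , pair c u ⟩
            ≡⟨ cong₂ _+_ (⟨⟩-cong {v = u} (BB≡Q+1 u) (λ _ → refl)) (⟨⟩-cong {v = pair c u} pair-k (λ _ → refl)) ⟩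
          ⟨ (λ x → Q u x + u x) , u ⟩ + ⟨ pair c k , pair c u ⟩
            ≡⟨ cong (λ z → ⟨ (λ x → Q u x + u x) , u ⟩ + z) (trans (⟨pair,pair⟩ periodic-k P c) (⟨⟩-cong {v = u} 2k+Yk (λ _ → refl))) ⟩
          ⟨ (λ x → Q u x + u x) , u ⟩ + ⟨ (λ x → - Q u x) , u ⟩
            ≡⟨ total-+ (λ x → (Q u x + u x) * u x) (λ x → - Q u x * u x) ⟨
          total (λ x → (Q u x + u x) * u x + - Q u x * u x)
            ≡⟨ total-cong (λ x → solve 2 (λ q u → (q :+ u) :* u :+ (:- q) :* u := u :* u) refl (Q u x) (u x)) ⟩
          ⟨ u , u ⟩ ∎)
          where open ≡-Reasoning

        defect≡0⇒Q≡0 : (∀ x → defect u x ≡ 0ℤ) → ∀ x → Q u x ≡ 0ℤ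
        defect≡0⇒Q≡0 h x = neg-injective (trans (sym (2k+Yk x))
          (pair≡0⇒ {k} c (λ y → trans (sym (pair-k y)) (pair≡0⇒ {pair c u} 1ℤ h y)) x))

      B-zero : ∀ {u} → (∀ x → u x ≡ 0ℤ) → ∀ x → B u x ≡ 0ℤ
      B-zero h x = cong₂ _+_ (cong₂ _+_ (h (x + 1ℤ)) (h (x - 1ℤ))) (h x)

      QB≡BQ : ∀ u x → Q (B u) x ≡ B (Q u) x
      QB≡BQ u x = trans
        (cong₂ (λ s t → s + + 2 * t) (trans (neighbours-cong 1ℤ (XB u) x) (XB (X u) x)) (XB u x))
        (sym (trans (cong (λ z → z + Q u x) XQ) (solve 4 (λ a b d e → (a :+ con (+ 2) :* b) :+ (d :+ con (+ 2) :* e)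
            := (a :+ d) :+ con (+ 2) :* (b :+ e)) refl
          (X (X (X u)) x) (X (X u) x) (X (X u) x) (X u x))))
        where
        XB : ∀ v x → X (B v) x ≡ B (X v) x
        XB v x = solve 4 (λ a b d e → (a :+ b) :+ (d :+ e) := (a :+ d) :+ (b :+ e)) refl
          (X v (x + 1ℤ)) (v (x + 1ℤ)) (X v (x - 1ℤ)) (v (x - 1ℤ))
        XQ : X (Q u) x ≡ X (X (X u)) x + + 2 * X (X u) x
        XQ = solve 4 (λ a b d e → (a :+ con (+ 2) :* b) :+ (d :+ con (+ 2) :* e) := (a :+ d) :+ con (+ 2) :* (b :+ e)) refl
          (X (X u) (x + 1ℤ)) (X u (x + 1ℤ)) (X (X u) (x - 1ℤ)) (X u (x - 1ℤ))

      -- The norm of B u is smaller than that of u unless the defect vanishes.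
      BQ≡0 : ∀ {u} → Periodic u → Kernel u → ∀ x → B (Q u) x ≡ 0ℤ
      BQ≡0 P K = <-rec (λ N → ∀ {u} → ∣ ⟨ u , u ⟩ ∣ ≡ N → Periodic u → Kernel u → ∀ x → B (Q u) x ≡ 0ℤ)
                   step _ refl P K
        where
        step : ∀ N → (∀ {M} → M ℕ.< N → ∀ {u} → ∣ ⟨ u , u ⟩ ∣ ≡ M → Periodic u → Kernel u → ∀ x → B (Q u) x ≡ 0ℤ) →
               ∀ {u} → ∣ ⟨ u , u ⟩ ∣ ≡ N → Periodic u → Kernel u → ∀ x → B (Q u) x ≡ 0ℤ
        step N rec {u} refl P K with ⟨ defect u , defect u ⟩ ≟ 0ℤ
        ... | yes d≡0 = B-zero (defect≡0⇒Q≡0 P K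
                (⟨⟩≡0⇒≡0 (periodic-pair (periodic-pair P c) 1ℤ) d≡0))
        ... | no d≢0 = ⟨⟩≡0⇒≡0 (periodic-B (periodic-Q P)) (trans (sym (B-adjoint (periodic-B (periodic-Q P)) (periodic-Q P)))
                (total-zero (λ x → trans (cong (λ z → z * Q u x) (BBQ x)) (*-zeroˡ (Q u x)))))
          where
          smaller : ∣ ⟨ B u , B u ⟩ ∣ ℕ.< ∣ ⟨ u , u ⟩ ∣
          smaller = subst (∣ ⟨ B u , B u ⟩ ∣ ℕ.<_) (cong ∣_∣ (sym (norm-defect P K)))
            (lt ⟨ B u , B u ⟩ ⟨ defect u , defect u ⟩ (0≤⟨⟩ (B u)) (0≤⟨⟩ (defect u)) d≢0)
            where
            lt : ∀ i j → 0ℤ ≤ i → 0ℤ ≤ j → j ≢ 0ℤ → ∣ i ∣ ℕ.< ∣ i + j ∣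
            lt (+ i) (+ zero)   _ _ j≢0 = contradiction refl j≢0
            lt (+ i) +[1+ j ]   _ _ _   = ℕ.m<m+n i (ℕ.s≤s ℕ.z≤n)
          BBQ : ∀ x → B (B (Q u)) x ≡ 0ℤ
          BBQ x = trans (sym (cong₂ _+_ (neighbours-cong 1ℤ (QB≡BQ u) x) (QB≡BQ u x)))
            (rec smaller refl (periodic-B P) (kernel-B K) x)

      B≡0⇒shift-3 : ∀ {t} → (∀ x → B t x ≡ 0ℤ) → Twist 1ℤ (+ 3) t
      B≡0⇒shift-3 {t} h = twist λ x → begin
        t (x + + 3)
          ≡⟨ solve 4 (λ p q r s → s := (s :+ q :+ r) :- (r :+ p :+ q) :+ con 1ℤ :* p) refl
               (t x) (t (x + + 1)) (t (x + + 2)) (t (x + + 3)) ⟩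
        (t (x + + 3) + t (x + + 1) + t (x + + 2)) - (t (x + + 2) + t x + t (x + + 1)) + 1ℤ * t x
          ≡⟨ cong₂ (λ p q → p - q + 1ℤ * t x)
               (trans (cong₂ (λ i j → t i + t j + t (x + + 2))
                         (solve 1 (λ x → x :+ con (+ 3) := x :+ con (+ 2) :+ con 1ℤ) refl x)
                         (solve 1 (λ x → x :+ con (+ 1) := x :+ con (+ 2) :- con 1ℤ) refl x))
                      (h (x + + 2)))
               (trans (cong₂ (λ i j → t i + t j + t (x + + 1))
                         (solve 1 (λ x → x :+ con (+ 2) := x :+ con (+ 1) :+ con 1ℤ) refl x)
                         (solve 1 (λ x → x := x :+ con (+ 1) :- con 1ℤ) refl x))
                      (h (x + + 1))) ⟩
        0ℤ - 0ℤ + 1ℤ * t x ≡⟨ +-identityˡ (1ℤ * t x) ⟩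
        1ℤ * t x ∎
        where open ≡-Reasoning

      neighbours-twist : ∀ {u} a → Twist 1ℤ a u → ∀ x → neighbours a u x ≡ + 2 * u x
      neighbours-twist {u} a (twist h) x = trans
        (cong₂ _+_ (trans (h x) (*-identityˡ (u x)))
          (sym (trans (cong u (solve 2 (λ x a → x := x :- a :+ a) refl x a)) (trans (h (x - a)) (*-identityˡ (u (x - a)))))))
        (solve 1 (λ z → z :+ z := con (+ 2) :* z) refl (u x))

      twist-1-power : ∀ {u a} → Twist 1ℤ a u → ∀ k → Twist 1ℤ (+ k * a) u
      twist-1-power {u} {a} h k = subst (λ σ → Twist σ (+ k * a) u) (^-zeroˡ k) (twist-* h k)

      shift-3-nondivisor : ∀ {t} → Periodic t → Twist 1ℤ (+ 3) t → ¬ 3 ∣ n → Twist 1ℤ 1ℤ t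
      shift-3-nondivisor {t} P h 3∤n with n ℕ.% 3 | n ℕ./ 3 | ℕ.m≡m%n+[m/n]*n n 3 | ℕ.m%n<n n 3
      ... | 0 | q | n≡ | _ = contradiction (divides q n≡) 3∤n
      ... | 1 | q | n≡ | _ = twist λ x → begin
        t (x + 1ℤ)             ≡⟨ *-identityˡ (t (x + 1ℤ)) ⟨
        1ℤ * t (x + 1ℤ)        ≡⟨ Twist.shift (twist-1-power h q) (x + 1ℤ) ⟨
        t (x + 1ℤ + + q * + 3) ≡⟨ cong t (trans (+-assoc x 1ℤ (+ q * + 3)) (cong (λ z → x + z)
                                    (trans (cong (λ z → 1ℤ + z) (sym (pos-* q 3))) (cong +_ (sym n≡))))) ⟩
        t (x + + n)            ≡⟨ P x ⟩
        t x                    ≡⟨ *-identityˡ (t x) ⟨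
        1ℤ * t x               ∎
        where open ≡-Reasoning
      ... | 2 | q | n≡ | _ = twist λ x → begin
        t (x + 1ℤ)             ≡⟨ P (x + 1ℤ) ⟨
        t (x + 1ℤ + + n)       ≡⟨ cong t (trans (+-assoc x 1ℤ (+ n)) (cong (λ z → x + z)
                                    (trans (cong (λ k → + suc k) n≡) (pos-* (suc q) 3)))) ⟩
        t (x + + suc q * + 3)  ≡⟨ Twist.shift (twist-1-power h (suc q)) x ⟩
        1ℤ * t x               ∎
        where open ≡-Reasoning
      ... | suc (suc (suc _)) | _ | _ | ℕ.s≤s (ℕ.s≤s (ℕ.s≤s ()))

      module _ {d} (c≡d : c ≡ + d) (d-odd : ¬ 2 ∣ d) (not-type-2 : (3 ∣ d) ⊎ (¬ 3 ∣ n)) where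

        B≡0⇒≡0 : ∀ {t} → Periodic t → Kernel t → (∀ x → B t x ≡ 0ℤ) → ∀ x → t x ≡ 0ℤ
        B≡0⇒≡0 {t} P (kernel K) h x = 3z≡0⇒z≡0 (t x) (go not-type-2)
          where
          go : (3 ∣ d) ⊎ (¬ 3 ∣ n) → + 3 * t x ≡ 0ℤ
          go (inj₁ (divides q d≡)) = trans
            (solve 2 (λ t b → con (+ 3) :* t := con (+ 2) :* t :+ b :+ con (+ 2) :* t :- (b :+ t)) refl (t x) (X t x))
            (cong₂ _-_ (trans (cong (λ z → + 2 * t x + X t x + z)
                                (sym (neighbours-twist c (subst (λ a → Twist 1ℤ a t)
                                  (sym (trans c≡d (trans (cong +_ d≡) (pos-* q 3)))) (twist-1-power (B≡0⇒shift-3 h) q)) x)))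
                              (K x))
                       (h x))
          go (inj₂ 3∤n) = trans (solve 1 (λ t → con (+ 3) :* t := con (+ 2) :* t :+ t) refl (t x))
            (trans (cong (λ z → z + t x) (sym (neighbours-twist 1ℤ (shift-3-nondivisor P (B≡0⇒shift-3 h) 3∤n) x))) (h x))

        pair≡0⇒twist : ∀ {u} a → (∀ x → pair a u x ≡ 0ℤ) → Twist -1ℤ a u
        pair≡0⇒twist {u} a h = twist λ x → trans
          (solve 2 (λ p q → p := (p :+ q) :+ con -1ℤ :* q) refl (u (x + a)) (u x))
          (trans (cong (λ z → z + -1ℤ * u x) (h x)) (+-identityˡ (-1ℤ * u x)))

        twist⇒pair≡0 : ∀ {u} a → Twist -1ℤ a u → ∀ x → pair a u x ≡ 0ℤ
        twist⇒pair≡0 {u} a (twist h) x = trans (cong (λ z → z + u x) (h x))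
          (solve 1 (λ z → con -1ℤ :* z :+ z := con 0ℤ) refl (u x))

        X≡0 : ∀ {u} → Periodic u → Kernel u → ∀ x → X u x ≡ 0ℤ
        X≡0 {u} P K = v≡0
          where
          v : Seq
          v = X u
          2v+Xv : ∀ x → + 2 * v x + X v x ≡ 0ℤ
          2v+Xv x = trans (+-comm (+ 2 * v x) (X v x)) (B≡0⇒≡0 (periodic-Q P) (kernel-Q K) (BQ≡0 P K) x)
          anti-1 : Twist -1ℤ 1ℤ v
          anti-1 = pair≡0⇒twist 1ℤ (pair≡0⇐ (periodic-X P) 1ℤ 2v+Xv)
          anti-c : Twist -1ℤ c v
          anti-c = subst₂ (λ σ a → Twist σ a v) (-1^odd d-odd) (trans (*-identityʳ (+ d)) (sym c≡d)) (twist-* anti-1 d)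
          v≡0 : ∀ x → v x ≡ 0ℤ
          v≡0 x = *-cancelˡ-≡ (+ 2) (v x) 0ℤ (trans
            (solve 3 (λ v a b → con (+ 2) :* v := (con (+ 2) :* v :+ b) :+ (con (+ 2) :* v :+ a) :- (con (+ 2) :* v :+ a :+ b)) refl
              (v x) (X v x) (Y v x))
            (cong₂ _-_ (cong₂ _+_ (pair≡0⇒ {v} c (twist⇒pair≡0 c anti-c) x) (2v+Xv x)) (Kernel.equation (kernel-X K) x)))

        kernel-trivial : ∀ {u} → Periodic u → Kernel u → ∀ x → u x ≡ 0ℤ
        kernel-trivial {u} P K = twist-conflict refl (-1^odd d-odd)
          (subst (λ a → Twist 1ℤ a u) (trans (cong (λ z → + 2 * z) c≡d) (*-comm (+ 2) (+ d))) (twist-* anti-c 2))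
          (twist-* anti-2 d)
          where
          anti-2 : Twist -1ℤ (+ 2) u
          anti-2 = twist λ x → trans
            (solve 2 (λ p q → p := (p :+ q) :+ con -1ℤ :* q) refl (u (x + + 2)) (u x))
            (trans (cong (λ z → z + -1ℤ * u x) (trans
                (cong₂ (λ i j → u i + u j) (solve 1 (λ x → x :+ con (+ 2) := x :+ con 1ℤ :+ con 1ℤ) refl x)
                                           (solve 1 (λ x → x := x :+ con 1ℤ :- con 1ℤ) refl x))
                (X≡0 P K (x + 1ℤ))))
              (+-identityˡ (-1ℤ * u x)))
          anti-c : Twist -1ℤ c u
          anti-c = pair≡0⇒twist c (pair≡0⇐ P c (λ x → trans
            (cong (λ z → z + Y u x) (sym (trans (cong (λ z → + 2 * u x + z) (X≡0 P K x)) (+-identityʳ (+ 2 * u x)))))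
            (Kernel.equation K x)))

module Magic where

  open Shifts
  open import Data.Empty using (⊥)
  open import Data.Integer.Base hiding (NonZero; suc; ∣_∣)
  open import Data.Integer.Properties
  open import Data.Integer.Solver using (module +-*-Solver)
  open import Data.Nat.Base as ℕ using (ℕ; suc; NonZero)
  import Data.Nat.Properties as ℕ
  open import Data.Nat.Divisibility
  open import Data.Product.Base using (_×_; _,_)
  open import Data.Sum.Base using (_⊎_; inj₁; inj₂)
  open import Relation.Binary.PropositionalEquality
  open import Relation.Nullary using (¬_; yes; no; contradiction)
  open +-*-Solver using (solve; _:+_; _:*_; _:-_; :-_; con; _:=_)

  OppositeParity : ℕ → ℕ → Set
  OppositeParity a b = (2 ∣ a × ¬ 2 ∣ b) ⊎ (¬ 2 ∣ a × 2 ∣ b)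

  -- Here c = p + 1.  On h = F - T ^ m F the magic equation reads
  -- (T ^ (c - 1) + 1) (T ^ (c + 1) + 1) h = 0, up to a power of T.
  module _ (n m p : ℕ) .{{_ : NonZero n}} (n≡m+m : n ≡ m ℕ.+ m) (0<p : 0 ℕ.< p) (c<m : suc p ℕ.< m)
    (F : Seq) (F-periodic : Periodic n F)
    (F-injective : ∀ {a b} → a ℕ.< n → b ℕ.< n → F (+ a) ≡ F (+ b) → a ≡ b)
    (r : ℤ) (magic : ∀ x → F x + (F (x + 1ℤ) + F (x - 1ℤ)) + (F (x + + suc p) + F (x - + suc p)) + F (x + + m) ≡ r)
    where

    private
      c : ℤ
      c = + suc p

      h u : Seq
      h x = F x - F (x + + m)
      u = pair (+ p) h

      m<n : m ℕ.< n
      m<n = subst (m ℕ.<_) (sym n≡m+m) (ℕ.m<m+n m (ℕ.≤-<-trans ℕ.z≤n c<m))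

      F-m+m : ∀ x → F (x + + m + + m) ≡ F x
      F-m+m x = trans (cong F (trans (+-assoc x (+ m) (+ m)) (cong (λ k → x + + k) (sym n≡m+m)))) (F-periodic x)

      h-twist : Twist -1ℤ (+ m) h
      h-twist = twist λ x → trans (cong (λ z → F (x + + m) - z) (F-m+m x))
        (solve 2 (λ a b → b :- a := con -1ℤ :* (a :- b)) refl (F x) (F (x + + m)))

      h-equation : ∀ x → (h (x + 1ℤ) + h (x - 1ℤ)) + (h (x + c) + h (x - c)) ≡ 0ℤ
      h-equation x = trans
        (cong₂ _+_
          (cong₂ (λ y z → (F (x + 1ℤ) - y) + (F (x - 1ℤ) - z)) (swap-shifts F x 1ℤ (+ m)) (swap-shifts F x (- 1ℤ) (+ m)))
          (cong₂ (λ y z → (F (x + c) - y) + (F (x - c) - z)) (swap-shifts F x c (+ m)) (swap-shifts F x (- c) (+ m))))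
        (trans
          (solve 10 (λ a b d e f a′ b′ d′ e′ f′ →
              ((b :- b′) :+ (d :- d′)) :+ ((e :- e′) :+ (f :- f′))
                := (a :+ (b :+ d) :+ (e :+ f) :+ a′) :- (a′ :+ (b′ :+ d′) :+ (e′ :+ f′) :+ a)) refl
            (F x) (F (x + 1ℤ)) (F (x - 1ℤ)) (F (x + c)) (F (x - c))
            (F y) (F (y + 1ℤ)) (F (y - 1ℤ)) (F (y + c)) (F (y - c)))
          (trans (cong₂ _-_ (magic x) (trans (cong (λ z → F y + (F (y + 1ℤ) + F (y - 1ℤ)) + (F (y + c) + F (y - c)) + z)
                                                   (sym (F-m+m x))) (magic y)))
                 (+-inverseʳ r)))
        where y = x + + m

      u-twist-m : Twist -1ℤ (+ m) u
      u-twist-m = twist λ x → trans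
        (cong₂ _+_ (trans (swap-shifts h x (+ m) (+ p)) (Twist.shift h-twist (x + + p))) (Twist.shift h-twist x))
        (sym (*-distribˡ-+ -1ℤ (h (x + + p)) (h x)))

      u-twist-c+1 : Twist -1ℤ (+ suc (suc p)) u
      u-twist-c+1 = twist λ x → trans
        (solve 4 (λ a b d e → a :+ b := (b :+ d) :+ (a :+ e) :+ con -1ℤ :* (d :+ e)) refl
          (h (x + + suc (suc p) + + p)) (h (x + + suc (suc p))) (h (x + + p)) (h x))
        (trans (cong (λ z → z + -1ℤ * u x) (trans
            (cong₂ _+_
              (cong₂ (λ i j → h i + h j)
                (solve 2 (λ x p → x :+ (con (+ 2) :+ p) := x :+ (con 1ℤ :+ p) :+ con 1ℤ) refl x (+ p))
                (solve 2 (λ x p → x :+ p := x :+ (con 1ℤ :+ p) :- con 1ℤ) refl x (+ p)))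
              (cong₂ (λ i j → h i + h j)
                (solve 2 (λ x p → x :+ (con (+ 2) :+ p) :+ p := x :+ (con 1ℤ :+ p) :+ (con 1ℤ :+ p)) refl x (+ p))
                (solve 2 (λ x p → x := x :+ (con 1ℤ :+ p) :- (con 1ℤ :+ p)) refl x (+ p))))
            (h-equation (x + c))))
          (+-identityˡ (-1ℤ * u x)))

    module _ (e m′ d′ : ℕ) (m≡ : m ≡ m′ ℕ.* e) (c+1≡ : suc (suc p) ≡ d′ ℕ.* e)
             (opposite : OppositeParity m′ d′) (not-type-2 : (3 ∣ suc p) ⊎ (¬ 3 ∣ n)) where

      private
        common : d′ ℕ.* m ≡ m′ ℕ.* suc (suc p)
        common = trans (cong (d′ ℕ.*_) m≡) (trans (trans (sym (ℕ.*-assoc d′ m′ e))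
          (trans (cong (ℕ._* e) (ℕ.*-comm d′ m′)) (ℕ.*-assoc m′ d′ e))) (cong (m′ ℕ.*_) (sym c+1≡)))

        u≡0 : ∀ x → u x ≡ 0ℤ
        u≡0 = go opposite
          where
          by-c+1 : Twist (-1ℤ ^ m′) (+ (d′ ℕ.* m)) u
          by-c+1 = subst (λ a → Twist (-1ℤ ^ m′) a u)
            (trans (sym (pos-* m′ (suc (suc p)))) (cong +_ (sym common))) (twist-* u-twist-c+1 m′)
          by-m : Twist (-1ℤ ^ d′) (+ (d′ ℕ.* m)) u
          by-m = subst (λ a → Twist (-1ℤ ^ d′) a u) (sym (pos-* d′ m)) (twist-* u-twist-m d′)
          go : OppositeParity m′ d′ → ∀ x → u x ≡ 0ℤ
          go (inj₁ (even , odd)) = twist-conflict (-1^even even) (-1^odd odd) by-c+1 by-m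
          go (inj₂ (odd , even)) = twist-conflict (-1^even even) (-1^odd odd) by-m by-c+1

        h-twist-p : Twist -1ℤ (+ p) h
        h-twist-p = twist λ x → trans
          (solve 2 (λ a b → a := (a :+ b) :+ con -1ℤ :* b) refl (h (x + + p)) (h x))
          (trans (cong (λ z → z + -1ℤ * h x) (u≡0 x)) (+-identityˡ (-1ℤ * h x)))

        c-odd⇒⊥ : ¬ 2 ∣ suc p → ⊥
        c-odd⇒⊥ odd = ℕ.m<n⇒n≢0 0<p (ℕ.m+n≡0⇒n≡0 m
            (F-injective {m ℕ.+ p} {0} D<n (ℕ.≤-<-trans ℕ.z≤n m<n) (*-cancelˡ-≡ (+ 6) _ _ 6F)))
          where
          D<n : m ℕ.+ p ℕ.< n
          D<n = subst (m ℕ.+ p ℕ.<_) (sym n≡m+m) (ℕ.+-monoʳ-< m (ℕ.<-trans (ℕ.n<1+n p) c<m))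
          h-D : h (0ℤ + + (m ℕ.+ p)) ≡ 1ℤ * h 0ℤ
          h-D = Twist.shift (twist-+ h-twist h-twist-p) 0ℤ
          g : Seq
          g x = + 3 * (F x + F (x + + m)) - r
          g-periodic : Periodic n g
          g-periodic x = cong₂ (λ a b → + 3 * (a + b) - r) (F-periodic x) (periodic-shift n F-periodic (+ m) x)
          g-kernel : Kernel n c g
          g-kernel = kernel λ x → let y = x + + m in trans
            (cong₂ (λ a b → + 2 * g x + a + b)
              (cong₂ (λ a b → (+ 3 * (F (x + 1ℤ) + a) - r) + (+ 3 * (F (x - 1ℤ) + b) - r))
                (swap-shifts F x 1ℤ (+ m)) (swap-shifts F x (- 1ℤ) (+ m)))
              (cong₂ (λ a b → (+ 3 * (F (x + c) + a) - r) + (+ 3 * (F (x - c) + b) - r))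
                (swap-shifts F x c (+ m)) (swap-shifts F x (- c) (+ m))))
            (trans
              (solve 11 (λ r a b d e f a′ b′ d′ e′ f′ →
                  con (+ 2) :* (con (+ 3) :* (a :+ a′) :- r)
                    :+ ((con (+ 3) :* (b :+ b′) :- r) :+ (con (+ 3) :* (d :+ d′) :- r))
                    :+ ((con (+ 3) :* (e :+ e′) :- r) :+ (con (+ 3) :* (f :+ f′) :- r))
                  := con (+ 3) :* ((a :+ (b :+ d) :+ (e :+ f) :+ a′) :+ (a′ :+ (b′ :+ d′) :+ (e′ :+ f′) :+ a)) :- con (+ 6) :* r) refl
                r (F x) (F (x + 1ℤ)) (F (x - 1ℤ)) (F (x + c)) (F (x - c))
                  (F y) (F (y + 1ℤ)) (F (y - 1ℤ)) (F (y + c)) (F (y - c)))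
              (trans (cong₂ (λ s t → + 3 * (s + t) - + 6 * r) (magic x)
                  (trans (cong (λ z → F y + (F (y + 1ℤ) + F (y - 1ℤ)) + (F (y + c) + F (y - c)) + z) (sym (F-m+m x))) (magic y)))
                (solve 1 (λ r → con (+ 3) :* (r :+ r) :- con (+ 6) :* r := con 0ℤ) refl r)))
          g≡0 : ∀ x → g x ≡ 0ℤ
          g≡0 = kernel-trivial n c refl odd not-type-2 g-periodic g-kernel
          3h : ∀ x → + 6 * F x ≡ + 3 * h x + r
          3h x = trans (solve 3 (λ a b r → con (+ 6) :* a := (con (+ 3) :* (a :+ b) :- r) :+ (con (+ 3) :* (a :- b) :+ r)) refl
                         (F x) (F (x + + m)) r)
            (trans (cong (λ z → z + (+ 3 * h x + r)) (g≡0 x)) (+-identityˡ _))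
          6F : + 6 * F (+ (m ℕ.+ p)) ≡ + 6 * F (+ 0)
          6F = trans (3h (+ (m ℕ.+ p))) (trans (cong (λ z → + 3 * z + r)
            (trans (cong h (sym (+-identityˡ (+ (m ℕ.+ p))))) (trans h-D (*-identityˡ (h 0ℤ))))) (sym (3h 0ℤ)))

        c-even⇒⊥ : 2 ∣ suc p → ⊥
        c-even⇒⊥ even = ℕ.m<n⇒n≢0 c<m (F-injective {m} {0} m<n (ℕ.≤-<-trans ℕ.z≤n m<n)
            (sym (i-j≡0⇒i≡j (F 0ℤ) (F (+ m)) (trans (cong (λ k → F 0ℤ - F k) (sym (+-identityˡ (+ m)))) (h≡0 0ℤ)))))
          where
          odd-p : ¬ 2 ∣ p
          odd-p 2∣p = >⇒∤ (ℕ.s≤s (ℕ.s≤s ℕ.z≤n)) (∣m+n∣m⇒∣n (subst (2 ∣_) (ℕ.+-comm 1 p) even) 2∣p)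
          even-m : 2 ∣ m
          even-m = subst (2 ∣_) (sym m≡) (∣m⇒∣m*n e (go opposite))
            where
            go : OppositeParity m′ d′ → 2 ∣ m′
            go (inj₁ (2∣m′ , _)) = 2∣m′
            go (inj₂ (_ , 2∣d′)) = contradiction
              (∣m+n∣m⇒∣n (subst (2 ∣_) (trans (sym c+1≡) (ℕ.+-comm 1 (suc p))) (∣m⇒∣m*n e 2∣d′)) even)
              (>⇒∤ (ℕ.s≤s (ℕ.s≤s ℕ.z≤n)))
          h≡0 : ∀ x → h x ≡ 0ℤ
          h≡0 = twist-conflict (-1^even even-m) (-1^odd odd-p)
            (subst (λ a → Twist (-1ℤ ^ m) a h) (*-comm (+ m) (+ p)) (twist-* h-twist-p m))
            (twist-* h-twist p)

      magic-contradiction : ⊥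
      magic-contradiction with 2 ∣? suc p
      ... | yes even = c-even⇒⊥ even
      ... | no odd   = c-odd⇒⊥ odd

module Subsets where

  open import Defs using (sumOver; residue; difference; connectionSet; Graph; Cay)
  open Shifts hiding (pair)
  open import Algebra.Bundles using (CommutativeMonoid)
  import Algebra.Properties.CommutativeMonoid.Sum as MonoidSum
  open import Data.Bool.Base using (true; false; if_then_else_)
  open import Data.Fin.Base using (Fin; zero; suc; toℕ)
  import Data.Fin.Properties as Fin
  open import Data.Fin.Subset using (Subset; _∈_; ⁅_⁆)
  open import Data.Fin.Subset.Properties using (x∈p∪q⁻; x∈p∪q⁺; x∈⁅x⁆; x∈⁅y⁆⇒x≡y)
  open import Data.Integer.Base hiding (NonZero; suc; ∣_∣)
  open import Data.Integer.Base using () renaming (∣_∣ to abs)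
  open import Data.Integer.Properties
  import Data.Integer.DivMod as ℤ
  open import Data.Integer.Solver using (module +-*-Solver)
  open import Data.List.Base using (List; []; _∷_; map; foldr)
  open import Data.List.Membership.Propositional using () renaming (_∈_ to _∈ˡ_; _∉_ to _∉ˡ_)
  open import Data.List.Relation.Unary.All using ([]; _∷_)
  open import Data.List.Relation.Unary.All.Properties using (All¬⇒¬Any)
  open import Data.List.Relation.Unary.AllPairs as AllPairs using (AllPairs; []; _∷_)
  import Data.List.Relation.Unary.AllPairs.Properties as AllPairs
  open import Data.List.Relation.Unary.Any using (here; there)
  open import Data.List.Relation.Unary.Linked using (Linked; []; [-]; _∷_)
  open import Data.List.Relation.Unary.Linked.Properties using (Linked⇒AllPairs)
  open import Data.List.Relation.Unary.Unique.Propositional using (Unique)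
  open import Data.Nat.Base as ℕ using (ℕ; zero; suc; NonZero)
  import Data.Nat.Properties as ℕ
  open import Data.Nat.Divisibility using (divides; ∣⇒≤)
  open import Data.Product.Base using (∃-syntax; _×_; _,_)
  open import Data.Sum.Base using (_⊎_; inj₁; inj₂)
  open import Data.Vec.Base using (lookup)
  open import Data.Vec.Properties using (lookup∘tabulate; []=⇒lookup; lookup⇒[]=)
  open import Function.Base using (_∘_)
  open import Function.Bundles using (_⤖_; module Bijection)
  open import Level using (0ℓ)
  open import Relation.Binary.PropositionalEquality
  open import Relation.Nullary using (yes; no; does; contradiction)
  open import Relation.Nullary.Decidable using (dec-true; _⊎-dec_)
  open +-*-Solver using (solve; _:+_; _:*_; _:-_; :-_; con; _:=_)

  module SubsetSum (M : CommutativeMonoid 0ℓ 0ℓ) where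

    open CommutativeMonoid M using (Carrier; _≈_; _∙_; ε; ∙-cong; identityˡ; identityʳ; rawMonoid)
      renaming (refl to ≈-refl; sym to ≈-sym; trans to ≈-trans)
    open MonoidSum M using (sum; sum-cong-≋; ∑-distrib-+; sum-replicate-zero)

    only : ∀ {n} → (Fin n → Carrier) → Fin n → Fin n → Carrier
    only f p x = if does (x Fin.≟ p) then f x else ε

    only-≡ : ∀ {n} (f : Fin n → Carrier) p → only f p p ≈ f p
    only-≡ f p with p Fin.≟ p
    ... | yes _  = ≈-refl
    ... | no p≢p = contradiction refl p≢p

    only-≢ : ∀ {n} (f : Fin n → Carrier) {p x} → x ≢ p → only f p x ≈ ε
    only-≢ f {p} {x} x≢p with x Fin.≟ p
    ... | yes x≡p = contradiction x≡p x≢p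
    ... | no _    = ≈-refl

    sum-only : ∀ {n} (f : Fin n → Carrier) p → sum (only f p) ≈ f p
    sum-only {suc n} f zero = ≈-trans
      (∙-cong (only-≡ f zero) (≈-trans (sum-cong-≋ {n} (λ i → only-≢ f {zero} {suc i} λ ())) (sum-replicate-zero n)))
      (identityʳ (f zero))
    sum-only {suc n} f (suc p) = ≈-trans
      (∙-cong (only-≢ f {suc p} {zero} λ ()) (sum-only (f ∘ suc) p))
      (identityˡ (f (suc p)))

    spread : ∀ {n} → (Fin n → Carrier) → List (Fin n) → Fin n → Carrier
    spread f ps x = foldr (λ p s → only f p x ∙ s) ε ps

    spread-∉ : ∀ {n} (f : Fin n → Carrier) ps {x} → x ∉ˡ ps → spread f ps x ≈ ε
    spread-∉ f []       x∉ = ≈-refl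
    spread-∉ f (p ∷ ps) x∉ = ≈-trans
      (∙-cong (only-≢ f (x∉ ∘ here)) (spread-∉ f ps (x∉ ∘ there))) (identityˡ ε)

    spread-∈ : ∀ {n} (f : Fin n → Carrier) {ps x} → Unique ps → x ∈ˡ ps → spread f ps x ≈ f x
    spread-∈ f {p ∷ ps} (p≢ ∷ _) (here refl) = ≈-trans
      (∙-cong (only-≡ f p) (spread-∉ f ps (All¬⇒¬Any p≢))) (identityʳ (f p))
    spread-∈ f {p ∷ ps} {x} (p≢ ∷ unique) (there x∈) = ≈-trans
      (∙-cong (only-≢ f (λ x≡p → All¬⇒¬Any p≢ (subst (_∈ˡ ps) x≡p x∈))) (spread-∈ f unique x∈)) (identityˡ (f x))

    sum-spread : ∀ {n} (f : Fin n → Carrier) ps → sum (spread f ps) ≈ foldr (λ p s → f p ∙ s) ε ps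
    sum-spread {n} f []       = sum-replicate-zero n
    sum-spread     f (p ∷ ps) = ≈-trans (∑-distrib-+ (only f p) (spread f ps))
      (∙-cong (sum-only f p) (sum-spread f ps))

    sumOver-list : ∀ {n} (S : Subset n) (f : Fin n → Carrier) {ps} → Unique ps →
      (∀ x → x ∈ S → x ∈ˡ ps) → (∀ x → x ∈ˡ ps → x ∈ S) →
      sumOver rawMonoid S f ≈ foldr (λ p s → f p ∙ s) ε ps
    sumOver-list {n} S f {ps} unique to from = ≈-trans (sum-cong-≋ {n} same) (sum-spread f ps)
      where
      same : ∀ x → (if lookup S x then f x else ε) ≈ spread f ps x
      same x with lookup S x in eq
      ... | true  = ≈-sym (spread-∈ f unique (to x (lookup⇒[]= x S eq)))
      ... | false = ≈-sym (spread-∉ f ps (λ x∈ → contradiction (trans (sym ([]=⇒lookup (from x x∈))) eq) λ ()))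

  module Residues (n : ℕ) .{{_ : NonZero n}} where

    infix 4 _≡ₙ_

    record _≡ₙ_ (z w : ℤ) : Set where
      constructor congruent
      field
        quotient : ℤ
        equality : z ≡ w + quotient * + n

    ≡ₙ-reflexive : ∀ {z w} → z ≡ w → z ≡ₙ w
    ≡ₙ-reflexive {z} refl = congruent 0ℤ (sym (trans (cong (λ t → z + t) (*-zeroˡ (+ n))) (+-identityʳ z)))

    ≡ₙ-sym : ∀ {z w} → z ≡ₙ w → w ≡ₙ z
    ≡ₙ-sym {z} {w} (congruent k refl) = congruent (- k)
      (solve 3 (λ w k n → w := w :+ k :* n :+ (:- k) :* n) refl w k (+ n))

    ≡ₙ-trans : ∀ {z w v} → z ≡ₙ w → w ≡ₙ v → z ≡ₙ v
    ≡ₙ-trans {v = v} (congruent k refl) (congruent l refl) = congruent (l + k)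
      (solve 4 (λ v l k n → v :+ l :* n :+ k :* n := v :+ (l :+ k) :* n) refl v l k (+ n))

    ≡ₙ-+ : ∀ {z w z′ w′} → z ≡ₙ w → z′ ≡ₙ w′ → z + z′ ≡ₙ w + w′
    ≡ₙ-+ {w = w} {w′ = w′} (congruent k refl) (congruent l refl) = congruent (k + l)
      (solve 5 (λ w w′ k l n → w :+ k :* n :+ (w′ :+ l :* n) := w :+ w′ :+ (k :+ l) :* n) refl w w′ k l (+ n))

    toℕ-residue : ∀ z → + toℕ (residue n z) ≡ₙ z
    toℕ-residue z = ≡ₙ-sym (congruent (z ℤ./ℕ n) (trans (ℤ.a≡a%ℕn+[a/ℕn]*n z n)
      (cong (λ k → + k + (z ℤ./ℕ n) * + n) (sym (Fin.toℕ-fromℕ< (ℤ.n%ℕd<d z n))))))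

    multiple-of-n : ∀ {t} k → t ℕ.< n → + t ≡ k * + n → t ≡ 0
    multiple-of-n {zero}  k t<n eq = refl
    multiple-of-n {suc t} k t<n eq = contradiction
      (∣⇒≤ (divides (abs k) (trans (cong abs eq) (abs-* k (+ n))))) (ℕ.<⇒≱ t<n)

    ordered-≡ₙ : ∀ {a b} → b ℕ.≤ a → a ℕ.< n → + a ≡ₙ + b → a ≡ b
    ordered-≡ₙ {a} {b} b≤a a<n (congruent k eq) = ℕ.≤-antisym (ℕ.m∸n≡0⇒m≤n
      (multiple-of-n k (ℕ.≤-<-trans (ℕ.m∸n≤m a b) a<n) (trans (sym (⊖-≥ b≤a)) (trans (sym (m-n≡m⊖n a b))
        (trans (cong (λ z → z - + b) eq) (solve 2 (λ b k → b :+ k :- b := k) refl (+ b) (k * + n))))))) b≤a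

    small-≡ₙ : ∀ {a b} → a ℕ.< n → b ℕ.< n → + a ≡ₙ + b → a ≡ b
    small-≡ₙ {a} {b} a<n b<n a≡b with ℕ.≤-total b a
    ... | inj₁ b≤a = ordered-≡ₙ b≤a a<n a≡b
    ... | inj₂ a≤b = sym (ordered-≡ₙ a≤b b<n (≡ₙ-sym a≡b))

    residue-unique : ∀ {z} (v : Fin n) → + toℕ v ≡ₙ z → residue n z ≡ v
    residue-unique {z} v h = Fin.toℕ-injective
      (small-≡ₙ (Fin.toℕ<n (residue n z)) (Fin.toℕ<n v) (≡ₙ-trans (toℕ-residue z) (≡ₙ-sym h)))

    residue-cong : ∀ {z w} → z ≡ₙ w → residue n z ≡ residue n w
    residue-cong {z} {w} h = residue-unique (residue n w) (≡ₙ-trans (toℕ-residue w) (≡ₙ-sym h))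

    residue-sound : ∀ {z w} → residue n z ≡ residue n w → z ≡ₙ w
    residue-sound {z} {w} eq = ≡ₙ-trans (≡ₙ-sym (toℕ-residue z))
      (≡ₙ-trans (≡ₙ-reflexive (cong (λ v → + toℕ v) eq)) (toℕ-residue w))

  -- The connection set and the closed neighbourhoods are listed along the window (- m , m] of
  -- representatives modulo n = 2 m.
  module Points (n m c : ℕ) .{{_ : NonZero n}} (n≡m+m : n ≡ m ℕ.+ m) (n/2≡m : n ℕ./ 2 ≡ m)
    (1<c : 1 ℕ.< c) (c<m : c ℕ.< m) where

    open Residues n

    InWindow : ℤ → ℤ → Set
    InWindow z w = z < w × - + m < z × w ≤ + m

    window-trans : ∀ {x y z} → InWindow x y → InWindow y z → InWindow x z
    window-trans (x<y , -m<x , _) (y<z , _ , z≤m) = <-trans x<y y<z , -m<x , z≤m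

    window-distinct : ∀ {u z w} → InWindow z w → residue n (u + z) ≢ residue n (u + w)
    window-distinct {u} {z} {w} (z<w , -m<z , w≤m) eq = go (w - z) refl
      where
      same-class : u + w ≡ₙ u + z
      same-class = residue-sound (sym eq)
      open _≡ₙ_ same-class
      difference≡ : w - z ≡ quotient * + n
      difference≡ = trans
        (solve 3 (λ u w z → w :- z := (u :+ w) :- (u :+ z)) refl u w z)
        (trans (cong (λ t → t - (u + z)) equality) (solve 2 (λ a k → a :+ k :- a := k) refl (u + z) (quotient * + n)))
      w-z<n : w - z < + n
      w-z<n = subst (w - z <_) (cong +_ (sym n≡m+m)) (+-mono-≤-< w≤m
        (subst (- z <_) (neg-involutive (+ m)) (neg-mono-< -m<z)))
      0<w-z : 0ℤ < w - z
      0<w-z = subst (_< w - z) (+-inverseʳ z) (+-monoˡ-< (- z) z<w)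
      go : ∀ d → d ≡ w - z → _
      go (+ t) d≡ = <-irrefl (cong +_ (sym (multiple-of-n {t} quotient (drop‿+<+ (subst (_< + n) (sym d≡) w-z<n)) (trans d≡ difference≡))))
        (subst (0ℤ <_) (sym d≡) 0<w-z)
      go -[1+ t ] d≡ with subst (0ℤ <_) (sym d≡) 0<w-z
      ... | ()

    connection : List ℤ
    connection = - + c ∷ - 1ℤ ∷ 1ℤ ∷ + c ∷ + m ∷ []

    ball : List ℤ
    ball = - + c ∷ - 1ℤ ∷ 0ℤ ∷ 1ℤ ∷ + c ∷ + m ∷ []

    private
      -c<-1 : - + c < - 1ℤ
      -c<-1 = neg-mono-< (+<+ 1<c)
      -m<-c : - + m < - + c
      -m<-c = neg-mono-< (+<+ c<m)
      -m<-1 : - + m < - 1ℤ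
      -m<-1 = <-trans -m<-c -c<-1
      -m<0 : - + m < 0ℤ
      -m<0 = <-trans -m<-1 -<+
      1≤m : 1ℤ ≤ + m
      1≤m = +≤+ (ℕ.<⇒≤ (ℕ.<-trans 1<c c<m))

    connection-window : Linked InWindow connection
    connection-window = (-c<-1 , -m<-c , -≤+) ∷ (-<+ , -m<-1 , 1≤m)
      ∷ (+<+ 1<c , <-trans -m<0 (+<+ (ℕ.s≤s ℕ.z≤n)) , +≤+ (ℕ.<⇒≤ c<m))
      ∷ (+<+ c<m , <-trans -m<0 (+<+ (ℕ.<-trans (ℕ.s≤s ℕ.z≤n) 1<c)) , ≤-refl) ∷ [-]

    ball-window : Linked InWindow ball
    ball-window = (-c<-1 , -m<-c , -≤+) ∷ (-<+ , -m<-1 , +≤+ ℕ.z≤n) ∷ (+<+ (ℕ.s≤s ℕ.z≤n) , -m<0 , 1≤m)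
      ∷ (+<+ 1<c , <-trans -m<0 (+<+ (ℕ.s≤s ℕ.z≤n)) , +≤+ (ℕ.<⇒≤ c<m))
      ∷ (+<+ c<m , <-trans -m<0 (+<+ (ℕ.<-trans (ℕ.s≤s ℕ.z≤n) 1<c)) , ≤-refl) ∷ [-]

    points : ℤ → List ℤ → List (Fin n)
    points u = map (λ z → residue n (u + z))

    points-unique : ∀ u {zs} → Linked InWindow zs → Unique (points u zs)
    points-unique u linked = AllPairs.map⁺ (AllPairs.map (window-distinct {u}) (Linked⇒AllPairs window-trans linked))

    S : Subset n
    S = connectionSet n c

    private
      r0 : ∀ z → residue n (0ℤ + z) ≡ residue n z
      r0 z = cong (residue n) (+-identityˡ z)

    S⇒points : ∀ x → x ∈ S → x ∈ˡ points 0ℤ connection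
    S⇒points x x∈S with x∈p∪q⁻ _ _ x∈S
    ... | inj₁ h = there (there (here (trans (x∈⁅y⁆⇒x≡y _ h) (sym (r0 1ℤ)))))
    ... | inj₂ h with x∈p∪q⁻ _ _ h
    ... | inj₁ h = there (here (trans (x∈⁅y⁆⇒x≡y _ h) (sym (r0 (- 1ℤ)))))
    ... | inj₂ h with x∈p∪q⁻ _ _ h
    ... | inj₁ h = there (there (there (here (trans (x∈⁅y⁆⇒x≡y _ h) (sym (r0 (+ c)))))))
    ... | inj₂ h with x∈p∪q⁻ _ _ h
    ... | inj₁ h = here (trans (x∈⁅y⁆⇒x≡y _ h) (sym (r0 (- + c))))
    ... | inj₂ h = there (there (there (there (here (trans (x∈⁅y⁆⇒x≡y _ h)
                     (trans (cong (λ k → residue n (+ k)) n/2≡m) (sym (r0 (+ m)))))))))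

    points⇒S : ∀ x → x ∈ˡ points 0ℤ connection → x ∈ S
    points⇒S x (here refl) = x∈p∪q⁺ (inj₂ (x∈p∪q⁺ (inj₂ (x∈p∪q⁺ (inj₂ (x∈p∪q⁺ (inj₁
      (subst (λ y → residue n (0ℤ + - + c) ∈ ⁅ y ⁆) (r0 (- + c)) (x∈⁅x⁆ _)))))))))
    points⇒S x (there (here refl)) = x∈p∪q⁺ (inj₂ (x∈p∪q⁺ (inj₁
      (subst (λ y → residue n (0ℤ + - 1ℤ) ∈ ⁅ y ⁆) (r0 (- 1ℤ)) (x∈⁅x⁆ _)))))
    points⇒S x (there (there (here refl))) = x∈p∪q⁺ (inj₁
      (subst (λ y → residue n (0ℤ + 1ℤ) ∈ ⁅ y ⁆) (r0 1ℤ) (x∈⁅x⁆ _)))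
    points⇒S x (there (there (there (here refl)))) = x∈p∪q⁺ (inj₂ (x∈p∪q⁺ (inj₂ (x∈p∪q⁺ (inj₁
      (subst (λ y → residue n (0ℤ + + c) ∈ ⁅ y ⁆) (r0 (+ c)) (x∈⁅x⁆ _)))))))
    points⇒S x (there (there (there (there (here refl))))) = x∈p∪q⁺ (inj₂ (x∈p∪q⁺ (inj₂ (x∈p∪q⁺ (inj₂ (x∈p∪q⁺ (inj₂
      (subst (λ y → residue n (0ℤ + + m) ∈ ⁅ y ⁆) (trans (r0 (+ m)) (cong (λ k → residue n (+ k)) (sym n/2≡m))) (x∈⁅x⁆ _)))))))))

    open Graph (Cay n S) using (closedNeighbourhood; adj?)

    private
      difference-≡ : ∀ {u v z} → difference v u ≡ residue n z → v ≡ residue n (+ toℕ u + z)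
      difference-≡ {u} {v} {z} eq = sym (residue-unique v (≡ₙ-trans
        (≡ₙ-reflexive (solve 2 (λ v u → v := u :+ (v :- u)) refl (+ toℕ v) (+ toℕ u)))
        (≡ₙ-+ (≡ₙ-reflexive {+ toℕ u} refl) (residue-sound {+ toℕ v - + toℕ u} {z} eq))))

      difference-residue : ∀ u z → difference (residue n (+ toℕ u + z)) u ≡ residue n z
      difference-residue u z = residue-cong (≡ₙ-trans
        (≡ₙ-+ (toℕ-residue (+ toℕ u + z)) (≡ₙ-reflexive {z = - + toℕ u} refl))
        (≡ₙ-reflexive (solve 2 (λ u z → u :+ z :- u := z) refl (+ toℕ u) z)))

      shift-points : ∀ {u v} zs → difference v u ∈ˡ points 0ℤ zs → v ∈ˡ points (+ toℕ u) zs
      shift-points {u} {v} (z ∷ zs) (here eq)   = here (difference-≡ {u} {v} {z} (trans eq (r0 z)))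
      shift-points (z ∷ zs) (there rest) = there (shift-points zs rest)

      unshift-points : ∀ {u v} zs → v ∈ˡ points (+ toℕ u) zs → difference v u ∈ˡ points 0ℤ zs
      unshift-points {u} (z ∷ zs) (here refl) = here (trans (difference-residue u z) (sym (r0 z)))
      unshift-points (z ∷ zs) (there rest) = there (unshift-points zs rest)

      u≡point : ∀ u → u ≡ residue n (+ toℕ u + 0ℤ)
      u≡point u = sym (residue-unique u (≡ₙ-reflexive (sym (+-identityʳ (+ toℕ u)))))

    neighbourhood⇒points : ∀ u v → v ∈ closedNeighbourhood u → v ∈ˡ points (+ toℕ u) ball
    neighbourhood⇒points u v v∈ with v Fin.≟ u | adj? u v | trans (sym (lookup∘tabulate _ v)) ([]=⇒lookup v∈)
    ... | yes refl | _ | _ = there (there (here (u≡point u)))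
    ... | no _ | yes d∈S | _ with shift-points connection (S⇒points _ d∈S)
    ...   | here eq          = here eq
    ...   | there (here eq)  = there (here eq)
    ...   | there (there rest) = there (there (there rest))
    neighbourhood⇒points u v v∈ | no _ | no _ | ()

    points⇒neighbourhood : ∀ u v → v ∈ˡ points (+ toℕ u) ball → v ∈ closedNeighbourhood u
    points⇒neighbourhood u v v∈ = lookup⇒[]= v _ (trans (lookup∘tabulate _ v) (does-true (split v∈)))
      where
      split : v ∈ˡ points (+ toℕ u) ball → v ≡ u ⊎ v ∈ˡ points (+ toℕ u) connection
      split (here eq)                   = inj₂ (here eq)
      split (there (here eq))           = inj₂ (there (here eq))
      split (there (there (here eq)))   = inj₁ (trans eq (sym (u≡point u)))
      split (there (there (there rest))) = inj₂ (there (there rest))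
      does-true : v ≡ u ⊎ v ∈ˡ points (+ toℕ u) connection → does ((v Fin.≟ u) ⊎-dec (adj? u v)) ≡ true
      does-true h = dec-true ((v Fin.≟ u) ⊎-dec (adj? u v)) (map-sum h)
        where
        map-sum : v ≡ u ⊎ v ∈ˡ points (+ toℕ u) connection → v ≡ u ⊎ difference v u ∈ S
        map-sum (inj₁ eq) = inj₁ eq
        map-sum (inj₂ v∈) = inj₂ (points⇒S _ (unshift-points connection v∈))

    module _ (ℓ : Fin n ⤖ Fin n) where

      labels : Seq
      labels z = + suc (toℕ (Bijection.to ℓ (residue n z)))

      private
        labels-cong : ∀ {z w} → z ≡ₙ w → labels z ≡ labels w
        labels-cong h = cong (λ v → + suc (toℕ (Bijection.to ℓ v))) (residue-cong h)

      labels-periodic : Periodic n labels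
      labels-periodic x = labels-cong {x + + n} {x} (congruent 1ℤ (cong (λ z → x + z) (sym (*-identityˡ (+ n)))))

      labels-injective : ∀ {a b} → a ℕ.< n → b ℕ.< n → labels (+ a) ≡ labels (+ b) → a ≡ b
      labels-injective a<n b<n eq = small-≡ₙ a<n b<n (residue-sound
        (Bijection.injective ℓ (Fin.toℕ-injective (ℕ.suc-injective (+-injective eq)))))

      labels-magic : ∀ {r} →
        (∀ u → sumOver ℕ.+-0-rawMonoid (closedNeighbourhood u) (λ v → suc (toℕ (Bijection.to ℓ v))) ≡ r) →
        ∀ x → labels x + (labels (x + 1ℤ) + labels (x - 1ℤ))
        + (labels (x + + c) + labels (x - + c)) + labels (x + + m) ≡ + r
      labels-magic magic x = trans
        (solve 6 (λ a b d e f g → a :+ (b :+ d) :+ (e :+ f) :+ g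
           := f :+ (d :+ (a :+ (b :+ (e :+ (g :+ con 0ℤ)))))) refl
          (labels x) (labels (x + 1ℤ)) (labels (x - 1ℤ)) (labels (x + + c)) (labels (x - + c)) (labels (x + + m)))
        (trans (cong₂ _+_ (at (- + c)) (cong₂ _+_ (at (- 1ℤ)) (cong₂ _+_
            (trans (cong labels (sym (+-identityʳ x))) (at 0ℤ))
            (cong₂ _+_ (at 1ℤ) (cong₂ _+_ (at (+ c)) (cong (λ z → z + 0ℤ) (at (+ m))))))))
          (cong +_ (trans (sym (sumOver-list (closedNeighbourhood u) _ (points-unique (+ toℕ u) ball-window)
            (neighbourhood⇒points u) (points⇒neighbourhood u))) (magic u))))
        where
        open SubsetSum ℕ.+-0-commutativeMonoid using (sumOver-list)
        u = residue n x
        at : ∀ z → labels (x + z) ≡ labels (+ toℕ u + z)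
        at z = labels-cong (≡ₙ-+ (≡ₙ-sym (toℕ-residue x)) (≡ₙ-reflexive {z} refl))

module EigenvalueTypes where

  open CosineSine
  open Subsets using (module SubsetSum; module Residues; module Points)
  open Magic using (OppositeParity)
  open Shifts using (even-or-suc-even)
  open import Defs
  open Defs.Estimates using (halves)
  open import Algebra.Bundles.Raw using (RawMonoid)
  open import Algebra.Definitions.RawMonoid using (sum)
  open import Data.Bool.Base using (true; false; if_then_else_)
  open import Data.Empty using (⊥; ⊥-elim)
  open import Data.Fin.Base using (Fin; zero; suc; toℕ; fromℕ<)
  open import Data.Fin.Subset using (Subset)
  open import Data.Vec.Base using (lookup)
  open import Data.Fin.Properties using (toℕ-fromℕ<)
  open import Data.Nat.Base as ℕ using (ℕ; zero; suc; NonZero)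
  import Data.Nat.Properties as ℕ
  import Data.Nat.DivMod as ℕ
  open import Data.List.Base using (foldr)
  open import Data.Nat.GCD using (gcd; gcd[m,n]∣m; gcd[m,n]∣n; gcd-greatest)
  open import Data.Nat.Divisibility using (_∣_; _∣?_; divides; n∣m*n; ∣m+n∣m⇒∣n; ∣⇒≤; *-monoˡ-∣)
  open import Data.Integer.Base as ℤ using (ℤ; +_; -[1+_]; 0ℤ; 1ℤ)
  import Data.Integer.Properties as ℤ
  import Data.Integer.Solver as ℤ-Solver
  import Data.Nat.Solver as ℕ-Solver
  open import Data.Product.Base using (∃-syntax; _×_; _,_; proj₁; proj₂)
  open import Data.Sign.Base as Sign using (Sign)
  open import Data.Sum.Base using (_⊎_; inj₁; inj₂)
  open import Data.Rational.Base hiding (NonZero; ∣_∣)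
  open import Data.Rational.Properties
  import Data.Rational.Unnormalised.Base as ℚᵘ
  import Data.Rational.Unnormalised.Properties as ℚᵘ
  open import Data.Rational.Solver using (module +-*-Solver)
  open import Function.Bundles using (mk⇔)
  open import Relation.Binary.PropositionalEquality hiding ([_])
  open import Relation.Nullary using (¬_; Dec; yes; no; contradiction)
  open +-*-Solver using (solve; _:+_; _:*_; _:-_; :-_; con; _:=_)
  open ℤ-Solver.+-*-Solver using () renaming (solve to ℤ-solve; _:+_ to _⊞_; _:*_ to _⊠_; :-_ to ⊟_; con to ℤ-con; _:=_ to _≛_)

  /-cross : ∀ a b m n .{{_ : NonZero m}} .{{_ : NonZero n}} → a ℤ.* + n ≡ b ℤ.* + m → a / m ≡ b / n
  /-cross a b (suc m) (suc n) eq = fromℚᵘ-cong {ℚᵘ.mkℚᵘ a m} {ℚᵘ.mkℚᵘ b n} (ℚᵘ.*≡* eq)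

  /-+ : ∀ a b n .{{_ : NonZero n}} → (a ℤ.+ b) / n ≡ a / n + b / n
  /-+ a b n@(suc d) = toℚᵘ-injective (begin
    toℚᵘ ((a ℤ.+ b) / n)              ≈⟨ toℚᵘ-fromℚᵘ (ℚᵘ.mkℚᵘ (a ℤ.+ b) d) ⟩
    ℚᵘ.mkℚᵘ (a ℤ.+ b) d               ≈⟨ ℚᵘ.*≡* (ℤ-solve 3 (λ a b n → (a ⊞ b) ⊠ (n ⊠ n) ≛ (a ⊠ n ⊞ b ⊠ n) ⊠ n) refl a b (+ n)) ⟩
    ℚᵘ.mkℚᵘ a d ℚᵘ.+ ℚᵘ.mkℚᵘ b d      ≈⟨ ℚᵘ.+-cong (toℚᵘ-fromℚᵘ (ℚᵘ.mkℚᵘ a d)) (toℚᵘ-fromℚᵘ (ℚᵘ.mkℚᵘ b d)) ⟨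
    toℚᵘ (a / n) ℚᵘ.+ toℚᵘ (b / n)    ≈⟨ toℚᵘ-homo-+ (a / n) (b / n) ⟨
    toℚᵘ (a / n + b / n)              ∎)
    where open ℚᵘ.≃-Reasoning

  /-neg : ∀ a n .{{_ : NonZero n}} → (ℤ.- a) / n ≡ - (a / n)
  /-neg a n@(suc d) = toℚᵘ-injective (begin
    toℚᵘ ((ℤ.- a) / n)   ≈⟨ toℚᵘ-fromℚᵘ (ℚᵘ.mkℚᵘ (ℤ.- a) d) ⟩
    ℚᵘ.- ℚᵘ.mkℚᵘ a d     ≈⟨ ℚᵘ.-‿cong (toℚᵘ-fromℚᵘ (ℚᵘ.mkℚᵘ a d)) ⟨
    ℚᵘ.- toℚᵘ (a / n)    ≈⟨ toℚᵘ-homo‿- (a / n) ⟨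
    toℚᵘ (- (a / n))     ∎)
    where open ℚᵘ.≃-Reasoning

  /-+-multiple : ∀ a k n .{{_ : NonZero n}} → (a ℤ.+ k ℤ.* + n) / n ≡ a / n + k / 1
  /-+-multiple a k n = trans (/-+ a (k ℤ.* + n) n)
    (cong (λ q → a / n + q) (/-cross (k ℤ.* + n) k n 1 (ℤ.*-identityʳ (k ℤ.* + n))))

  period-2k⁺ : ∀ k → Period ((+ 2 ℤ.* + k) / 1)
  period-2k⁺ zero q =
    null-cong (λ n → trans (cong (λ r → cosπ r n - cosπ q n) (+-identityʳ q)) (+-inverseʳ (cosπ q n))) (null-from 0 {λ _ → 0ℚ} (λ _ _ → refl)) ,
    null-cong (λ n → trans (cong (λ r → sinπ r n - sinπ q n) (+-identityʳ q)) (+-inverseʳ (sinπ q n))) (null-from 0 {λ _ → 0ℚ} (λ _ _ → refl))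
  period-2k⁺ (suc k) = subst Period
    (trans (sym (/-+ (+ 2) (+ 2 ℤ.* + k) 1))
      (cong (λ a → a / 1) (ℤ-solve 1 (λ k → ℤ-con (+ 2) ⊞ ℤ-con (+ 2) ⊠ k ≛ ℤ-con (+ 2) ⊠ (ℤ-con 1ℤ ⊞ k)) refl (+ k))))
    (period-+ (antiperiod-+ antiperiod-1 antiperiod-1) (period-2k⁺ k))

  period-2k : ∀ k → Period ((+ 2 ℤ.* k) / 1)
  period-2k (+ k)    = period-2k⁺ k
  period-2k -[1+ k ] = subst Period (sym (/-neg (+ 2 ℤ.* + suc k) 1)) (period-neg (period-2k⁺ (suc k)))

  even-period : ∀ {k} → 2 ∣ k → Period (+ k / 1)
  even-period {k} (divides q refl) = subst Period
    (cong (λ a → a / 1) (trans (sym (ℤ.pos-* 2 q)) (cong +_ (ℕ.*-comm 2 q)))) (period-2k (+ q))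

  odd-half : ∀ {k} → ¬ 2 ∣ k → ∃[ l ] + k ≡ + 2 ℤ.* + l ℤ.+ 1ℤ
  odd-half {k} odd with even-or-suc-even k
  ... | inj₁ even             = contradiction even odd
  ... | inj₂ (divides zero ())
  ... | inj₂ (divides (suc l) eq) = l , trans
    (cong +_ (trans (ℕ.suc-injective eq) (trans (cong suc (ℕ.*-comm l 2)) (ℕ.+-comm 1 (2 ℕ.* l)))))
    (cong (ℤ._+ 1ℤ) (ℤ.pos-* 2 l))

  odd-antiperiod : ∀ {k} → ¬ 2 ∣ k → Antiperiod (+ k / 1)
  odd-antiperiod {k} odd = let l , eq = odd-half odd in subst Antiperiod
    (trans (sym (/-+ (+ 2 ℤ.* + l) 1ℤ 1)) (cong (λ a → a / 1) (sym eq)))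
    (period-antiperiod (period-2k (+ l)) antiperiod-1)

  sinπ-0 : Null (sinπ 0ℚ)
  sinπ-0 = null-from 0 λ n _ → trans (sym (halves (sinπ 0ℚ n)))
    (trans (cong (λ z → ½ * sinπ 0ℚ n + ½ * z) (sinπ-neg 0ℚ n))
      (solve 1 (λ x → con ½ :* x :+ con ½ :* (:- x) := con 0ℚ) refl (sinπ 0ℚ n)))

  cosπ-even : ∀ {k} → 2 ∣ k → Null (λ n → cosπ (+ k / 1) n - 1ℚ)
  cosπ-even {k} even = null-cong
    (λ n → trans (cong (λ q → cosπ q n - 1ℚ) (sym (+-identityˡ (+ k / 1))))
      (solve 2 (λ x y → x :- con 1ℚ := (x :- y) :+ (y :- con 1ℚ)) refl (cosπ (0ℚ + + k / 1) n) (cosπ 0ℚ n)))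
    (null-+ (proj₁ (even-period even 0ℚ)) cosπ-0)

  cosπ-odd : ∀ {k} → ¬ 2 ∣ k → Null (λ n → cosπ (+ k / 1) n + 1ℚ)
  cosπ-odd {k} odd = null-cong
    (λ n → trans (cong (λ q → cosπ q n + 1ℚ) (sym (+-identityˡ (+ k / 1))))
      (solve 2 (λ x y → x :+ con 1ℚ := (x :+ y) :+ (:- (y :- con 1ℚ))) refl (cosπ (0ℚ + + k / 1) n) (cosπ 0ℚ n)))
    (null-+ (proj₁ (odd-antiperiod odd 0ℚ)) (null-neg cosπ-0))

  sinπ-integer : ∀ k → Null (sinπ (+ k / 1))
  sinπ-integer k with 2 ∣? k
  ... | yes even = null-cong
    (λ n → trans (cong (λ q → sinπ q n) (sym (+-identityˡ (+ k / 1))))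
      (solve 2 (λ x y → x := (x :- y) :+ y) refl (sinπ (0ℚ + + k / 1) n) (sinπ 0ℚ n)))
    (null-+ (proj₂ (even-period even 0ℚ)) sinπ-0)
  ... | no odd = null-cong
    (λ n → trans (cong (λ q → sinπ q n) (sym (+-identityˡ (+ k / 1))))
      (solve 2 (λ x y → x := (x :+ y) :+ (:- y)) refl (sinπ (0ℚ + + k / 1) n) (sinπ 0ℚ n)))
    (null-+ (proj₂ (odd-antiperiod odd 0ℚ)) (null-neg sinπ-0))

  gap : ℝ → ℝ → ℕ → ℚ
  gap x y n = seq x n - seq y n

  Null⇒≈ : ∀ {x y} → Null (gap x y) → x ≈ y
  Null⇒≈ (null h) = h

  ≈⇒Null : ∀ {x y} → x ≈ y → Null (gap x y)
  ≈⇒Null h = null h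

  ≈-pointwise : ∀ {x y} → (∀ n → seq x n ≡ seq y n) → x ≈ y
  ≈-pointwise {x} {y} x≡y = Null⇒≈ {x} {y} (null-from 0 λ n _ →
    trans (cong (λ z → z - seq y n) (x≡y n)) (+-inverseʳ (seq y n)))

  ≈-sym : ∀ {x y} → x ≈ y → y ≈ x
  ≈-sym {x} {y} h = Null⇒≈ {y} {x} (null-cong (λ n → solve 2 (λ x y → y :- x := :- (x :- y)) refl (seq x n) (seq y n))
    (null-neg (≈⇒Null {x} {y} h)))

  ≈-trans : ∀ {x y z} → x ≈ y → y ≈ z → x ≈ z
  ≈-trans {x} {y} {z} h k = Null⇒≈ {x} {z} (null-cong
    (λ n → solve 3 (λ x y z → x :- z := (x :- y) :+ (y :- z)) refl (seq x n) (seq y n) (seq z n))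
    (null-+ (≈⇒Null {x} {y} h) (≈⇒Null {y} {z} k)))

  seq-re-sum : ∀ {n} (f : Fin n → ℂ) (g : Fin n → ℚ) N → (∀ x → seq (re (f x)) N ≡ g x) →
    seq (re (sum ℂ-+-rawMonoid f)) N ≡ sum +-0-rawMonoid g
  seq-re-sum {zero}  f g N f≡g = refl
  seq-re-sum {suc n} f g N f≡g =
    cong₂ _+_ (f≡g zero) (seq-re-sum (λ x → f (suc x)) (λ x → g (suc x)) N (λ x → f≡g (suc x)))

  seq-im-sum : ∀ {n} (f : Fin n → ℂ) (g : Fin n → ℚ) N → (∀ x → seq (im (f x)) N ≡ g x) →
    seq (im (sum ℂ-+-rawMonoid f)) N ≡ sum +-0-rawMonoid g
  seq-im-sum {zero}  f g N f≡g = refl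
  seq-im-sum {suc n} f g N f≡g =
    cong₂ _+_ (f≡g zero) (seq-im-sum (λ x → f (suc x)) (λ x → g (suc x)) N (λ x → f≡g (suc x)))

  seq-re-sumOver : ∀ {n} (S : Subset n) (f : Fin n → ℂ) N →
    seq (re (sumOver ℂ-+-rawMonoid S f)) N ≡ sumOver +-0-rawMonoid S (λ x → seq (re (f x)) N)
  seq-re-sumOver S f N = seq-re-sum (λ x → if lookup S x then f x else RawMonoid.ε ℂ-+-rawMonoid)
    (λ x → if lookup S x then seq (re (f x)) N else 0ℚ) N (λ x → choose (lookup S x) (f x))
    where
    choose : ∀ b z → seq (re (if b then z else RawMonoid.ε ℂ-+-rawMonoid)) N ≡ (if b then seq (re z) N else 0ℚ)
    choose true  z = refl
    choose false z = refl

  seq-im-sumOver : ∀ {n} (S : Subset n) (f : Fin n → ℂ) N →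
    seq (im (sumOver ℂ-+-rawMonoid S f)) N ≡ sumOver +-0-rawMonoid S (λ x → seq (im (f x)) N)
  seq-im-sumOver S f N = seq-im-sum (λ x → if lookup S x then f x else RawMonoid.ε ℂ-+-rawMonoid)
    (λ x → if lookup S x then seq (im (f x)) N else 0ℚ) N (λ x → choose (lookup S x) (f x))
    where
    choose : ∀ b z → seq (im (if b then z else RawMonoid.ε ℂ-+-rawMonoid)) N ≡ (if b then seq (im z) N else 0ℚ)
    choose true  z = refl
    choose false z = refl

  module Eigenvalues (n m c : ℕ) .{{n≢0 : NonZero n}} (n≡m+m : n ≡ m ℕ.+ m) (n/2≡m : n ℕ./ 2 ≡ m)
    (1<c : 1 ℕ.< c) (c<m : c ℕ.< m) (j : Fin n) where

    open Residues n
    open Points n m c n≡m+m n/2≡m 1<c c<m using (S; points; connection; connection-window; points-unique; S⇒points; points⇒S)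
    open SubsetSum +-0-commutativeMonoid using (sumOver-list)

    -- χ j takes the value exp (2 z j π i / n) at the residue of z.
    angle : ℤ → ℚ
    angle z = (z ℤ.* + (2 ℕ.* toℕ j)) / n

    angle-neg : ∀ z → angle (ℤ.- z) ≡ - angle z
    angle-neg z = trans (cong (λ a → a / n) (sym (ℤ.neg-distribˡ-* z (+ (2 ℕ.* toℕ j))))) (/-neg (z ℤ.* + (2 ℕ.* toℕ j)) n)

    angle-m : angle (+ m) ≡ + toℕ j / 1
    angle-m = /-cross (+ m ℤ.* + (2 ℕ.* toℕ j)) (+ toℕ j) n 1 (trans (ℤ.*-identityʳ _)
      (trans (cong (λ z → + m ℤ.* z) (ℤ.pos-* 2 (toℕ j)))
        (trans (ℤ-solve 2 (λ m j → m ⊠ (ℤ-con (+ 2) ⊠ j) ≛ j ⊠ (m ⊞ m)) refl (+ m) (+ toℕ j))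
          (cong (λ k → + toℕ j ℤ.* + k) (sym n≡m+m)))))

    private
      argument : Fin n → ℚ
      argument x = + (2 ℕ.* toℕ x ℕ.* toℕ j) / n

      at-residue : ∀ z → ∃[ k ] argument (residue n (0ℤ ℤ.+ z)) ≡ angle z + (+ 2 ℤ.* k) / 1
      at-residue z with toℕ-residue (0ℤ ℤ.+ z)
      ... | congruent k eq = k ℤ.* + toℕ j , trans
        (cong (λ a → a / n) (trans (ℤ.pos-* (2 ℕ.* toℕ x) (toℕ j)) (trans (cong (ℤ._* + toℕ j) (ℤ.pos-* 2 (toℕ x)))
          (trans (cong (λ t → + 2 ℤ.* t ℤ.* + toℕ j) eq)
            (trans (ℤ-solve 4 (λ z k n j → ℤ-con (+ 2) ⊠ (ℤ-con 0ℤ ⊞ z ⊞ k ⊠ n) ⊠ j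
                                 ≛ z ⊠ (ℤ-con (+ 2) ⊠ j) ⊞ ℤ-con (+ 2) ⊠ (k ⊠ j) ⊠ n) refl z k (+ n) (+ toℕ j))
              (cong (λ t → z ℤ.* t ℤ.+ + 2 ℤ.* (k ℤ.* + toℕ j) ℤ.* + n) (sym (ℤ.pos-* 2 (toℕ j)))))))))
        (/-+-multiple (z ℤ.* + (2 ℕ.* toℕ j)) (+ 2 ℤ.* (k ℤ.* + toℕ j)) n)
        where x = residue n (0ℤ ℤ.+ z)

      value : ∀ z → Null (λ N → cosπ (argument (residue n (0ℤ ℤ.+ z))) N - cosπ (angle z) N)
                  × Null (λ N → sinπ (argument (residue n (0ℤ ℤ.+ z))) N - sinπ (angle z) N)
      value z = let k , eq = at-residue z ; C , S = period-2k k (angle z) in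
        null-cong (λ N → cong (λ q → cosπ q N - cosπ (angle z) N) eq) C ,
        null-cong (λ N → cong (λ q → sinπ q N - sinπ (angle z) N) eq) S

      z₁ z₂ z₃ z₄ z₅ : ℤ
      z₁ = ℤ.- + c
      z₂ = ℤ.- 1ℤ
      z₃ = 1ℤ
      z₄ = + c
      z₅ = + m

      C′ S′ : ℤ → ℕ → ℚ
      C′ z = cosπ (argument (residue n (0ℤ ℤ.+ z)))
      S′ z = sinπ (argument (residue n (0ℤ ℤ.+ z)))

    𝒥-criterion : Null (λ N → 2ℚ * (cosπ (angle 1ℤ) N + cosπ (angle (+ c)) N) + cosπ (angle (+ m)) N + 1ℚ) → 𝒥 n {{n≢0}} (connectionSet n {{n≢0}} c) j
    𝒥-criterion h =
      Null⇒≈ {re (χ-sum n {{n≢0}} j S)} {fromℚ (- 1ℚ)} (null-cong (λ N → cong (λ t → t - (- 1ℚ))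
        (trans (seq-re-sumOver S (χ n {{n≢0}} j) N) (expand (λ x → seq (re (χ n {{n≢0}} j x)) N)))) real) ,
      Null⇒≈ {im (χ-sum n {{n≢0}} j S)} {fromℚ 0ℚ} (null-cong (λ N → cong (λ t → t - 0ℚ)
        (trans (seq-im-sumOver S (χ n {{n≢0}} j) N) (expand (λ x → seq (im (χ n {{n≢0}} j x)) N)))) imaginary)
      where
      expand : ∀ (f : Fin n → ℚ) → sumOver +-0-rawMonoid S f ≡
        foldr (λ p s → f p + s) 0ℚ (points 0ℤ connection)
      expand f = sumOver-list S f (points-unique 0ℤ connection-window) S⇒points points⇒S
      cos-neg : ∀ z N → cosπ (angle (ℤ.- z)) N ≡ cosπ (angle z) N
      cos-neg z N = trans (cong (λ q → cosπ q N) (angle-neg z)) (cosπ-neg (angle z) N)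
      sin-neg : ∀ z N → sinπ (angle (ℤ.- z)) N ≡ - sinπ (angle z) N
      sin-neg z N = trans (cong (λ q → sinπ q N) (angle-neg z)) (sinπ-neg (angle z) N)
      real : Null (λ N → (C′ z₁ N + (C′ z₂ N + (C′ z₃ N + (C′ z₄ N + (C′ z₅ N + 0ℚ))))) - (- 1ℚ))
      real = null-cong
        (λ N → trans
          (solve 8 (λ a₁ a₂ a₃ a₄ a₅ u v w →
            (a₁ :+ (a₂ :+ (a₃ :+ (a₄ :+ (a₅ :+ con 0ℚ))))) :- con (- 1ℚ)
              := ((a₁ :- v) :+ (a₂ :- u)) :+ (((a₃ :- u) :+ (a₄ :- v)) :+ ((a₅ :- w) :+ (con 2ℚ :* (u :+ v) :+ w :+ con 1ℚ)))) refl
            (C′ z₁ N) (C′ z₂ N) (C′ z₃ N) (C′ z₄ N) (C′ z₅ N)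
            (cosπ (angle 1ℤ) N) (cosπ (angle (+ c)) N) (cosπ (angle (+ m)) N))
          (cong₂ (λ s t → ((C′ z₁ N - s) + (C′ z₂ N - t)) + (((C′ z₃ N - cosπ (angle z₃) N) + (C′ z₄ N - cosπ (angle z₄) N))
               + ((C′ z₅ N - cosπ (angle z₅) N)
               + (2ℚ * (cosπ (angle 1ℤ) N + cosπ (angle (+ c)) N) + cosπ (angle (+ m)) N + 1ℚ))))
            (sym (cos-neg (+ c) N)) (sym (cos-neg 1ℤ N))))
        (null-+ (null-+ (proj₁ (value z₁)) (proj₁ (value z₂)))
          (null-+ (null-+ (proj₁ (value z₃)) (proj₁ (value z₄))) (null-+ (proj₁ (value z₅)) h)))
      imaginary : Null (λ N → (S′ z₁ N + (S′ z₂ N + (S′ z₃ N + (S′ z₄ N + (S′ z₅ N + 0ℚ))))) - 0ℚ)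
      imaginary = null-cong
        (λ N → trans
          (solve 8 (λ a₁ a₂ a₃ a₄ a₅ u v w →
            (a₁ :+ (a₂ :+ (a₃ :+ (a₄ :+ (a₅ :+ con 0ℚ))))) :- con 0ℚ
              := ((a₁ :- :- v) :+ (a₂ :- :- u)) :+ (((a₃ :- u) :+ (a₄ :- v)) :+ ((a₅ :- w) :+ w))) refl
            (S′ z₁ N) (S′ z₂ N) (S′ z₃ N) (S′ z₄ N) (S′ z₅ N)
            (sinπ (angle 1ℤ) N) (sinπ (angle (+ c)) N) (sinπ (angle (+ m)) N))
          (cong₂ (λ s t → ((S′ z₁ N - s) + (S′ z₂ N - t)) + (((S′ z₃ N - sinπ (angle z₃) N) + (S′ z₄ N - sinπ (angle z₄) N))
               + ((S′ z₅ N - sinπ (angle z₅) N) + sinπ (angle (+ m)) N)))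
            (sym (sin-neg (+ c) N)) (sym (sin-neg 1ℤ N))))
        (null-+ (null-+ (proj₂ (value z₁)) (proj₂ (value z₂)))
          (null-+ (null-+ (proj₂ (value z₃)) (proj₂ (value z₄))) (null-+ (proj₂ (value z₅))
            (null-cong (λ N → cong (λ q → sinπ q N) angle-m) (sinπ-integer (toℕ j))))))

    module _ {d} (d-odd : ¬ 2 ∣ d) (j-odd : ¬ 2 ∣ toℕ j) (eq : 2 ℕ.* suc c ℕ.* toℕ j ≡ d ℕ.* n) where

      type3⁺ : Type3⁺ n {{n≢0}} c j
      type3⁺ = j-odd , + l , /-cross (+ toℕ j) (+ n ℤ.* (+ 2 ℤ.* + l ℤ.+ 1ℤ)) 1 (2 ℕ.* suc c)
        (trans (sym (ℤ.pos-* (toℕ j) (2 ℕ.* suc c))) (trans (cong +_ (trans (ℕ.*-comm (toℕ j) (2 ℕ.* suc c)) (trans eq (ℕ.*-comm d n))))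
          (trans (ℤ.pos-* n d) (trans (cong (λ z → + n ℤ.* z) d≡) (sym (ℤ.*-identityʳ _))))))
        where
        l = proj₁ (odd-half d-odd)
        d≡ = proj₂ (odd-half d-odd)

      -- The angles at 1 and c add up to an odd multiple of π, so their cosines cancel.
      type3⁺-𝒥 : 𝒥 n {{n≢0}} (connectionSet n {{n≢0}} c) j
      type3⁺-𝒥 = 𝒥-criterion (null-cong
        (λ N → trans
          (cong₂ (λ p q → 2ℚ * (cosπ (angle 1ℤ) N + cosπ p N) + cosπ q N + 1ℚ) angle-c angle-m)
          (trans (solve 3 (λ u v w → con 2ℚ :* (u :+ v) :+ w :+ con 1ℚ := con 2ℚ :* (v :+ u) :+ (w :+ con 1ℚ)) refl
                   (cosπ (angle 1ℤ) N) (cosπ (- angle 1ℤ + + d / 1) N) (cosπ (+ toℕ j / 1) N))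
            (cong (λ t → 2ℚ * (cosπ (- angle 1ℤ + + d / 1) N + t) + (cosπ (+ toℕ j / 1) N + 1ℚ)) (sym (cosπ-neg (angle 1ℤ) N)))))
        (null-+ (null-*ᶜ 2ℚ (proj₁ (odd-antiperiod d-odd (- angle 1ℤ)))) (cosπ-odd j-odd)))
        where
        angle-c : angle (+ c) ≡ - angle 1ℤ + + d / 1
        angle-c = trans (cong (λ a → a / n) (trans
            (ℤ-solve 2 (λ c j → c ⊠ j ≛ ⊟ (ℤ-con 1ℤ ⊠ j) ⊞ (ℤ-con 1ℤ ⊞ c) ⊠ j) refl (+ c) (+ (2 ℕ.* toℕ j)))
            (cong (λ z → ℤ.- (1ℤ ℤ.* + (2 ℕ.* toℕ j)) ℤ.+ z)
              (trans (sym (ℤ.pos-* (suc c) (2 ℕ.* toℕ j))) (trans (cong +_ nat) (ℤ.pos-* d n))))))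
          (trans (/-+-multiple (ℤ.- (1ℤ ℤ.* + (2 ℕ.* toℕ j))) (+ d) n)
            (cong (λ q → q + + d / 1) (/-neg (1ℤ ℤ.* + (2 ℕ.* toℕ j)) n)))
          where
          nat : suc c ℕ.* (2 ℕ.* toℕ j) ≡ d ℕ.* n
          nat = trans (trans (sym (ℕ.*-assoc (suc c) 2 (toℕ j))) (cong (ℕ._* toℕ j) (ℕ.*-comm (suc c) 2))) eq

    module _ {a} (n≡a*3 : n ≡ a ℕ.* 3) (j≡a : toℕ j ≡ a) (3∤c : ¬ 3 ∣ c) where

      j-even : 2 ∣ toℕ j
      j-even = subst (2 ∣_) (sym j≡a) (∣m+n∣m⇒∣n
        (divides m (trans (ℕ.+-comm (a ℕ.* 2) a) (trans (sym (ℕ.*-suc a 2)) (trans (sym n≡a*3) (trans n≡m+m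
          (trans (cong (m ℕ.+_) (sym (ℕ.+-identityʳ m))) (ℕ.*-comm 2 m)))))))
        (n∣m*n a {2}))

      two-thirds : ∀ b → (+ (2 ℕ.* toℕ j ℕ.* b)) / n ≡ (+ (2 ℕ.* b)) / 3
      two-thirds b = /-cross (+ (2 ℕ.* toℕ j ℕ.* b)) (+ (2 ℕ.* b)) n 3
        (trans (sym (ℤ.pos-* (2 ℕ.* toℕ j ℕ.* b) 3)) (trans (cong +_ nat) (ℤ.pos-* (2 ℕ.* b) n)))
        where
        nat : 2 ℕ.* toℕ j ℕ.* b ℕ.* 3 ≡ 2 ℕ.* b ℕ.* n
        nat = trans (cong (λ k → 2 ℕ.* k ℕ.* b ℕ.* 3) j≡a) (trans (trans (cong (ℕ._* 3) (trans (ℕ.*-assoc 2 a b)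
          (trans (cong (2 ℕ.*_) (ℕ.*-comm a b)) (sym (ℕ.*-assoc 2 b a))))) (ℕ.*-assoc (2 ℕ.* b) a 3)) (cong (2 ℕ.* b ℕ.*_) (sym n≡a*3)))

      c-angle : ∃[ s ] ∃[ k ] (+ (2 ℕ.* toℕ j ℕ.* c)) / n ≡ (s ℤ.◃ 2) / 3 + (+ 2 ℤ.* k) / 1
      c-angle with c ℕ.% 3 | c ℕ./ 3 | ℕ.m≡m%n+[m/n]*n c 3 | ℕ.m%n<n c 3
      ... | 0 | q | c≡ | _ = contradiction (divides q c≡) 3∤c
      ... | 1 | q | c≡ | _ = Sign.+ , + q , trans (two-thirds c) (trans
        (cong (λ z → z / 3) (trans (cong (λ k → + (2 ℕ.* k)) c≡) (trans (ℤ.pos-* 2 (suc (q ℕ.* 3)))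
          (trans (cong (λ z → + 2 ℤ.* (1ℤ ℤ.+ z)) (ℤ.pos-* q 3))
            (ℤ-solve 1 (λ q → ℤ-con (+ 2) ⊠ (ℤ-con 1ℤ ⊞ q ⊠ ℤ-con (+ 3)) ≛ ℤ-con (+ 2) ⊞ ℤ-con (+ 2) ⊠ q ⊠ ℤ-con (+ 3)) refl (+ q))))))
        (/-+-multiple (+ 2) (+ 2 ℤ.* + q) 3))
      ... | 2 | q | c≡ | _ = Sign.- , + suc q , trans (two-thirds c) (trans
        (cong (λ z → z / 3) (trans (cong (λ k → + (2 ℕ.* k)) c≡) (trans (ℤ.pos-* 2 (suc (suc (q ℕ.* 3))))
          (trans (cong (λ z → + 2 ℤ.* (+ 2 ℤ.+ z)) (ℤ.pos-* q 3))
            (ℤ-solve 1 (λ q → ℤ-con (+ 2) ⊠ (ℤ-con (+ 2) ⊞ q ⊠ ℤ-con (+ 3))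
                ≛ ℤ-con (ℤ.- + 2) ⊞ ℤ-con (+ 2) ⊠ (ℤ-con 1ℤ ⊞ q) ⊠ ℤ-con (+ 3)) refl (+ q))))))
        (/-+-multiple (ℤ.- + 2) (+ 2 ℤ.* + suc q) 3))
      ... | suc (suc (suc _)) | _ | _ | ℕ.s≤s (ℕ.s≤s (ℕ.s≤s ()))

      type2 : Type2 n {{n≢0}} c j
      type2 = j-even , Sign.+ , proj₁ c-angle , 0ℤ , proj₁ (proj₂ c-angle) , λ x →
          mk⇔ (λ { (inj₁ h) → inj₁ (≈-trans {x} {A} {C} h A≈C) ; (inj₂ h) → inj₂ (≈-trans {x} {B} {D} h B≈D) })
              (λ { (inj₁ h) → inj₁ (≈-trans {x} {C} {A} h (≈-sym {A} {C} A≈C))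
                 ; (inj₂ h) → inj₂ (≈-trans {x} {D} {B} h (≈-sym {B} {D} B≈D)) })
        where
        A B C D : ℝ
        A = (+ (2 ℕ.* toℕ j) / n) · π
        B = (+ (2 ℕ.* toℕ j ℕ.* c) / n) · π
        C = twoThirdsπ Sign.+ 0ℤ
        D = twoThirdsπ (proj₁ c-angle) (proj₁ (proj₂ c-angle))
        A≈C : A ≈ C
        A≈C = ≈-pointwise {A} {C} (λ N → trans
          (cong (λ q → q * seq π N) (trans (cong (λ k → (+ k) / n) (sym (ℕ.*-identityʳ (2 ℕ.* toℕ j)))) (two-thirds 1)))
          (solve 1 (λ p → con (+ 2 / 3) :* p := con (+ 2 / 3) :* p :+ con 0ℚ :* p) refl (seq π N)))
        B≈D : B ≈ D
        B≈D = ≈-pointwise {B} {D} (λ N → trans (cong (λ q → q * seq π N) (proj₂ (proj₂ c-angle)))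
          (*-distribʳ-+ (seq π N) ((proj₁ c-angle ℤ.◃ 2) / 3) ((+ 2 ℤ.* proj₁ (proj₂ c-angle)) / 1)))

      type2-𝒥 : 𝒥 n {{n≢0}} (connectionSet n {{n≢0}} c) j
      type2-𝒥 = 𝒥-criterion (null-cong
        (λ N → trans
          (cong₂ (λ p q → 2ℚ * (p + q) + cosπ (angle (+ m)) N + 1ℚ) (cong (λ q → cosπ q N) angle-1) (cong (λ q → cosπ q N) angle-c))
          (trans (cong (λ q → 2ℚ * (cosπ (+ 2 / 3) N + cosπ c₀ N) + cosπ q N + 1ℚ) angle-m)
            (solve 3 (λ u v w → con 2ℚ :* (u :+ v) :+ w :+ con 1ℚ
                := con 2ℚ :* ((u :+ con ½) :+ (v :+ con ½)) :+ (w :- con 1ℚ)) refl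
              (cosπ (+ 2 / 3) N) (cosπ c₀ N) (cosπ (+ toℕ j / 1) N))))
        (null-+ (null-*ᶜ 2ℚ (null-+ cosπ-⅔ at-c)) (cosπ-even j-even)))
        where
        s = proj₁ c-angle
        k = proj₁ (proj₂ c-angle)
        c₀ : ℚ
        c₀ = (s ℤ.◃ 2) / 3 + (+ 2 ℤ.* k) / 1
        angle-1 : angle 1ℤ ≡ + 2 / 3
        angle-1 = trans (cong (λ z → z / n) (trans (ℤ.*-identityˡ _) (cong +_ (sym (ℕ.*-identityʳ (2 ℕ.* toℕ j)))))) (two-thirds 1)
        angle-c : angle (+ c) ≡ c₀
        angle-c = trans (cong (λ z → z / n) (trans (sym (ℤ.pos-* c (2 ℕ.* toℕ j))) (cong +_ (ℕ.*-comm c (2 ℕ.* toℕ j)))))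
          (proj₂ (proj₂ c-angle))
        signed : ∀ s → Null (λ N → cosπ ((s ℤ.◃ 2) / 3) N + ½)
        signed Sign.+ = cosπ-⅔
        signed Sign.- = null-cong (λ N → cong (λ z → z + ½) (cosπ-neg (+ 2 / 3) N)) cosπ-⅔
        at-c : Null (λ N → cosπ c₀ N + ½)
        at-c = null-cong (λ N → solve 2 (λ x y → x :+ con ½ := (x :- y) :+ (y :+ con ½)) refl (cosπ c₀ N) (cosπ ((s ℤ.◃ 2) / 3) N))
          (null-+ (proj₁ (period-2k k ((s ℤ.◃ 2) / 3))) (signed s))

  record ReducedFraction (m k : ℕ) : Set where
    field
      e m′ k′       : ℕ
      m≡            : m ≡ m′ ℕ.* e
      k≡            : k ≡ k′ ℕ.* e
      not-both-even : 2 ∣ m′ → ¬ 2 ∣ k′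

  reduce : ∀ m k → 0 ℕ.< m → ReducedFraction m k
  reduce m k 0<m = from-gcd (gcd m k) (gcd[m,n]∣m m k) (gcd[m,n]∣n m k) (gcd-greatest)
    where
    from-gcd : ∀ e → e ∣ m → e ∣ k → (∀ {f} → f ∣ m → f ∣ k → f ∣ e) → ReducedFraction m k
    from-gcd e (divides m′ m≡) (divides k′ k≡) greatest = record
      { e = e ; m′ = m′ ; k′ = k′ ; m≡ = m≡ ; k≡ = k≡
      ; not-both-even = λ 2∣m′ 2∣k′ → ℕ.<⇒≱ (ℕ.m<m*n e 2 {{ℕ.>-nonZero 0<e}} (ℕ.s≤s (ℕ.s≤s ℕ.z≤n)))
          (subst (ℕ._≤ e) (ℕ.*-comm 2 e) (∣⇒≤ {{ℕ.>-nonZero 0<e}} (greatest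
            (subst (2 ℕ.* e ∣_) (sym m≡) (*-monoˡ-∣ e 2∣m′)) (subst (2 ℕ.* e ∣_) (sym k≡) (*-monoˡ-∣ e 2∣k′)))))
      }
      where
      0<e : 0 ℕ.< e
      0<e = ℕ.n≢0⇒n>0 (λ e≡0 → ℕ.m<n⇒n≢0 0<m (trans m≡ (trans (cong (m′ ℕ.*_) e≡0) (ℕ.*-zeroʳ m′))))

  module _ (n m c : ℕ) .{{n≢0 : NonZero n}} (n≡m+m : n ≡ m ℕ.+ m) (n/2≡m : n ℕ./ 2 ≡ m)
    (1<c : 1 ℕ.< c) (c<m : c ℕ.< m) (fraction : ReducedFraction m (suc c)) where

    open ReducedFraction fraction renaming (k′ to d′; k≡ to c+1≡)

    private
      0<m : 0 ℕ.< m
      0<m = ℕ.≤-<-trans ℕ.z≤n c<m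

      TypedEigenvalue : Set
      TypedEigenvalue = ∃[ j ] 𝒥 n {{n≢0}} (connectionSet n {{n≢0}} c) j × (Type2 n {{n≢0}} c j ⊎ Type3⁺ n {{n≢0}} c j)

      type2-eigenvalue : 3 ∣ n → ¬ 3 ∣ c → TypedEigenvalue
      type2-eigenvalue (divides a n≡a*3) 3∤c =
        j , type2-𝒥 n≡a*3 (toℕ-fromℕ< a<n) 3∤c , inj₁ (type2 n≡a*3 (toℕ-fromℕ< a<n) 3∤c)
        where
        a<n : a ℕ.< n
        a<n = subst (a ℕ.<_) (sym n≡a*3) (ℕ.m<m*n a 3
          {{ℕ.≢-nonZero (λ a≡0 → ℕ.m<n⇒n≢0 (ℕ.m<m+n m 0<m) (trans (sym n≡m+m) (trans n≡a*3 (cong (ℕ._* 3) a≡0))))}}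
          (ℕ.s≤s (ℕ.s≤s ℕ.z≤n)))
        j = fromℕ< a<n
        open Eigenvalues n m c {{n≢0}} n≡m+m n/2≡m 1<c c<m j

      type3⁺-eigenvalue : ¬ 2 ∣ m′ → ¬ 2 ∣ d′ → TypedEigenvalue
      type3⁺-eigenvalue 2∤m′ 2∤d′ = j , type3⁺-𝒥 2∤d′ j-odd equation , inj₂ (type3⁺ 2∤d′ j-odd equation)
        where
        m′≤m : m′ ℕ.≤ m
        m′≤m = ∣⇒≤ {{ℕ.>-nonZero 0<m}} (divides e (trans m≡ (ℕ.*-comm m′ e)))
        m′<n : m′ ℕ.< n
        m′<n = ℕ.≤-<-trans m′≤m (subst (m ℕ.<_) (sym n≡m+m) (ℕ.m<m+n m 0<m))
        j = fromℕ< m′<n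
        open Eigenvalues n m c {{n≢0}} n≡m+m n/2≡m 1<c c<m j
        j-odd : ¬ 2 ∣ toℕ j
        j-odd = subst (λ k → ¬ 2 ∣ k) (sym (toℕ-fromℕ< m′<n)) 2∤m′
        equation : 2 ℕ.* suc c ℕ.* toℕ j ≡ d′ ℕ.* n
        equation = trans (cong₂ (λ s t → 2 ℕ.* s ℕ.* t) c+1≡ (toℕ-fromℕ< m′<n))
          (trans (ℕ-solve 3 (λ d m e → conℕ 2 :*ℕ (d :*ℕ e) :*ℕ m :=ℕ d :*ℕ (m :*ℕ e :+ℕ m :*ℕ e)) refl d′ m′ e)
            (cong (d′ ℕ.*_) (sym (trans n≡m+m (cong₂ ℕ._+_ m≡ m≡)))))
          where
          open ℕ-Solver.+-*-Solver using () renaming (solve to ℕ-solve; _:+_ to _:+ℕ_; _:*_ to _:*ℕ_; con to conℕ; _:=_ to _:=ℕ_)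

    typed-eigenvalue : (OppositeParity m′ d′ → (3 ∣ c) ⊎ (¬ 3 ∣ n) → ⊥) → TypedEigenvalue
    typed-eigenvalue impossible = decide (2 ∣? m′) (2 ∣? d′) (3 ∣? n) (3 ∣? c)
      where
      decide : Dec (2 ∣ m′) → Dec (2 ∣ d′) → Dec (3 ∣ n) → Dec (3 ∣ c) → TypedEigenvalue
      decide (yes 2∣m′) (yes 2∣d′) _         _         = contradiction 2∣d′ (not-both-even 2∣m′)
      decide (no 2∤m′)  (no 2∤d′)  _         _         = type3⁺-eigenvalue 2∤m′ 2∤d′
      decide _          _          (yes 3∣n) (no 3∤c)  = type2-eigenvalue 3∣n 3∤c
      decide (yes 2∣m′) (no 2∤d′)  (no 3∤n)  _         = ⊥-elim (impossible (inj₁ (2∣m′ , 2∤d′)) (inj₂ 3∤n))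
      decide (yes 2∣m′) (no 2∤d′)  (yes _)   (yes 3∣c) = ⊥-elim (impossible (inj₁ (2∣m′ , 2∤d′)) (inj₁ 3∣c))
      decide (no 2∤m′)  (yes 2∣d′) (no 3∤n)  _         = ⊥-elim (impossible (inj₂ (2∤m′ , 2∣d′)) (inj₂ 3∤n))
      decide (no 2∤m′)  (yes 2∣d′) (yes _)   (yes 3∣c) = ⊥-elim (impossible (inj₂ (2∤m′ , 2∣d′)) (inj₁ 3∣c))

open import Defs
open import Data.Integer.Base using () renaming (+_ to pos)
open import Data.Nat.Base using (ℕ; NonZero; _≤_; _<_; _/_; _+_; suc; z≤n; s≤s)
open import Data.Nat.Divisibility using (_∣_; divides)
import Data.Nat.DivMod as ℕ
import Data.Nat.Properties as ℕ
open import Data.Product.Base using (∃-syntax; _×_; _,_)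
open import Data.Sum.Base using (_⊎_)
open import Relation.Binary.PropositionalEquality using (_≡_; trans; cong; subst)
open EigenvalueTypes
open Magic using (magic-contradiction)
open Subsets using (module Points)

proposition4p3 : (n : ℕ) .{{_ : NonZero n}} → 6 ≤ n → 2 ∣ n →
    (c : ℕ) → 1 < c → c < n / 2 →
    ClosedDistanceMagic (Cay n (connectionSet n c)) →
    ∃[ j ] 𝒥 n (connectionSet n c) j × (Type2 n c j ⊎ Type3⁺ n c j)
proposition4p3 n {{n≢0}} _ (divides m n≡m*2) (suc p) 1<c@(s≤s 0<p) c<n/2 (ℓ , r , _ , magic) =
  typed-eigenvalue n m (suc p) {{n≢0}} n≡m+m n/2≡m 1<c c<m fraction λ opposite not-type-2 →
    magic-contradiction n m p {{n≢0}} n≡m+m 0<p c<m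
      (labels ℓ) (labels-periodic ℓ) (labels-injective ℓ) (pos r) (labels-magic ℓ magic)
      e m′ k′ m≡ k≡ opposite not-type-2
  where
  n/2≡m : n / 2 ≡ m
  n/2≡m = trans (ℕ./-congˡ n≡m*2) (ℕ.m*n/n≡m m 2)
  n≡m+m : n ≡ m + m
  n≡m+m = trans n≡m*2 (trans (ℕ.*-comm m 2) (cong (m +_) (ℕ.+-identityʳ m)))
  c<m : suc p < m
  c<m = subst (suc p <_) n/2≡m c<n/2
  fraction : ReducedFraction m (suc (suc p))
  fraction = reduce m (suc (suc p)) (ℕ.≤-<-trans z≤n c<m)
  open ReducedFraction fraction
  open Points n m (suc p) {{n≢0}} n≡m+m n/2≡m 1<c c<m using (labels; labels-periodic; labels-injective; labels-magic)
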